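{- There exist constants $c,C>0$, an integer $n_0$, and a family of pairs of non-isomorphic simple undirected graphs $(G_n,H_n)_{n\ge n_0}$, where for each $n$ the graphs $G_n$ and $H_n$ have a common vertex set $\{1,\dots,N_n\}$ with $N_n\le Cn$, such that the Sherali-Adams procedure applied to $\mathcal T_{G_n,H_n}$ and to $\mathcal Q_{G_n,H_n}$ needs $\Omega(n)$ iterations to converge to $\operatorname{conv}(\Psi_{G_n,H_n})=\emptyset$; that is, for every $n\ge n_0$, every $k\ge1$ with $\mathcal T^k_{G_n,H_n}=\emptyset$ satisfies $k\ge cn$, and every $k\ge 1$ with $\mathcal Q^k_{G_n,H_n}=\emptyset$ satisfies $k\ge cn$.
   Context: For graphs $G,H$ on a vertex set $V=\{1,\dots,N\}$: $E_G$ is the edge set of $G$, $A_G$ its adjacency matrix, $e$ the all-ones vector, and $\Psi_{G,H}$ is the set of permutation matrices $X$ representing isomorphisms $\psi$ from $G$ to $H$ ($X_{uv}=1$ iff $\psi(u)=v$). $$\mathcal T_{G,H}=\{X\in[0,1]^{N\times N}: A_GX=XA_H,\ Xe=X^Te=e\}.$$ $\mathcal Q_{G,H}$ is the set of $X\in[0,1]^{N\times N}$ with $Xe=X^Te=e$, $X_{u_1v_1}X_{u_2v_2}=0$ for all $\{u_1,u_2\}\in E_G,\{v_1,v_2\}\notin E_H$, and $X_{u_1v_1}X_{u_2v_2}=0$ for all $\{u_1,u_2\}\notin E_G$, $\{v_1,v_2\}\in E_H$ (here $u_1=u_2$ counts as $\{u_1,u_2\}\notin E_G$, and $v_1=v_2$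 as $\{v_1,v_2\}\notin E_H$). **Sherali-Adams relaxations.** For $P=\{x\in[0,1]^M: f_j(x)=0\ (1\le j\le s),\ g_j(x)\ge 0\ (1\le j\le t)\}$ with polynomials $f_j,g_j$, the $k$th Sherali-Adams relaxation $P^k$ is obtained as follows. Form the constraints $\prod_{i\in I}x_i\, f_j(x)=0$ for all $I\subseteq\{1,\dots,M\}$, $|I|\le k-1$ and all $j$; $\prod_{i\in I}x_i\prod_{i\in J\setminus I}(1-x_i)\,g_j(x)\ge0$ for all $I\subseteq J$, $|J|\le k-1$ and all $j$; and $\prod_{i\in I}x_i\prod_{i\in J\setminus I}(1-x_i)\ge 0$ for all $I\subseteq J$, $|J|\le k$. Expand, replace every $x_i^2$ by $x_i$ repeatedly until all monomials are square-free, and replace each monomial $\prod_{i\in I}x_i$ with $|I|\ge 1$ by a new variable $y_I$ (and the empty monomial by $1$). This gives a polyhedron $\hat P^k$ in $y$-space, and $P^k=\{x: x_i=y_{\{i\}}\ \forall i,\ y\in\hat P^k\}$. The $f_j$ are the row-sum and column-sum equations together with the entries of $A_GX-XA_H$ (for $\mathcal T_{G,H}$) or the quadratic equations (for $\mathcal Q_{G,H}$); there are no $g_j$. $\mathcal T^k_{G,H}$, $\mathcal Q^k_{G,H}$ denote the $k$th relaxations. -}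

module Defs where

open import Data.Bool.Base using (Bool; true; false; if_then_else_)
open import Data.Empty using (⊥)
open import Data.Fin.Base using (Fin; combine)
open import Data.Fin.Permutation using (Permutation′; _⟨$⟩ʳ_)
open import Data.Fin.Properties using (_≟_)
open import Data.Fin.Subset using (Subset; ∣_∣; _⊆_; _─_; ⁅_⁆)
open import Data.Fin.Subset.Properties using (nonempty?)
import Data.Integer.Base as ℤ
open import Data.List.Base using (List; []; _∷_; _++_; cartesianProductWith)
open import Data.Nat.Base as ℕ using (ℕ)
import Data.Nat.Properties as ℕ
open import Data.Product.Base using (Σ-syntax; ∃-syntax; _×_; _,_)
open import Data.Rational.Base as ℚ using (ℚ; 0ℚ; 1ℚ; ½)
import Data.Rational.Properties as ℚ
open import Data.Rational.Solver using (module +-*-Solver)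
open import Data.Vec.Base as Vec using (Vec; lookup; _[_]≔_)
open import Data.Vec.Functional using (Vector; foldr)
open import Level using (0ℓ)
open import Relation.Binary.PropositionalEquality
open import Relation.Nullary.Decidable.Core using (does)
open import Relation.Unary using (Pred; _∈_)

------------------------------------------------------------------------
-- Real numbers as Cauchy sequences of rationals, with the equality _≈_

IsCauchy : (ℕ → ℚ) → Set
IsCauchy x = ∀ ε → 0ℚ ℚ.< ε → ∃[ K ] ∀ m n → K ℕ.≤ m → K ℕ.≤ n →
             ℚ.∣ x m ℚ.- x n ∣ ℚ.≤ ε

record ℝ : Set where
  constructor mkℝ
  field
    seq    : ℕ → ℚ
    cauchy : IsCauchy seq

open ℝ public

infixl 7 _*ℝ_
infixl 6 _+ℝ_
infix  4 _≤ℝ_ _<ℝ_ _≈_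

_≤ℝ_ : ℝ → ℝ → Set
x ≤ℝ y = ∀ ε → 0ℚ ℚ.< ε → ∃[ K ] ∀ n → K ℕ.≤ n → seq x n ℚ.≤ seq y n ℚ.+ ε

_<ℝ_ : ℝ → ℝ → Set
x <ℝ y = ∃[ ε ] 0ℚ ℚ.< ε × (∃[ K ] ∀ n → K ℕ.≤ n → seq x n ℚ.+ ε ℚ.≤ seq y n)

_≈_ : ℝ → ℝ → Set
x ≈ y = x ≤ℝ y × y ≤ℝ x

private
  abstract
    half-pos : ∀ {ε} → 0ℚ ℚ.< ε → 0ℚ ℚ.< ε ℚ.* ½
    half-pos {ε} 0<ε =
      ℚ.positive⁻¹ _ {{ℚ.pos*pos⇒pos ε {{ℚ.positive 0<ε}} ½}}

    halves : ∀ ε → ε ℚ.* ½ ℚ.+ ε ℚ.* ½ ≡ ε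
    halves ε = trans (sym (ℚ.*-distribˡ-+ ε ½ ½)) (ℚ.*-identityʳ ε)

    ∣p∣≤∣p-q∣+∣q∣ : ∀ p q → ℚ.∣ p ∣ ℚ.≤ ℚ.∣ p ℚ.- q ∣ ℚ.+ ℚ.∣ q ∣
    ∣p∣≤∣p-q∣+∣q∣ p q = subst (λ r → ℚ.∣ r ∣ ℚ.≤ ℚ.∣ p ℚ.- q ∣ ℚ.+ ℚ.∣ q ∣)
      (solve 2 (λ a b → (a :- b) :+ b := a) refl p q)
      (ℚ.∣p+q∣≤∣p∣+∣q∣ (p ℚ.- q) q)
      where open +-*-Solver

    +-cauchy : ∀ {x y} → IsCauchy x → IsCauchy y → IsCauchy (λ n → x n ℚ.+ y n)
    +-cauchy {x} {y} cx cy ε 0<ε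
      with cx (ε ℚ.* ½) (half-pos 0<ε) | cy (ε ℚ.* ½) (half-pos 0<ε)
    ... | K , hK | L , hL = K ℕ.⊔ L , λ m n p q → begin
      ℚ.∣ (x m ℚ.+ y m) ℚ.- (x n ℚ.+ y n) ∣
        ≡⟨ cong ℚ.∣_∣ (solve 4 (λ a b c d →
             (a :+ b) :- (c :+ d) := (a :- c) :+ (b :- d)) refl (x m) (y m) (x n) (y n)) ⟩
      ℚ.∣ (x m ℚ.- x n) ℚ.+ (y m ℚ.- y n) ∣
        ≤⟨ ℚ.∣p+q∣≤∣p∣+∣q∣ (x m ℚ.- x n) (y m ℚ.- y n) ⟩
      ℚ.∣ x m ℚ.- x n ∣ ℚ.+ ℚ.∣ y m ℚ.- y n ∣
        ≤⟨ ℚ.+-mono-≤ (hK m n (ℕ.m⊔n≤o⇒m≤o K L p) (ℕ.m⊔n≤o⇒m≤o K L q))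
                      (hL m n (ℕ.m⊔n≤o⇒n≤o K L p) (ℕ.m⊔n≤o⇒n≤o K L q)) ⟩
      ε ℚ.* ½ ℚ.+ ε ℚ.* ½
        ≡⟨ halves ε ⟩
      ε ∎
      where
      open ℚ.≤-Reasoning
      open +-*-Solver

    eventually-bounded : ∀ {x} → IsCauchy x →
      ∃[ B ] ℚ.Positive B × (∃[ K ] ∀ n → K ℕ.≤ n → ℚ.∣ x n ∣ ℚ.≤ B)
    eventually-bounded {x} cx with cx 1ℚ (ℚ.positive⁻¹ 1ℚ)
    ... | K , hK = 1ℚ ℚ.+ ℚ.∣ x K ∣
      , ℚ.pos+nonNeg⇒pos 1ℚ ℚ.∣ x K ∣ {{ℚ.nonNegative (ℚ.0≤∣p∣ (x K))}}
      , K , λ n K≤n → ℚ.≤-trans (∣p∣≤∣p-q∣+∣q∣ (x n) (x K))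
                        (ℚ.+-monoˡ-≤ ℚ.∣ x K ∣ (hK n K K≤n ℕ.≤-refl))

    scaled : ∀ {ε} B → ℚ.Positive B → 0ℚ ℚ.< ε →
             ∃[ δ ] 0ℚ ℚ.< δ × B ℚ.* δ ≡ ε
    scaled {ε} B B>0 0<ε = (ℚ.1/ B) ℚ.* ε
      , ℚ.positive⁻¹ _ {{ℚ.pos*pos⇒pos (ℚ.1/ B) {{ℚ.1/pos⇒pos B {{B>0}}}} ε {{ℚ.positive 0<ε}}}}
      , trans (sym (ℚ.*-assoc B (ℚ.1/ B) ε))
              (trans (cong (ℚ._* ε) (ℚ.*-inverseʳ B)) (ℚ.*-identityˡ ε))
      where instance
        B≢0 : ℚ.NonZero B
        B≢0 = ℚ.pos⇒nonZero B {{B>0}}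

    ∣p*q∣≤ : ∀ {p q b d} → ℚ.Positive b → ℚ.∣ p ∣ ℚ.≤ b → ℚ.∣ q ∣ ℚ.≤ d →
             ℚ.∣ p ℚ.* q ∣ ℚ.≤ b ℚ.* d
    ∣p*q∣≤ {p} {q} {b} {d} b>0 p≤b q≤d = begin
      ℚ.∣ p ℚ.* q ∣       ≡⟨ ℚ.∣p*q∣≡∣p∣*∣q∣ p q ⟩
      ℚ.∣ p ∣ ℚ.* ℚ.∣ q ∣ ≤⟨ ℚ.*-monoʳ-≤-nonNeg ℚ.∣ q ∣ {{ℚ.nonNegative (ℚ.0≤∣p∣ q)}} p≤b ⟩
      b ℚ.* ℚ.∣ q ∣       ≤⟨ ℚ.*-monoˡ-≤-nonNeg b {{ℚ.pos⇒nonNeg b {{b>0}}}} q≤d ⟩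
      b ℚ.* d             ∎
      where open ℚ.≤-Reasoning

    *-step : ∀ a b c d {B D δ η ε} → ℚ.Positive B → ℚ.Positive D →
             B ℚ.* δ ≡ ε ℚ.* ½ → D ℚ.* η ≡ ε ℚ.* ½ →
             ℚ.∣ a ∣ ℚ.≤ B → ℚ.∣ d ∣ ℚ.≤ D →
             ℚ.∣ b ℚ.- d ∣ ℚ.≤ δ → ℚ.∣ a ℚ.- c ∣ ℚ.≤ η →
             ℚ.∣ a ℚ.* b ℚ.- c ℚ.* d ∣ ℚ.≤ ε
    *-step a b c d {B} {D} {δ} {η} {ε} B>0 D>0 Bδ Dη a≤B d≤D b-d≤δ a-c≤η = begin
      ℚ.∣ a ℚ.* b ℚ.- c ℚ.* d ∣
        ≡⟨ cong ℚ.∣_∣ (rearrange a b c d) ⟩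
      ℚ.∣ a ℚ.* (b ℚ.- d) ℚ.+ d ℚ.* (a ℚ.- c) ∣
        ≤⟨ ℚ.∣p+q∣≤∣p∣+∣q∣ (a ℚ.* (b ℚ.- d)) (d ℚ.* (a ℚ.- c)) ⟩
      ℚ.∣ a ℚ.* (b ℚ.- d) ∣ ℚ.+ ℚ.∣ d ℚ.* (a ℚ.- c) ∣
        ≤⟨ ℚ.+-mono-≤ (∣p*q∣≤ {a} {b ℚ.- d} B>0 a≤B b-d≤δ)
                      (∣p*q∣≤ {d} {a ℚ.- c} D>0 d≤D a-c≤η) ⟩
      B ℚ.* δ ℚ.+ D ℚ.* η
        ≡⟨ cong₂ ℚ._+_ Bδ Dη ⟩
      ε ℚ.* ½ ℚ.+ ε ℚ.* ½
        ≡⟨ halves ε ⟩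
      ε ∎
      where
      open ℚ.≤-Reasoning
      rearrange : ∀ a b c d → a ℚ.* b ℚ.- c ℚ.* d ≡ a ℚ.* (b ℚ.- d) ℚ.+ d ℚ.* (a ℚ.- c)
      rearrange = solve 4 (λ a b c d →
        a :* b :- c :* d := a :* (b :- d) :+ d :* (a :- c)) refl
        where open +-*-Solver

    *-cauchy : ∀ {x y} → IsCauchy x → IsCauchy y → IsCauchy (λ n → x n ℚ.* y n)
    *-cauchy {x} {y} cx cy ε 0<ε =
      let B , B>0 , K₁ , hB = eventually-bounded cx
          D , D>0 , K₂ , hD = eventually-bounded cy
          δ , 0<δ , Bδ = scaled B B>0 (half-pos 0<ε)
          η , 0<η , Dη = scaled D D>0 (half-pos 0<ε)
          K₃ , hy = cy δ 0<δ
          K₄ , hx = cx η 0<η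
          L₁ = K₁ ℕ.⊔ K₂
          L₂ = K₃ ℕ.⊔ K₄
      in L₁ ℕ.⊔ L₂ , λ m n p q →
         *-step (x m) (y m) (x n) (y n) B>0 D>0 Bδ Dη
           (hB m (ℕ.m⊔n≤o⇒m≤o K₁ K₂ (ℕ.m⊔n≤o⇒m≤o L₁ L₂ p)))
           (hD n (ℕ.m⊔n≤o⇒n≤o K₁ K₂ (ℕ.m⊔n≤o⇒m≤o L₁ L₂ q)))
           (hy m n (ℕ.m⊔n≤o⇒m≤o K₃ K₄ (ℕ.m⊔n≤o⇒n≤o L₁ L₂ p)) (ℕ.m⊔n≤o⇒m≤o K₃ K₄ (ℕ.m⊔n≤o⇒n≤o L₁ L₂ q)))
           (hx m n (ℕ.m⊔n≤o⇒n≤o K₃ K₄ (ℕ.m⊔n≤o⇒n≤o L₁ L₂ p)) (ℕ.m⊔n≤o⇒n≤o K₃ K₄ (ℕ.m⊔n≤o⇒n≤o L₁ L₂ q)))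

fromℚ : ℚ → ℝ
fromℚ q = mkℝ (λ _ → q) λ ε 0<ε → 0 , λ _ _ _ _ →
  subst (ℚ._≤ ε) (sym (cong ℚ.∣_∣ (ℚ.+-inverseʳ q))) (ℚ.<⇒≤ 0<ε)

fromℕ : ℕ → ℝ
fromℕ n = fromℚ (ℤ.+ n ℚ./ 1)

0ℝ 1ℝ -1ℝ : ℝ
0ℝ  = fromℚ 0ℚ
1ℝ  = fromℚ 1ℚ
-1ℝ = fromℚ (ℚ.- 1ℚ)

_+ℝ_ : ℝ → ℝ → ℝ
x +ℝ y = mkℝ (λ n → seq x n ℚ.+ seq y n) (+-cauchy {seq x} {seq y} (cauchy x) (cauchy y))

_*ℝ_ : ℝ → ℝ → ℝ
x *ℝ y = mkℝ (λ n → seq x n ℚ.* seq y n) (*-cauchy {seq x} {seq y} (cauchy x) (cauchy y))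

∑ℝ : ∀ {n} → Vector ℝ n → ℝ
∑ℝ = foldr _+ℝ_ 0ℝ

Conv : ∀ {M} → Pred (Vector ℝ M) 0ℓ → Pred (Vector ℝ M) 0ℓ
Conv S x = ∃[ m ] Σ[ w ∈ Vector ℝ m ] Σ[ p ∈ Vector (Vector ℝ _) m ]
  (∀ j → 0ℝ ≤ℝ w j) × (∑ℝ w ≈ 1ℝ) × (∀ j → p j ∈ S) ×
  (∀ i → x i ≈ ∑ℝ λ j → w j *ℝ p j i)

------------------------------------------------------------------------
-- Polynomials in M variables over ℝ

-- A term is a coefficient together with the exponent of each variable.  Like
-- terms are not collected.
Polynomial : ℕ → Set
Polynomial M = List (ℝ × Vec ℕ M)

module _ {M : ℕ} where

  infixl 7 _*ₚ_
  infixl 6 _+ₚ_ _-ₚ_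

  constₚ : ℝ → Polynomial M
  constₚ c = (c , Vec.replicate M 0) ∷ []

  var : Fin M → Polynomial M
  var i = (1ℝ , Vec.replicate M 0 [ i ]≔ 1) ∷ []

  mulTerm : ℝ × Vec ℕ M → ℝ × Vec ℕ M → ℝ × Vec ℕ M
  mulTerm (c , d) (c′ , d′) = c *ℝ c′ , Vec.zipWith ℕ._+_ d d′

  _+ₚ_ _*ₚ_ _-ₚ_ : Polynomial M → Polynomial M → Polynomial M
  p +ₚ q = p ++ q
  p *ₚ q = cartesianProductWith mulTerm p q
  p -ₚ q = p +ₚ constₚ -1ℝ *ₚ q

  ∑ₚ : ∀ {n} → Vector (Polynomial M) n → Polynomial M
  ∑ₚ = foldr _+ₚ_ []

  ∏ₚ : Subset M → (Fin M → Polynomial M) → Polynomial M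
  ∏ₚ S p = foldr _*ₚ_ (constₚ 1ℝ) λ i → if lookup S i then p i else constₚ 1ℝ

------------------------------------------------------------------------
-- Sherali-Adams relaxations

-- The presentation { x ∈ [0,1]ᴹ : f j x = 0 for all j, g j x ≥ 0 for all j }.
record System (M : ℕ) : Set₁ where
  field
    {Eq Ineq} : Set
    f         : Eq → Polynomial M
    g         : Ineq → Polynomial M

module _ {M : ℕ} where

  -- The value of the monomial with variable set I, the empty one being 1; the
  -- coordinate of y at the empty set is never used.
  monomial : (Subset M → ℝ) → Subset M → ℝ
  monomial y I = if does (nonempty? I) then y I else 1ℝ

  -- Replacing xᵢ² by xᵢ until a monomial is square-free leaves exactly the
  -- variables of positive exponent.
  linearize : (Subset M → ℝ) → Polynomial M → ℝ
  linearize y []            = 0ℝ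
  linearize y ((c , d) ∷ p) =
    c *ℝ monomial y (Vec.map (0 ℕ.<ᵇ_) d) +ℝ linearize y p

  ∏x : Subset M → Polynomial M
  ∏x I = ∏ₚ I var

  ∏x∏[1-x] : Subset M → Subset M → Polynomial M
  ∏x∏[1-x] I J = ∏x I *ₚ ∏ₚ (J ─ I) λ i → constₚ 1ℝ -ₚ var i

  record Lifted (P : System M) (k : ℕ) (y : Subset M → ℝ) : Set where
    open System P
    field
      equalities   : ∀ I j → ∣ I ∣ ℕ.≤ k ℕ.∸ 1 →
                     linearize y (∏x I *ₚ f j) ≈ 0ℝ
      inequalities : ∀ I J j → I ⊆ J → ∣ J ∣ ℕ.≤ k ℕ.∸ 1 →
                     0ℝ ≤ℝ linearize y (∏x∏[1-x] I J *ₚ g j)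
      bounds       : ∀ I J → I ⊆ J → ∣ J ∣ ℕ.≤ k →
                     0ℝ ≤ℝ linearize y (∏x∏[1-x] I J)

  SheraliAdams : System M → ℕ → Pred (Vector ℝ M) 0ℓ
  SheraliAdams P k x =
    Σ[ y ∈ (Subset M → ℝ) ] Lifted P k y × (∀ i → x i ≈ y ⁅ i ⁆)

------------------------------------------------------------------------
-- Graph isomorphism

record Graph (N : ℕ) : Set where
  field
    adj    : Fin N → Fin N → Bool
    symm   : ∀ u v → adj u v ≡ adj v u
    irrefl : ∀ u → adj u u ≡ false

open Graph public

module _ {N : ℕ} where

  IsIso : Graph N → Graph N → Permutation′ N → Set
  IsIso G H ψ = ∀ u v → adj G u v ≡ adj H (ψ ⟨$⟩ʳ u) (ψ ⟨$⟩ʳ v)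

  infix 4 _≅_

  _≅_ : Graph N → Graph N → Set
  G ≅ H = ∃[ ψ ] IsIso G H ψ

  -- An N × N matrix X is the vector of length N * N whose entry at
  -- combine u v is X u v.

  Ψ : Graph N → Graph N → Pred (Vector ℝ (N ℕ.* N)) 0ℓ
  Ψ G H X = Σ[ ψ ∈ Permutation′ N ] IsIso G H ψ ×
    (∀ u v → X (combine u v) ≈ (if does (ψ ⟨$⟩ʳ u ≟ v) then 1ℝ else 0ℝ))

  X : Fin N → Fin N → Polynomial (N ℕ.* N)
  X u v = var (combine u v)

  A : Graph N → Fin N → Fin N → ℝ
  A G u v = if adj G u v then 1ℝ else 0ℝ

  rowSum columnSum : Fin N → Polynomial (N ℕ.* N)
  rowSum u    = ∑ₚ (λ v → X u v) -ₚ constₚ 1ℝ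
  columnSum v = ∑ₚ (λ u → X u v) -ₚ constₚ 1ℝ

  data 𝒯-Eq : Set where
    row column : Fin N → 𝒯-Eq
    entry      : Fin N → Fin N → 𝒯-Eq

  𝒯-f : Graph N → Graph N → 𝒯-Eq → Polynomial (N ℕ.* N)
  𝒯-f G H (row u)     = rowSum u
  𝒯-f G H (column v)  = columnSum v
  𝒯-f G H (entry u v) = ∑ₚ (λ w → constₚ (A G u w) *ₚ X w v)
                     -ₚ ∑ₚ (λ w → X u w *ₚ constₚ (A H w v))

  𝒯 : Graph N → Graph N → System (N ℕ.* N)
  𝒯 G H = record { Eq = 𝒯-Eq ; Ineq = ⊥ ; f = 𝒯-f G H ; g = λ () }

  -- Since adj is false on the diagonal, u₁ = u₂ and v₁ = v₂ count as non-edges.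
  data 𝒬-Eq (G H : Graph N) : Set where
    row column : Fin N → 𝒬-Eq G H
    edge-nonedge : ∀ u₁ u₂ v₁ v₂ → adj G u₁ u₂ ≡ true → adj H v₁ v₂ ≡ false → 𝒬-Eq G H
    nonedge-edge : ∀ u₁ u₂ v₁ v₂ → adj G u₁ u₂ ≡ false → adj H v₁ v₂ ≡ true → 𝒬-Eq G H

  𝒬-f : ∀ G H → 𝒬-Eq G H → Polynomial (N ℕ.* N)
  𝒬-f G H (row u)                        = rowSum u
  𝒬-f G H (column v)                     = columnSum v
  𝒬-f G H (edge-nonedge u₁ u₂ v₁ v₂ _ _) = X u₁ v₁ *ₚ X u₂ v₂
  𝒬-f G H (nonedge-edge u₁ u₂ v₁ v₂ _ _) = X u₁ v₁ *ₚ X u₂ v₂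

  𝒬 : Graph N → Graph N → System (N ℕ.* N)
  𝒬 G H = record { Eq = 𝒬-Eq G H ; Ineq = ⊥ ; f = 𝒬-f G H ; g = λ () }

{-# OPTIONS --safe #-}
module Submission where

-- The graphs are Cai-Fürer-Immerman graphs over a base multigraph on linearly many vertices in
-- which any two sets of a fifth of the vertices are joined by an edge; counting permutations
-- shows that such a multigraph of bounded degree exists.  Isomorphisms from G to H would be mod 2
-- edge labellings whose boundary is a single vertex v₀, and there are none, since every boundary
-- has even size. Labellings with boundary v₀ + w do exist, and induce maps from G to H that are
-- isomorphisms away from the gadget of w.  Deleting any small set Z of base vertices leaves a
-- giant component, and the distribution on Z of a uniformly random labelling with boundary v₀ + w
-- does not depend on the choice of w in this component: adding a path that avoids Z moves w.
-- Hence letting y_I be the probability that the random map satisfies I, for w in the giant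
-- component of the complement of the gadgets that I mentions, gives a solution of the lifted
-- system.

open import Defs
open import Algebra.Bundles using (CommutativeMonoid; CommutativeRing; Semiring)
open import Data.Bool.Base using (Bool; true; false; not; _∧_; _∨_; _xor_; if_then_else_; T)
import Data.Bool.Properties as Bool
import Data.Bool.Solver as BoolSolver
open import Data.Fin.Base
  using (Fin; zero; suc; toℕ; fromℕ<; inject₁; combine; quotient; remQuot; punchIn; splitAt; _↑ˡ_; _↑ʳ_)
open import Data.Fin.Permutation as Perm
  using (Permutation; Permutation′; _⟨$⟩ʳ_; _⟨$⟩ˡ_; insert; insert-punchIn)
open import Data.Fin.Properties
  using (_≟_; all?; any?; remQuot-combine; combine-remQuot; combine-injective; punchInᵢ≢i; suc-injective;
         splitAt-↑ˡ; splitAt-↑ʳ; join-splitAt; ↑ˡ-injective; ↑ʳ-injective; toℕ<n; toℕ-fromℕ<; toℕ-inject₁;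
         toℕ-injective; +↔⊎; *↔×; 2↔Bool)
open import Data.Fin.Subset as Subset
  using (Subset; ∣_∣; _∈_; _∉_; _⊆_; ⁅_⁆; ⊥; ∁; _∪_; _∩_; _─_)
open import Data.Fin.Subset.Properties
  using (_∈?_; anySubset?; nonempty?; x∈⁅x⁆; x∈⁅y⁆⇒x≡y; x∉p⇒x∈∁p; x∈∁p⇒x∉p; x∈p∪q⁺; x∈p∪q⁻; x∈p∩q⁺; x∈p∩q⁻;
         p⊆p∪q; q⊆p∪q; p─q⊆p; ⊥⊆; ∉⊥; ∪-identityˡ; ∪-identityʳ;
         p⊆q⇒∣p∣≤∣q∣; ∣p∣≤n; ∣∁p∣≡n∸∣p∣; ∣⁅x⁆∣≡1; ∣⊥∣≡0)
import Data.Integer.Base as ℤ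
import Data.Integer.Properties as ℤ
open import Data.List.Base as List using ([]; _∷_; _++_)
open import Data.List.Relation.Unary.All as All using (All; []; _∷_)
import Data.List.Relation.Unary.All.Properties as All
open import Data.Nat.Base as ℕ using (ℕ; zero; suc; z≤n; s≤s; _≤_)
import Data.Nat.Properties as ℕ
open import Data.Nat.Tactic.RingSolver using (solve-∀)
open import Data.Product.Base using (Σ-syntax; ∃-syntax; _×_; _,_; proj₁; proj₂)
open import Data.Product.Function.NonDependent.Propositional using (_×-↔_)
open import Data.Rational.Base as ℚ using (ℚ; 0ℚ; 1ℚ; ½; toℚᵘ)
import Data.Rational.Properties as ℚ
import Data.Rational.Solver as ℚSolver
open import Data.Rational.Unnormalised.Base as ℚᵘ using (mkℚᵘ; *≤*)
import Data.Rational.Unnormalised.Properties as ℚᵘ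
open import Data.Sum.Base using (_⊎_; inj₁; inj₂; [_,_]′)
open import Data.Sum.Function.Propositional using (_⊎-↔_)
open import Data.Vec.Base as Vec using (Vec; []; _∷_; lookup; tabulate; zipWith; replicate; here; there)
open import Data.Vec.Functional using (Vector; foldr)
open import Data.Vec.Properties
  using (lookup-zipWith; lookup∘tabulate; lookup-replicate; lookup⇒[]=; []=⇒lookup; tabulate-cong)
open import Function.Base using (_∘_; case_of_)
open import Function.Bundles using (mk⇔; _↔_; mk↔ₛ′; Inverse)
open import Function.Construct.Composition using (_↔-∘_)
open import Function.Construct.Identity using (↔-id)
open import Function.Construct.Symmetry using (↔-sym)
open import Level using (0ℓ)
open import Relation.Binary.PropositionalEquality as ≡ using (_≡_)
open import Relation.Nullary.Decidable
  using (Dec; does; yes; no; _×-dec_; _→-dec_; ¬?; dec-true; dec-false; does-⇔; map′)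
open import Relation.Nullary.Negation using (contradiction)
open import Relation.Nullary.Negation.Core using (¬_)
open import Relation.Unary using (Decidable; Empty; Pred)

-- Sums over Fin n and over the subsets of Fin n

-- The obstacle is that one constraint mixes monomials whose values come from different `w`. A
-- constraint of level `k` is determined by the labels at a set `Z` of at most `k + 1` gadgets, and
-- each of its monomials can be recomputed with a single `w` outside `Z`. The linearised constraint
-- then becomes an average over honest 0/1 points and is checked point by point.
--
-- A row, a column or an entry of the commutation equation has a variable for every vertex, yet it
-- must depend on at most two gadgets. It does because the maps are involutions: `X u v` can be read
-- off at the gadget of `u` as well as at that of `v`. To have involutions of one common vertex set,
-- each base vertex keeps cells of both parities; the two graphs differ only in the colours of
-- cells, that is, in edges to the path.
--
-- A monomial has its own set of at most `k + 1` gadgets besides `Z`, so `2k + 2` deleted base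
-- vertices must be tolerated. The base multigraph for index `m` has `10m` vertices and tolerates
-- `m` deletions, and `2k + 2 ≤ 4k` gives `c = 1/4`.

module FinSum {c ℓ} (M : CommutativeMonoid c ℓ) where
  open CommutativeMonoid M renaming (_≈_ to _≋_)
  open import Algebra.Properties.CommutativeMonoid.Sum M

  private
    sum-+ : ∀ m {n} (f : Fin (m ℕ.+ n) → Carrier) →
            sum f ≋ sum (λ i → f (i ↑ˡ n)) ∙ sum (λ j → f (m ↑ʳ j))
    sum-+ zero    f = sym (identityˡ _)
    sum-+ (suc m) f = trans (∙-congˡ (sum-+ m (f ∘ suc))) (sym (assoc _ _ _))

    sum-combine : ∀ m {n} (f : Fin (m ℕ.* n) → Carrier) →
                  sum f ≋ sum (λ i → sum λ j → f (combine {m} i j))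
    sum-combine zero        f = refl
    sum-combine (suc m) {n} f = trans (sum-+ n f) (∙-congˡ (sum-combine m (λ j → f (n ↑ʳ j))))

  -- Opaque, so that the summand of a sum can be inferred by unification.
  opaque
    ∑ : ∀ {n} → (Fin n → Carrier) → Carrier
    ∑ = sum

    ∑-empty : (f : Fin 0 → Carrier) → ∑ f ≡ ε
    ∑-empty f = ≡.refl

    ∑-suc : ∀ {n} (f : Fin (suc n) → Carrier) → ∑ f ≡ f zero ∙ ∑ (f ∘ suc)
    ∑-suc f = ≡.refl

    ∑-cong : ∀ {n} {f g : Fin n → Carrier} → (∀ i → f i ≡ g i) → ∑ f ≡ ∑ g
    ∑-cong = sum-cong-≗

    ∑-removeAt : ∀ {n} (i : Fin (suc n)) (f : Fin (suc n) → Carrier) →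
                 ∑ f ≋ f i ∙ ∑ (f ∘ punchIn i)
    ∑-removeAt i f = sum-remove {i = i} f

    ∑-∙ : ∀ {n} (f g : Fin n → Carrier) → ∑ (λ i → f i ∙ g i) ≋ ∑ f ∙ ∑ g
    ∑-∙ {n} = ∑-distrib-+ {n}

    ∑-reindex : ∀ {m n} (f : Fin n → Carrier) (π : Permutation m n) → ∑ f ≋ ∑ (f ∘ (π ⟨$⟩ʳ_))
    ∑-reindex = sum-permute

    ∑-+ : ∀ m {n} (f : Fin (m ℕ.+ n) → Carrier) →
          ∑ f ≋ ∑ (λ i → f (i ↑ˡ n)) ∙ ∑ (λ j → f (m ↑ʳ j))
    ∑-+ = sum-+

    ∑-combine : ∀ m {n} (f : Fin (m ℕ.* n) → Carrier) →
                ∑ f ≋ ∑ (λ i → ∑ λ j → f (combine {m} i j))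
    ∑-combine = sum-combine

    ∑-ε : ∀ n → ∑ {n} (λ _ → ε) ≋ ε
    ∑-ε = sum-replicate-zero

-- Used over three semirings: ℕ for counting permutations, the two-element field for boundaries, and
-- ℚ for averages.
module SemiringSum {c ℓ} (R : Semiring c ℓ) where
  open Semiring R renaming (_≈_ to _≋_)
    using (Carrier; _+_; _*_; 0#; refl; sym; trans; +-cong; +-comm; +-identityˡ; +-commutativeMonoid; distribˡ)
  open import Algebra.Properties.CommutativeSemigroup (CommutativeMonoid.commutativeSemigroup +-commutativeMonoid)
    using (interchange)

  open FinSum +-commutativeMonoid public
  import Algebra.Properties.Semiring.Sum R as Sum

  opaque
    unfolding ∑

    ∑-*ˡ : ∀ {n} a (f : Fin n → Carrier) → ∑ (λ i → a * f i) ≋ a * ∑ f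
    ∑-*ˡ {n} a f = sym (Sum.*-distribˡ-sum {n} a f)

    ∑-*ʳ : ∀ {n} a (f : Fin n → Carrier) → ∑ (λ i → f i * a) ≋ ∑ f * a
    ∑-*ʳ {n} a f = sym (Sum.*-distribʳ-sum {n} a f)

  opaque
    ∑⊆ : ∀ {n} → (Subset n → Carrier) → Carrier
    ∑⊆ {zero}  f = f []
    ∑⊆ {suc n} f = ∑⊆ (f ∘ (false ∷_)) + ∑⊆ (f ∘ (true ∷_))

    ∑⊆-empty : (f : Subset 0 → Carrier) → ∑⊆ f ≡ f []
    ∑⊆-empty f = ≡.refl

    ∑⊆-suc : ∀ {n} (f : Subset (suc n) → Carrier) → ∑⊆ f ≡ ∑⊆ (f ∘ (false ∷_)) + ∑⊆ (f ∘ (true ∷_))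
    ∑⊆-suc f = ≡.refl

    ∑⊆-cong : ∀ {n} {f g : Subset n → Carrier} → (∀ S → f S ≡ g S) → ∑⊆ f ≡ ∑⊆ g
    ∑⊆-cong {zero}  e = e []
    ∑⊆-cong {suc n} e = ≡.cong₂ _+_ (∑⊆-cong (e ∘ (false ∷_))) (∑⊆-cong (e ∘ (true ∷_)))

    ∑⊆-0# : ∀ n → ∑⊆ {n} (λ _ → 0#) ≋ 0#
    ∑⊆-0# zero    = refl
    ∑⊆-0# (suc n) = trans (+-cong (∑⊆-0# n) (∑⊆-0# n)) (+-identityˡ 0#)

    ∑⊆-+ : ∀ {n} (f g : Subset n → Carrier) → ∑⊆ (λ S → f S + g S) ≋ ∑⊆ f + ∑⊆ g
    ∑⊆-+ {zero}  f g = refl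
    ∑⊆-+ {suc n} f g = trans (+-cong (∑⊆-+ {n} _ _) (∑⊆-+ {n} _ _)) (interchange _ _ _ _)

    ∑⊆-*ˡ : ∀ {n} a (f : Subset n → Carrier) → ∑⊆ (λ S → a * f S) ≋ a * ∑⊆ f
    ∑⊆-*ˡ {zero}  a f = refl
    ∑⊆-*ˡ {suc n} a f = trans (+-cong (∑⊆-*ˡ {n} a _) (∑⊆-*ˡ {n} a _)) (sym (distribˡ a _ _))

    -- Adding `q` modulo 2 permutes the subsets: each `true` in `q` swaps the two halves of the sum.
    ∑⊆-translate : ∀ {n} (q : Subset n) (f : Subset n → Carrier) →
                   ∑⊆ (λ S → f (zipWith _xor_ q S)) ≋ ∑⊆ f
    ∑⊆-translate []          f = refl
    ∑⊆-translate (false ∷ q) f = +-cong (∑⊆-translate q (f ∘ (false ∷_))) (∑⊆-translate q (f ∘ (true ∷_)))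
    ∑⊆-translate (true  ∷ q) f =
      trans (+-cong (∑⊆-translate q (f ∘ (true ∷_))) (∑⊆-translate q (f ∘ (false ∷_)))) (+-comm _ _)

open ≡ using (_≢_; refl; sym; trans; cong; cong₂; subst; subst₂; module ≡-Reasoning)

-- Counting permutations that map one set into the complement of another

module Counting where
  open import Data.Nat.Base using (_+_; _*_; _∸_; _^_; _<_; _≤ᵇ_; _!)
  open import Data.Nat.Properties
  open SemiringSum ℕ.+-*-semiring

  bit : Bool → ℕ
  bit true  = 1
  bit false = 0

  count : ∀ {n} → (Fin n → Bool) → ℕ
  count f = ∑ (bit ∘ f)

  count-+-not : ∀ {n} (f : Fin n → Bool) → count f + count (not ∘ f) ≡ n
  count-+-not {zero}  f = cong₂ _+_ (∑-empty (bit ∘ f)) (∑-empty (bit ∘ not ∘ f))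
  count-+-not {suc n} f rewrite ∑-suc (bit ∘ f) | ∑-suc (bit ∘ not ∘ f) with f zero
  ... | true  = cong suc (count-+-not (f ∘ suc))
  ... | false = trans (+-suc _ _) (cong suc (count-+-not (f ∘ suc)))

  count≤ : ∀ {n} (f : Fin n → Bool) → count f ≤ n
  count≤ f = m+n≤o⇒m≤o (count f) (≤-reflexive (count-+-not f))

  count-not : ∀ {n} (f : Fin n → Bool) → count (not ∘ f) ≡ n ∸ count f
  count-not f = sym (trans (cong (_∸ count f) (sym (count-+-not f))) (m+n∸m≡n (count f) _))

  -- The falling factorial x(x-1)...(x-k+1), the number of injections of `k` points into `x`;
  -- truncated subtraction makes it 0 for `k > x`, as it should be.
  falling : ℕ → ℕ → ℕ
  falling x zero    = 1
  falling x (suc k) = x * falling (x ∸ 1) k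

  falling-last : ∀ x k → falling x (suc k) ≡ falling x k * (x ∸ k)
  falling-last x zero    = *-comm x 1
  falling-last x (suc k) = begin
    x * falling (x ∸ 1) (suc k)            ≡⟨ cong (x *_) (falling-last (x ∸ 1) k) ⟩
    x * (falling (x ∸ 1) k * (x ∸ 1 ∸ k))  ≡⟨ sym (*-assoc x _ _) ⟩
    falling x (suc k) * (x ∸ 1 ∸ k)        ≡⟨ cong (falling x (suc k) *_) (∸-+-assoc x 1 k) ⟩
    falling x (suc k) * (x ∸ suc k)        ∎
    where open ≡-Reasoning

  falling-< : ∀ {x k} → x < k → falling x k ≡ 0
  falling-< {zero}  (s≤s x<k) = refl
  falling-< {suc x} (s≤s x<k) = trans (cong (suc x *_) (falling-< x<k)) (*-zeroʳ (suc x))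

  -- Each factor (x-i)/(M-i) is at most 4/5, because lowering both numbers by one does not raise a
  -- ratio below 1. Denominators are cleared.
  falling-bound : ∀ k {x M} → k ≤ M → 5 * x ≤ 4 * M →
                  falling x k * (M ∸ k) ! * 5 ^ k ≤ 4 ^ k * M !
  falling-bound zero    {x} {M} _ _ = ≤-reflexive (trans (*-identityʳ _) refl)
  falling-bound (suc k) {zero}  {M} _ _ = z≤n
  falling-bound (suc k) {suc x} {suc M} (s≤s k≤M) 5x≤4M = begin
    suc x * falling x k * (M ∸ k) ! * (5 * 5 ^ k)      ≡⟨ lemma (suc x) (falling x k) ((M ∸ k) !) (5 ^ k) ⟩
    5 * suc x * (falling x k * (M ∸ k) ! * 5 ^ k)      ≤⟨ *-mono-≤ 5x≤4M (falling-bound k k≤M 5x′≤4M′) ⟩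
    4 * suc M * (4 ^ k * M !)                          ≡⟨ lemma′ (suc M) (4 ^ k) (M !) ⟩
    4 * 4 ^ k * (suc M * M !)                          ∎
    where
    open ≤-Reasoning
    lemma : ∀ a b c d → a * b * c * (5 * d) ≡ 5 * a * (b * c * d)
    lemma = solve-∀
    lemma′ : ∀ a b c → 4 * a * (b * c) ≡ 4 * b * (a * c)
    lemma′ = solve-∀
    5x′≤4M′ : 5 * x ≤ 4 * M
    5x′≤4M′ = +-cancelˡ-≤ 4 _ _ (begin
      4 + 5 * x    ≤⟨ n≤1+n _ ⟩
      5 + 5 * x    ≡⟨ sym (*-suc 5 x) ⟩
      5 * suc x    ≤⟨ 5x≤4M ⟩
      4 * suc M    ≡⟨ *-suc 4 M ⟩
      4 + 4 * M    ∎)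

  opaque
    -- The image `c` of zero is chosen first and then a permutation of the rest, which makes `M !`
    -- terms.
    ∑π : ∀ {M} → (Permutation′ M → ℕ) → ℕ
    ∑π {zero}  F = F Perm.id
    ∑π {suc M} F = ∑ λ c → ∑π λ π → F (insert zero c π)

    ∑π-empty : ∀ F → ∑π {0} F ≡ F Perm.id
    ∑π-empty F = refl

    ∑π-suc : ∀ {M} (F : Permutation′ (suc M) → ℕ) → ∑π F ≡ ∑ λ c → ∑π λ π → F (insert zero c π)
    ∑π-suc F = refl

    ∑π-cong : ∀ {M} {F F′ : Permutation′ M → ℕ} → (∀ π → F π ≡ F′ π) → ∑π F ≡ ∑π F′
    ∑π-cong {zero}  e = e Perm.id
    ∑π-cong {suc M} e = ∑-cong λ c → ∑π-cong λ π → e (insert zero c π)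

    ∑π-*ˡ : ∀ {M} a (F : Permutation′ M → ℕ) → ∑π (λ π → a * F π) ≡ a * ∑π F
    ∑π-*ˡ {zero}  a F = refl
    ∑π-*ˡ {suc M} a F = trans (∑-cong λ c → ∑π-*ˡ {M} a _) (∑-*ˡ a _)

    ∑π-+ : ∀ {M} (F F′ : Permutation′ M → ℕ) → ∑π (λ π → F π + F′ π) ≡ ∑π F + ∑π F′
    ∑π-+ {zero}  F F′ = refl
    ∑π-+ {suc M} F F′ = trans (∑-cong λ c → ∑π-+ {M} _ _) (∑-∙ _ _)

  ∑π-∑⊆ : ∀ {M n} (F : Permutation′ M → Subset n → ℕ) →
          ∑π (λ π → ∑⊆ (F π)) ≡ ∑⊆ (λ S → ∑π λ π → F π S)
  ∑π-∑⊆ {n = zero}  F = trans (∑π-cong λ π → ∑⊆-empty (F π)) (sym (∑⊆-empty _))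
  ∑π-∑⊆ {n = suc n} F =
    trans (∑π-cong λ π → ∑⊆-suc (F π))
      (trans (∑π-+ _ _) (trans (cong₂ _+_ (∑π-∑⊆ _) (∑π-∑⊆ _)) (sym (∑⊆-suc _))))

  ∑-pigeonhole : ∀ n {b} (a : Fin n → ℕ) → ∑ a < n * b → ∃[ i ] a i < b
  ∑-pigeonhole zero        a ()
  ∑-pigeonhole (suc n) {b} a s<nb with a zero <? b
  ... | yes a₀<b = zero , a₀<b
  ... | no  a₀≮b = let i , aᵢ<b = ∑-pigeonhole n (a ∘ suc) (+-cancelˡ-< b _ _
                                    (≤-<-trans (+-monoˡ-≤ _ (≮⇒≥ a₀≮b)) (subst (_< b + n * b) (∑-suc a) s<nb)))
                       in suc i , aᵢ<b

  -- The probabilistic method: a mean below 1 over `M !` natural numbers forces one of them to be 0.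
  ∑π-pigeonhole : ∀ {M} (F : Permutation′ M → ℕ) → ∑π F < M ! → ∃[ π ] F π ≡ 0
  ∑π-pigeonhole {zero}  F F<1 = Perm.id , n<1⇒n≡0 (subst (_< 1) (∑π-empty F) F<1)
  ∑π-pigeonhole {suc M} F F<M! =
    let c , s = ∑-pigeonhole (suc M) _ (subst (_< suc M !) (∑π-suc F) F<M!)
        π , e = ∑π-pigeonhole _ s
    in insert zero c π , e

  all : ∀ {n} → (Fin n → Bool) → Bool
  all = foldr _∧_ true

  all-cong : ∀ {n} {f g : Fin n → Bool} → (∀ i → f i ≡ g i) → all f ≡ all g
  all-cong {zero}  e = refl
  all-cong {suc n} e = cong₂ _∧_ (e zero) (all-cong (e ∘ suc))

  all-false : ∀ {n} (f : Fin n → Bool) → all f ≡ false → ∃[ i ] f i ≡ false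
  all-false {suc n} f e with f zero in f₀
  ... | false = zero , f₀
  ... | true  = let i , fᵢ = all-false (f ∘ suc) e in suc i , fᵢ

  avoids : ∀ {M} → (Fin M → Bool) → (Fin M → Bool) → Permutation′ M → Bool
  avoids A B π = all λ p → not (A p ∧ B (π ⟨$⟩ʳ p))

  bit-∧ : ∀ x y → bit (x ∧ y) ≡ bit x * bit y
  bit-∧ true  y = sym (+-identityʳ _)
  bit-∧ false y = refl

  -- The points of `A` go injectively into the complement of `B`, and the other points fill what is
  -- left in any order. The induction fixes the image `c` of zero; only whether `c` lies in `B`
  -- matters.
  ∑-avoids : ∀ {M} (A B : Fin M → Bool) →
             ∑π (bit ∘ avoids A B) ≡ (M ∸ count A) ! * falling (M ∸ count B) (count A)
  ∑-avoids {zero}  A B = trans (∑π-empty _) (sym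
    (cong₂ (λ a b → (0 ∸ a) ! * falling (0 ∸ b) a) (∑-empty (bit ∘ A)) (∑-empty (bit ∘ B))))
  ∑-avoids {suc M} A B = begin
    ∑π (bit ∘ avoids A B)
      ≡⟨ ∑π-suc _ ⟩
    ∑ (λ c → ∑π λ π → bit (avoids A B (insert zero c π)))
      ≡⟨ (∑-cong λ c → ∑π-cong λ π → cong bit (cong (not (A zero ∧ B c) ∧_)
           (all-cong λ p → cong (λ i → not (A (suc p) ∧ B i)) (insert-punchIn zero c π p)))) ⟩
    ∑ (λ c → ∑π λ π → bit (not (A zero ∧ B c) ∧ avoids A′ (B ∘ punchIn c) π))
      ≡⟨ (∑-cong λ c → trans (∑π-cong λ π → bit-∧ (not (A zero ∧ B c)) _)
           (trans (∑π-*ˡ (bit (not (A zero ∧ B c))) (bit ∘ avoids A′ (B ∘ punchIn c)))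
                  (cong (bit (not (A zero ∧ B c)) *_) (∑-avoids A′ (B ∘ punchIn c))))) ⟩
    ∑ (λ c → bit (not (A zero ∧ B c)) * ((M ∸ a) ! * falling (M ∸ count (B ∘ punchIn c)) a))
      ≡⟨ (∑-cong λ c → cases c) ⟩
    ∑ (λ c → bit (A zero xor true) * (bit (B c) * U) + bit (not (B c)) * V)
      ≡⟨ ∑-∙ _ _ ⟩
    ∑ (λ c → bit (A zero xor true) * (bit (B c) * U)) + ∑ (λ c → bit (not (B c)) * V)
      ≡⟨ cong₂ _+_ (∑-*ˡ (bit (A zero xor true)) _) (∑-*ʳ V _) ⟩
    bit (A zero xor true) * ∑ (λ c → bit (B c) * U) + count (not ∘ B) * V
      ≡⟨ cong₂ (λ s t → bit (A zero xor true) * s + t * V)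
           (∑-*ʳ U _) (count-not B) ⟩
    bit (A zero xor true) * (b * U) + x * V
      ≡⟨ final ⟩
    (suc M ∸ (bit (A zero) + a)) ! * falling x (bit (A zero) + a)
      ≡⟨ cong (λ y → (suc M ∸ y) ! * falling x y) (sym (∑-suc (bit ∘ A))) ⟩
    (suc M ∸ count A) ! * falling x (count A)
      ∎
    where
    open ≡-Reasoning
    A′ : Fin M → Bool
    A′ = A ∘ suc
    a b x U V : ℕ
    a = count A′
    b = count B
    x = suc M ∸ b
    -- `U` counts the completions after zero is sent into `B`, `V` those after it is sent outside,
    -- which uses up one of the `x` points there.
    U = (M ∸ a) ! * falling x a
    V = (M ∸ a) ! * falling (x ∸ 1) a

    removed : ∀ c → bit (B c) + count (B ∘ punchIn c) ≡ b
    removed c = sym (∑-removeAt c (bit ∘ B))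

    M∸b : M ∸ b ≡ x ∸ 1
    M∸b = lemma M b
      where
      lemma : ∀ M b → M ∸ b ≡ suc M ∸ b ∸ 1
      lemma M b = trans (∸-+-assoc (suc M) 1 b) (trans (cong (suc M ∸_) (+-comm 1 b)) (sym (∸-+-assoc (suc M) b 1)))

    cases : ∀ c → bit (not (A zero ∧ B c)) * ((M ∸ a) ! * falling (M ∸ count (B ∘ punchIn c)) a)
                ≡ bit (A zero xor true) * (bit (B c) * U) + bit (not (B c)) * V
    cases c with A zero | B c | removed c
    ... | true  | true  | r = refl
    ... | true  | false | r = cong (λ y → 1 * ((M ∸ a) ! * falling y a)) (trans (cong (M ∸_) r) M∸b)
    ... | false | true  | r = trans (cong (λ y → 1 * ((M ∸ a) ! * falling y a)) (cong (suc M ∸_) r))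
                                (trans (sym (*-identityˡ _)) (sym (+-identityʳ _)))
    ... | false | false | r = cong (λ y → 1 * ((M ∸ a) ! * falling y a)) (trans (cong (M ∸_) r) M∸b)

    b+x : b + x ≡ suc M
    b+x = m+[n∸m]≡n (count≤ B)

    -- The last factor of `falling x (suc a)` is `x - a`, and `b + (x - a) = suc M - a`. For `a > x`
    -- truncation spoils this equation, but then both sides are 0.
    step : b * falling x a + falling x (suc a) ≡ (suc M ∸ a) * falling x a
    step with a ≤? x
    ... | yes a≤x = begin
      b * falling x a + falling x (suc a)        ≡⟨ cong (b * falling x a +_) (trans (falling-last x a) (*-comm (falling x a) _)) ⟩
      b * falling x a + (x ∸ a) * falling x a    ≡⟨ sym (*-distribʳ-+ (falling x a) b (x ∸ a)) ⟩
      (b + (x ∸ a)) * falling x a                ≡⟨ cong (_* falling x a) (trans (sym (+-∸-assoc b a≤x)) (cong (_∸ a) b+x)) ⟩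
      (suc M ∸ a) * falling x a                  ∎
    ... | no a≰x with e ← falling-< (≰⇒> a≰x) = begin
      b * falling x a + falling x (suc a)        ≡⟨ cong₂ _+_ (trans (cong (b *_) e) (*-zeroʳ b))
                                                      (trans (falling-last x a) (cong (_* (x ∸ a)) e)) ⟩
      0                                          ≡⟨ sym (trans (cong ((suc M ∸ a) *_) e) (*-zeroʳ (suc M ∸ a))) ⟩
      (suc M ∸ a) * falling x a                  ∎

    final : bit (A zero xor true) * (b * U) + x * V ≡ (suc M ∸ (bit (A zero) + a)) ! * falling x (bit (A zero) + a)
    final with A zero
    ... | true  = comm x ((M ∸ a) !) (falling (x ∸ 1) a)
      where
      comm : ∀ x f g → x * (f * g) ≡ f * (x * g)
      comm = solve-∀
    ... | false = begin
      1 * (b * U) + x * V                                       ≡⟨ factor b x ((M ∸ a) !) (falling x a) (falling (x ∸ 1) a) ⟩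
      (M ∸ a) ! * (b * falling x a + x * falling (x ∸ 1) a)     ≡⟨ cong ((M ∸ a) ! *_) step ⟩
      (M ∸ a) ! * ((suc M ∸ a) * falling x a)                   ≡⟨ sym (*-assoc ((M ∸ a) !) _ _) ⟩
      (M ∸ a) ! * (suc M ∸ a) * falling x a                     ≡⟨ cong (_* falling x a) (trans (*-comm ((M ∸ a) !) _) fact) ⟩
      (suc M ∸ a) ! * falling x a                               ∎
      where
      factor : ∀ b x f g h → 1 * (b * (f * g)) + x * (f * h) ≡ f * (b * g + x * h)
      factor = solve-∀
      fact : (suc M ∸ a) * (M ∸ a) ! ≡ (suc M ∸ a) !
      fact rewrite +-∸-assoc 1 (count≤ A′) = refl

  ^-distribʳ-* : ∀ k x y → (x * y) ^ k ≡ x ^ k * y ^ k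
  ^-distribʳ-* zero    x y = refl
  ^-distribʳ-* (suc k) x y = trans (cong (x * y *_) (^-distribʳ-* k x y)) (lemma x y (x ^ k) (y ^ k))
    where
    lemma : ∀ x y z w → x * y * (z * w) ≡ x * z * (y * w)
    lemma = solve-∀

  opaque
    unfolding ∑⊆

    ∑⊆-mono : ∀ {n} {f g : Subset n → ℕ} → (∀ S → f S ≤ g S) → ∑⊆ f ≤ ∑⊆ g
    ∑⊆-mono {zero}  f≤g = f≤g []
    ∑⊆-mono {suc n} f≤g = +-mono-≤ (∑⊆-mono (f≤g ∘ (false ∷_))) (∑⊆-mono (f≤g ∘ (true ∷_)))

    ∑⊆-const : ∀ n a → ∑⊆ {n} (λ _ → a) ≡ 2 ^ n * a
    ∑⊆-const zero    a = sym (*-identityˡ a)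
    ∑⊆-const (suc n) a = trans (cong₂ _+_ (∑⊆-const n a) (∑⊆-const n a)) (lemma (2 ^ n) a)
      where
      lemma : ∀ x a → x * a + x * a ≡ 2 * x * a
      lemma = solve-∀

    ∑⊆≡0 : ∀ {n} (f : Subset n → ℕ) → ∑⊆ f ≡ 0 → ∀ S → f S ≡ 0
    ∑⊆≡0 f e []          = e
    ∑⊆≡0 f e (false ∷ S) = ∑⊆≡0 _ (m+n≡0⇒m≡0 _ e) S
    ∑⊆≡0 f e (true  ∷ S) = ∑⊆≡0 _ (m+n≡0⇒n≡0 (∑⊆ (f ∘ (false ∷_))) e) S

  ∣∣≡count : ∀ {n} (S : Subset n) → ∣ S ∣ ≡ count (lookup S)
  ∣∣≡count []          = sym (∑-empty _)
  ∣∣≡count (true  ∷ S) = trans (cong suc (∣∣≡count S)) (sym (∑-suc _))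
  ∣∣≡count (false ∷ S) = trans (∣∣≡count S) (sym (∑-suc _))

  -- As in the configuration model, each vertex is split into `d` slots, and it is the slots that
  -- get permuted.
  slots : ∀ {n} d → Subset n → Fin (n * d) → Bool
  slots d S p = lookup S (quotient d p)

  ∑-const : ∀ n a → ∑ {n} (λ _ → a) ≡ n * a
  ∑-const zero    a = ∑-empty _
  ∑-const (suc n) a = trans (∑-suc _) (cong (a +_) (∑-const n a))

  count-slots : ∀ {n} d (S : Subset n) → count (slots d S) ≡ ∣ S ∣ * d
  count-slots {n} d S = begin
    ∑ (bit ∘ slots d S)                                       ≡⟨ ∑-combine n (bit ∘ slots d S) ⟩
    ∑ (λ i → ∑ λ j → bit (slots d S (combine i j)))           ≡⟨ ∑-cong (λ i → ∑-cong λ j →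
                                                                   cong (bit ∘ lookup S ∘ proj₁) (remQuot-combine i j)) ⟩
    ∑ (λ i → ∑ {d} λ j → bit (lookup S i))                    ≡⟨ ∑-cong (λ i → trans (∑-const d _) (*-comm d _)) ⟩
    ∑ (λ i → bit (lookup S i) * d)                            ≡⟨ ∑-*ʳ d (bit ∘ lookup S) ⟩
    count (lookup S) * d                                      ≡⟨ cong (_* d) (sym (∣∣≡count S)) ⟩
    ∣ S ∣ * d                                                 ∎
    where open ≡-Reasoning

  -- Every slot of `A` has to land among at most 4/5 of all slots. The exponent is lowered from the
  -- number `a` of these slots to `t * d`, at the cost of `4 ^ r ≤ 5 ^ r`, to have one bound for all
  -- pairs in the union bound.
  avoids-rare : ∀ t d (A B : Subset (5 * t)) → t ≤ ∣ A ∣ → t ≤ ∣ B ∣ →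
    ∑π (bit ∘ avoids (slots d A) (slots d B)) * 5 ^ (t * d) ≤ 4 ^ (t * d) * (5 * t * d) !
  avoids-rare t d A B t≤A t≤B = *-cancelʳ-≤ _ _ (5 ^ r) {{m^n≢0 5 r}} (begin
    ∑π (bit ∘ avoids A′ B′) * 5 ^ (t * d) * 5 ^ r     ≡⟨ *-assoc (∑π (bit ∘ avoids A′ B′)) _ _ ⟩
    ∑π (bit ∘ avoids A′ B′) * (5 ^ (t * d) * 5 ^ r)   ≡⟨ cong (∑π (bit ∘ avoids A′ B′) *_) (split 5) ⟩
    ∑π (bit ∘ avoids A′ B′) * 5 ^ a                   ≡⟨ cong (_* 5 ^ a) (trans (∑-avoids A′ B′) (*-comm ((M ∸ a) !) _)) ⟩
    falling (M ∸ count B′) a * (M ∸ a) ! * 5 ^ a      ≤⟨ falling-bound a (count≤ A′) small ⟩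
    4 ^ a * M !                                       ≡⟨ cong (_* M !) (sym (split 4)) ⟩
    4 ^ (t * d) * 4 ^ r * M !                         ≡⟨ swap (4 ^ (t * d)) (4 ^ r) (M !) ⟩
    4 ^ (t * d) * M ! * 4 ^ r                         ≤⟨ *-monoʳ-≤ (4 ^ (t * d) * M !) (^-monoˡ-≤ r (n≤1+n 4)) ⟩
    4 ^ (t * d) * M ! * 5 ^ r                         ∎)
    where
    open ≤-Reasoning
    A′ B′ : Fin (5 * t * d) → Bool
    A′ = slots d A
    B′ = slots d B
    M a r : ℕ
    M = 5 * t * d
    a = count A′
    td≤ : ∀ S → t ≤ ∣ S ∣ → t * d ≤ count (slots d S)
    td≤ S t≤S = ≤-trans (*-monoˡ-≤ d t≤S) (≤-reflexive (sym (count-slots d S)))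
    r = a ∸ t * d
    split : ∀ x → x ^ (t * d) * x ^ r ≡ x ^ a
    split x = trans (sym (^-distribˡ-+-* x (t * d) r)) (cong (x ^_) (m+[n∸m]≡n (td≤ A t≤A)))
    swap : ∀ x y z → x * y * z ≡ x * z * y
    swap = solve-∀
    small : 5 * (M ∸ count B′) ≤ 4 * M
    small = begin
      5 * (M ∸ count B′)              ≤⟨ *-monoʳ-≤ 5 (∸-monoʳ-≤ M (td≤ B t≤B)) ⟩
      5 * (M ∸ t * d)                 ≡⟨ cong (λ y → 5 * (y ∸ t * d)) (trans (*-assoc 5 t d) (+-comm (t * d) _)) ⟩
      5 * (4 * (t * d) + t * d ∸ t * d) ≡⟨ cong (5 *_) (m+n∸n≡m (4 * (t * d)) (t * d)) ⟩
      5 * (4 * (t * d))               ≡⟨ regroup t d ⟩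
      4 * M                           ∎
      where
      regroup : ∀ t d → 5 * (4 * (t * d)) ≡ 4 * (5 * t * d)
      regroup = solve-∀

  -- With 4⁵⁺ᵈ < 5ᵈ, a union bound over the 4⁵ᵗ pairs of subsets leaves a permutation that is good for all of them.
  mixing-permutation : ∀ t d → 1 ≤ t → 4 ^ (5 + d) < 5 ^ d →
    Σ[ π ∈ Permutation′ (5 * t * d) ] ∀ (A B : Subset (5 * t)) → t ≤ ∣ A ∣ → t ≤ ∣ B ∣ →
      ∃[ p ] lookup A (quotient d p) ≡ true × lookup B (quotient d (π ⟨$⟩ʳ p)) ≡ true
  mixing-permutation t d 1≤t 4<5 = π , λ A B t≤A t≤B →
    extract A B (all-false _ (unavoidable A B (≤⇒≤ᵇ t≤A) (≤⇒≤ᵇ t≤B) (∑⊆≡0 _ (∑⊆≡0 _ bad≡0 A) B)))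
    where
    open ≤-Reasoning
    M : ℕ
    M = 5 * t * d

    bad : Permutation′ M → Subset (5 * t) → Subset (5 * t) → Bool
    bad π A B = (t ≤ᵇ ∣ A ∣) ∧ (t ≤ᵇ ∣ B ∣) ∧ avoids (slots d A) (slots d B) π

    rare : ∀ A B → ∑π (λ π → bit (bad π A B)) * 5 ^ (t * d) ≤ 4 ^ (t * d) * M !
    rare A B with t ≤ᵇ ∣ A ∣ in eA | t ≤ᵇ ∣ B ∣ in eB
    ... | true  | true  = avoids-rare t d A B (≤ᵇ⇒≤ t _ (subst T (sym eA) _)) (≤ᵇ⇒≤ t _ (subst T (sym eB) _))
    ... | true  | false = ≤-trans (≤-reflexive (cong (_* 5 ^ (t * d)) (∑π-*ˡ {M} 0 (λ _ → 0)))) z≤n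
    ... | false | _     = ≤-trans (≤-reflexive (cong (_* 5 ^ (t * d)) (∑π-*ˡ {M} 0 (λ _ → 0)))) z≤n

    total : ℕ
    total = ∑π λ π → ∑⊆ λ A → ∑⊆ λ B → bit (bad π A B)

    total-bound : total * 5 ^ (t * d) ≤ 2 ^ (5 * t) * (2 ^ (5 * t) * (4 ^ (t * d) * M !))
    total-bound = begin
      total * 5 ^ (t * d)
        ≡⟨ cong (_* 5 ^ (t * d)) (trans (∑π-∑⊆ _) (∑⊆-cong λ A → ∑π-∑⊆ _)) ⟩
      ∑⊆ (λ A → ∑⊆ λ B → ∑π λ π → bit (bad π A B)) * 5 ^ (t * d)
        ≡⟨ *-comm _ (5 ^ (t * d)) ⟩
      5 ^ (t * d) * ∑⊆ (λ A → ∑⊆ λ B → ∑π λ π → bit (bad π A B))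
        ≡⟨ sym (trans (∑⊆-cong λ A → ∑⊆-*ˡ (5 ^ (t * d)) _) (∑⊆-*ˡ (5 ^ (t * d)) _)) ⟩
      ∑⊆ (λ A → ∑⊆ λ B → 5 ^ (t * d) * ∑π λ π → bit (bad π A B))
        ≤⟨ ∑⊆-mono (λ A → ∑⊆-mono λ B → ≤-trans (≤-reflexive (*-comm (5 ^ (t * d)) _)) (rare A B)) ⟩
      ∑⊆ {5 * t} (λ A → ∑⊆ {5 * t} λ B → 4 ^ (t * d) * M !)
        ≡⟨ trans (∑⊆-cong λ A → ∑⊆-const (5 * t) _) (∑⊆-const (5 * t) _) ⟩
      2 ^ (5 * t) * (2 ^ (5 * t) * (4 ^ (t * d) * M !)) ∎

    powers : 2 ^ (5 * t) * (2 ^ (5 * t) * (4 ^ (t * d) * M !)) < M ! * 5 ^ (t * d)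
    powers = begin-strict
      2 ^ (5 * t) * (2 ^ (5 * t) * (4 ^ (t * d) * M !))  ≡⟨ regroup (2 ^ (5 * t)) (4 ^ (t * d)) (M !) ⟩
      M ! * (2 ^ (5 * t) * 2 ^ (5 * t) * 4 ^ (t * d))    ≡⟨ cong (M ! *_) merge ⟩
      M ! * (4 ^ (5 + d)) ^ t                            <⟨ *-monoʳ-< (M !) {{M !≢0}} (^-monoˡ-< t {{ℕ.>-nonZero 1≤t}} 4<5) ⟩
      M ! * (5 ^ d) ^ t                                  ≡⟨ cong (M ! *_) (trans (^-*-assoc 5 d t) (cong (5 ^_) (*-comm d t))) ⟩
      M ! * 5 ^ (t * d)                                  ∎
      where
      regroup : ∀ x y z → x * (x * (y * z)) ≡ z * (x * x * y)
      regroup = solve-∀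
      exponent : ∀ t d → 5 * t + t * d ≡ (5 + d) * t
      exponent = solve-∀
      merge : 2 ^ (5 * t) * 2 ^ (5 * t) * 4 ^ (t * d) ≡ (4 ^ (5 + d)) ^ t
      merge = begin-equality
        2 ^ (5 * t) * 2 ^ (5 * t) * 4 ^ (t * d)  ≡⟨ cong (_* 4 ^ (t * d)) (sym (^-distribʳ-* (5 * t) 2 2)) ⟩
        4 ^ (5 * t) * 4 ^ (t * d)                ≡⟨ sym (^-distribˡ-+-* 4 (5 * t) (t * d)) ⟩
        4 ^ (5 * t + t * d)                      ≡⟨ cong (4 ^_) (exponent t d) ⟩
        4 ^ ((5 + d) * t)                        ≡⟨ sym (^-*-assoc 4 (5 + d) t) ⟩
        (4 ^ (5 + d)) ^ t                        ∎

    good : ∃[ π ] (∑⊆ λ A → ∑⊆ λ B → bit (bad π A B)) ≡ 0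
    good = ∑π-pigeonhole _ (*-cancelʳ-< (5 ^ (t * d)) total (M !) (≤-<-trans total-bound powers))

    π : Permutation′ M
    π = proj₁ good
    bad≡0 = proj₂ good

    unavoidable : ∀ A B → T (t ≤ᵇ ∣ A ∣) → T (t ≤ᵇ ∣ B ∣) → bit (bad π A B) ≡ 0 →
                  avoids (slots d A) (slots d B) π ≡ false
    unavoidable A B tA tB e with t ≤ᵇ ∣ A ∣ | t ≤ᵇ ∣ B ∣ | avoids (slots d A) (slots d B) π
    unavoidable A B tA tB e  | true | true | false = refl
    unavoidable A B tA tB () | true | true | true

    extract : ∀ (A B : Subset (5 * t)) → (∃[ p ] not (slots d A p ∧ slots d B (π ⟨$⟩ʳ p)) ≡ false) →
              ∃[ p ] lookup A (quotient d p) ≡ true × lookup B (quotient d (π ⟨$⟩ʳ p)) ≡ true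
    extract A B (p , e) with slots d A p in eA | slots d B (π ⟨$⟩ʳ p) in eB
    extract A B (p , e)  | true | true = p , eA , eB

-- Boundaries of edge labellings of a multigraph, and giant components

open CommutativeRing Bool.xor-∧-commutativeRing using () renaming (semiring to xor-∧-semiring)
module ⊕ = SemiringSum xor-∧-semiring
open ⊕ using () renaming (∑ to ⨁)

δ : ∀ {n} → Fin n → Fin n → Bool
δ u v = does (u ≟ v)

⨁-false : ∀ n → ⨁ {n} (λ _ → false) ≡ false
⨁-false = ⊕.∑-ε

⨁-δ : ∀ {n} (i : Fin n) → ⨁ (δ i) ≡ true
⨁-δ {suc n} i = begin
  ⨁ (δ i)                              ≡⟨ ⊕.∑-removeAt i (δ i) ⟩
  δ i i xor ⨁ (δ i ∘ punchIn i)        ≡⟨ cong₂ _xor_ (dec-true (i ≟ i) refl)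
                                            (trans (⊕.∑-cong λ k → dec-false (i ≟ punchIn i k) (punchInᵢ≢i i k ∘ sym)) (⨁-false n)) ⟩
  true                                 ∎
  where open ≡-Reasoning

lookup-⁅⁆ : ∀ {n} (i j : Fin n) → lookup ⁅ i ⁆ j ≡ δ i j
lookup-⁅⁆ i j with i ≟ j
... | yes refl = []=⇒lookup (x∈⁅x⁆ i)
... | no  i≢j with lookup ⁅ i ⁆ j in eq
...   | false = refl
...   | true  = contradiction (sym (x∈⁅y⁆⇒x≡y i (lookup⇒[]= j ⁅ i ⁆ eq))) i≢j

lookup-⊥ : ∀ {n} (i : Fin n) → lookup (⊥ {n}) i ≡ false
lookup-⊥ i = lookup-replicate i false

opaque
  ⟪_⟫ : ∀ {n} {P : Fin n → Set} → Decidable P → Subset n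
  ⟪ P? ⟫ = tabulate (does ∘ P?)

  ∈⟪⟫⁺ : ∀ {n} {P : Fin n → Set} (P? : Decidable P) {i} → P i → i ∈ ⟪ P? ⟫
  ∈⟪⟫⁺ P? {i} Pi = lookup⇒[]= i _ (trans (lookup∘tabulate _ i) (dec-true (P? i) Pi))

  ∈⟪⟫⁻ : ∀ {n} {P : Fin n → Set} (P? : Decidable P) {i} → i ∈ ⟪ P? ⟫ → P i
  ∈⟪⟫⁻ P? {i} i∈ with P? i | trans (sym (lookup∘tabulate (does ∘ P?) i)) ([]=⇒lookup i∈)
  ... | yes Pi | _ = Pi
  ... | no  _  | ()

∣p∪q∣≤∣p∣+∣q∣ : ∀ {n} (p q : Subset n) → ∣ p ∪ q ∣ ℕ.≤ ∣ p ∣ ℕ.+ ∣ q ∣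
∣p∪q∣≤∣p∣+∣q∣ []          []          = z≤n
∣p∪q∣≤∣p∣+∣q∣ (true  ∷ p) (true  ∷ q) = s≤s (ℕ.≤-trans (ℕ.m≤n⇒m≤1+n (∣p∪q∣≤∣p∣+∣q∣ p q)) (ℕ.≤-reflexive (sym (ℕ.+-suc _ _))))
∣p∪q∣≤∣p∣+∣q∣ (true  ∷ p) (false ∷ q) = s≤s (∣p∪q∣≤∣p∣+∣q∣ p q)
∣p∪q∣≤∣p∣+∣q∣ (false ∷ p) (true  ∷ q) = ℕ.≤-trans (s≤s (∣p∪q∣≤∣p∣+∣q∣ p q)) (ℕ.≤-reflexive (sym (ℕ.+-suc _ _)))
∣p∪q∣≤∣p∣+∣q∣ (false ∷ p) (false ∷ q) = ∣p∪q∣≤∣p∣+∣q∣ p q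

intersect : ∀ {n} (p q : Subset n) → n ℕ.< ∣ p ∣ ℕ.+ ∣ q ∣ → ∃[ i ] i ∈ p × i ∈ q
intersect {n} p q n<p+q with nonempty? (p ∩ q)
... | yes (i , i∈) = i , x∈p∩q⁻ p q i∈
... | no  empty    = contradiction n<p+q (ℕ.≤⇒≯ (begin
  ∣ p ∣ ℕ.+ ∣ q ∣        ≤⟨ ℕ.+-monoʳ-≤ ∣ p ∣ (p⊆q⇒∣p∣≤∣q∣ λ {i} i∈q → x∉p⇒x∈∁p λ i∈p → empty (i , x∈p∩q⁺ (i∈p , i∈q))) ⟩
  ∣ p ∣ ℕ.+ ∣ ∁ p ∣      ≡⟨ cong (∣ p ∣ ℕ.+_) (∣∁p∣≡n∸∣p∣ p) ⟩
  ∣ p ∣ ℕ.+ (n ℕ.∸ ∣ p ∣)  ≡⟨ ℕ.m+[n∸m]≡n (∣p∣≤n p) ⟩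
  n                    ∎))
  where open ℕ.≤-Reasoning

-- Edge `p` leaves the vertex of slot `p` and enters the vertex of slot `σ p`, so all in- and
-- out-degrees are `d`. A state is a mod 2 labelling of the edges.
module Multigraph {n d : ℕ} (σ : Permutation′ (n ℕ.* d)) where
  open import Data.Nat.Base using (_+_; _*_; _∸_; _<_)
  open import Data.Nat.Properties hiding (_≟_)

  State : Set
  State = Subset (n * d)

  infixl 6 _⊕ₛ_
  _⊕ₛ_ : State → State → State
  _⊕ₛ_ = zipWith _xor_

  tail head : Fin (n * d) → Fin n
  tail p = quotient d p
  head p = quotient d (σ ⟨$⟩ʳ p)

  -- The first `d` slots at `v` carry the edges that leave it, the others those that enter it. A
  -- loop fills one of each kind and so cancels in `∂`.
  edge : Fin n → Fin (d + d) → Fin (n * d)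
  edge v s = [ (λ j → combine v j) , (λ j → σ ⟨$⟩ˡ combine v j) ]′ (splitAt d s)

  val : State → Fin n → Fin (d + d) → Bool
  val x v s = lookup x (edge v s)

  ∂ : State → Fin n → Bool
  ∂ x v = ⨁ (val x v)

  val-⊕ : ∀ x y v s → val (x ⊕ₛ y) v s ≡ val x v s xor val y v s
  val-⊕ x y v s = lookup-zipWith _xor_ (edge v s) x y

  ∂-⊕ : ∀ x y v → ∂ (x ⊕ₛ y) v ≡ ∂ x v xor ∂ y v
  ∂-⊕ x y v = trans (⊕.∑-cong (val-⊕ x y v)) (⊕.∑-∙ (val x v) (val y v))

  ∂-split : ∀ x v → ∂ x v ≡ ⨁ (λ j → lookup x (combine v j)) xor ⨁ (λ j → lookup x (σ ⟨$⟩ˡ combine v j))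
  ∂-split x v = trans (⊕.∑-+ d (val x v)) (cong₂ _xor_
    (⊕.∑-cong λ j → cong (lookup x ∘ [ _ , _ ]′) (splitAt-↑ˡ d j d))
    (⊕.∑-cong λ j → cong (lookup x ∘ [ _ , _ ]′) (splitAt-↑ʳ d d j)))

  -- Handshaking: each edge is summed once at its tail and once at its head, and `σ` matches the two
  -- sums.
  ∂-total : ∀ x → ⨁ (∂ x) ≡ false
  ∂-total x = begin
    ⨁ (∂ x)                                     ≡⟨ trans (⊕.∑-cong (∂-split x)) (⊕.∑-∙ _ _) ⟩
    ⨁ (λ v → ⨁ λ j → lookup x (combine v j)) xor
    ⨁ (λ v → ⨁ λ j → lookup x (σ ⟨$⟩ˡ combine v j))
                                                ≡⟨ sym (cong₂ _xor_ (⊕.∑-combine n (lookup x)) (⊕.∑-combine n (lookup x ∘ (σ ⟨$⟩ˡ_)))) ⟩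
    ⨁ (lookup x) xor ⨁ (lookup x ∘ (σ ⟨$⟩ˡ_))   ≡⟨ cong (_xor ⨁ (lookup x ∘ (σ ⟨$⟩ˡ_))) (⊕.∑-reindex (lookup x) (Perm.flip σ)) ⟩
    ⨁ (lookup x ∘ (σ ⟨$⟩ˡ_)) xor ⨁ (lookup x ∘ (σ ⟨$⟩ˡ_)) ≡⟨ Bool.xor-same (⨁ (lookup x ∘ (σ ⟨$⟩ˡ_))) ⟩
    false                                       ∎
    where open ≡-Reasoning

  δ-combine : ∀ (u v : Fin n) (i j : Fin d) → δ (combine u i) (combine v j) ≡ δ u v ∧ δ i j
  δ-combine u v i j = does-⇔ (record
    { to        = combine-injective u i v j
    ; from      = λ { (refl , refl) → refl }
    ; to-cong   = cong _
    ; from-cong = cong _ }) (combine u i ≟ combine v j) ((u ≟ v) ×-dec (i ≟ j))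

  ⨁-δ-combine : ∀ p v → ⨁ (λ j → δ p (combine {n} {d} v j)) ≡ δ (quotient d p) v
  ⨁-δ-combine p v = begin
    ⨁ (λ j → δ p (combine v j))              ≡⟨ ⊕.∑-cong (λ j → trans (cong (λ q → δ q (combine v j)) (sym (combine-remQuot {n} d p)))
                                                                       (δ-combine u v i j)) ⟩
    ⨁ (λ j → δ u v ∧ δ i j)                  ≡⟨ ⊕.∑-*ˡ (δ u v) (δ i) ⟩
    δ u v ∧ ⨁ (δ i)                          ≡⟨ trans (cong (δ u v ∧_) (⨁-δ i)) (Bool.∧-identityʳ _) ⟩
    δ u v                                    ∎
    where
    open ≡-Reasoning
    u = quotient {n} d p
    i = proj₂ (remQuot {n} d p)

  δ-σ : ∀ p q → δ p (σ ⟨$⟩ˡ q) ≡ δ (σ ⟨$⟩ʳ p) q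
  δ-σ p q = does-⇔ (record
    { to        = λ { refl → Perm.inverseʳ σ }
    ; from      = λ { refl → sym (Perm.inverseˡ σ) }
    ; to-cong   = cong _
    ; from-cong = cong _ }) (p ≟ σ ⟨$⟩ˡ q) (σ ⟨$⟩ʳ p ≟ q)

  ∂-⁅⁆ : ∀ p v → ∂ ⁅ p ⁆ v ≡ δ (tail p) v xor δ (head p) v
  ∂-⁅⁆ p v = trans (∂-split ⁅ p ⁆ v) (cong₂ _xor_
    (trans (⊕.∑-cong λ j → lookup-⁅⁆ p _) (⨁-δ-combine p v))
    (trans (⊕.∑-cong λ j → trans (lookup-⁅⁆ p _) (δ-σ p _)) (⨁-δ-combine (σ ⟨$⟩ʳ p) v)))

  edge-endpoint : ∀ v s → tail (edge v s) ≡ v ⊎ head (edge v s) ≡ v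
  edge-endpoint v s with splitAt d s
  ... | inj₁ j = inj₁ (cong proj₁ (remQuot-combine v j))
  ... | inj₂ j = inj₂ (trans (cong (quotient d) (Perm.inverseʳ σ)) (cong proj₁ (remQuot-combine v j)))

  tail-edge : ∀ p → ∃[ s ] edge (tail p) s ≡ p
  tail-edge p = j ↑ˡ d , trans (cong [ _ , _ ]′ (splitAt-↑ˡ d j d)) (combine-remQuot {n} d p)
    where j = proj₂ (remQuot {n} d p)

  -- A witness of Connected Z u v is (mod 2) a union of a path from u to v and cycles, all avoiding Z.
  record Connected (Z : Subset n) (u v : Fin n) : Set where
    constructor connection
    field
      links    : State
      avoiding : ∀ w → w ∈ Z → ∀ s → val links w s ≡ false
      boundary : ∀ w → ∂ links w ≡ δ u w xor δ v w

  opaque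
    -- As a witness is one labelling rather than a path, a search through the finitely many
    -- labellings decides.
    connected? : ∀ Z u v → Dec (Connected Z u v)
    connected? Z u v = map′ (λ (q , a , b) → connection q a b) (λ (connection q a b) → q , a , b)
      (anySubset? λ q → all? (λ w → (w ∈? Z) →-dec all? λ s → val q w s Bool.≟ false) ×-dec
                        all? (λ w → ∂ q w Bool.≟ (δ u w xor δ v w)))

  connected-refl : ∀ Z u → Connected Z u u
  connected-refl Z u = connection ⊥ (λ w _ s → lookup-⊥ (edge w s)) λ w →
    trans (trans (⊕.∑-cong (λ s → lookup-⊥ (edge w s))) (⨁-false _)) (sym (Bool.xor-same (δ u w)))

  connected-sym : ∀ {Z u v} → Connected Z u v → Connected Z v u
  connected-sym {u = u} {v} (connection q q₀ ∂q) = connection q q₀ λ w → trans (∂q w) (Bool.xor-comm (δ u w) (δ v w))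

  connected-trans : ∀ {Z u v w} → Connected Z u v → Connected Z v w → Connected Z u w
  connected-trans {u = u} {v} {w} (connection q q₀ ∂q) (connection r r₀ ∂r) = connection
    (q ⊕ₛ r)
    (λ y y∈Z s → trans (val-⊕ q r y s) (cong₂ _xor_ (q₀ y y∈Z s) (r₀ y y∈Z s)))
    (λ y → trans (∂-⊕ q r y) (trans (cong₂ _xor_ (∂q y) (∂r y)) (cancel (δ u y) (δ v y) (δ w y))))
    where
    cancel : ∀ a b c → (a xor b) xor (b xor c) ≡ a xor c
    cancel a b c = trans (Bool.xor-assoc a b (b xor c)) (cong (a xor_)
      (trans (sym (Bool.xor-assoc b b c)) (cong (_xor c) (Bool.xor-same b))))

  connected-mono : ∀ {Z Z′ u v} → Z ⊆ Z′ → Connected Z′ u v → Connected Z u v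
  connected-mono Z⊆Z′ (connection q q₀ ∂q) = connection q (λ w w∈Z → q₀ w (Z⊆Z′ w∈Z)) ∂q

  connected-edge : ∀ {Z} p → tail p ∉ Z → head p ∉ Z → Connected Z (tail p) (head p)
  connected-edge {Z} p t∉Z h∉Z = connection ⁅ p ⁆ avoid (∂-⁅⁆ p)
    where
    avoid : ∀ w → w ∈ Z → ∀ s → val ⁅ p ⁆ w s ≡ false
    avoid w w∈Z s with lookup ⁅ p ⁆ (edge w s) in eq
    ... | false = refl
    ... | true with refl ← x∈⁅y⁆⇒x≡y p (lookup⇒[]= (edge w s) ⁅ p ⁆ eq) | edge-endpoint w s
    ...   | inj₁ t≡w = contradiction (subst (_∈ Z) (sym t≡w) w∈Z) t∉Z
    ...   | inj₂ h≡w = contradiction (subst (_∈ Z) (sym h≡w) w∈Z) h∉Z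

  component? : ∀ Z w → Decidable (λ v → v ∉ Z × Connected Z w v)
  component? Z w v = ¬? (v ∈? Z) ×-dec connected? Z w v

  component : Subset n → Fin n → Subset n
  component Z w = ⟪ component? Z w ⟫

  Giant : Subset n → Fin n → Set
  Giant Z w = w ∉ Z × n < 2 * ∣ component Z w ∣

  giant? : ∀ Z w → Dec (Giant Z w)
  giant? Z w = ¬? (w ∈? Z) ×-dec (n <? 2 * ∣ component Z w ∣)

  -- Two components with more than half of the vertices each share a vertex. The connection from
  -- `w′` to it avoids `Z′`, hence also the smaller `Z`.
  giants-connected : ∀ {Z Z′ w w′} → Z ⊆ Z′ → Giant Z w → Giant Z′ w′ → Connected Z w w′
  giants-connected {Z} {Z′} {w} {w′} Z⊆Z′ (_ , big) (_ , big′) =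
    let v , v∈ , v∈′ = intersect (component Z w) (component Z′ w′) (*-cancelˡ-< 2 n _ (begin-strict
          2 * n             ≡⟨ cong (n +_) (+-identityʳ n) ⟩
          n + n             <⟨ +-mono-< big big′ ⟩
          2 * a + 2 * b     ≡⟨ sym (*-distribˡ-+ 2 a b) ⟩
          2 * (a + b)       ∎))
    in connected-trans (proj₂ (∈⟪⟫⁻ (component? Z w) v∈))
         (connected-sym (connected-mono Z⊆Z′ (proj₂ (∈⟪⟫⁻ (component? Z′ w′) v∈′))))
    where
    open ≤-Reasoning
    a = ∣ component Z w ∣
    b = ∣ component Z′ w′ ∣

  Mixing : ℕ → Set
  Mixing t = ∀ A B → t ≤ ∣ A ∣ → t ≤ ∣ B ∣ → ∃[ p ] tail p ∈ A × head p ∈ B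

  -- Adding components one at a time, the union jumps from below t to above n - ∣ Z ∣ - t at a giant one.
  giant-exists : ∀ {t} Z → 1 ≤ t → Mixing t → 4 * t + 2 * ∣ Z ∣ ≤ n → ∃[ w ] Giant Z w
  giant-exists {t} Z 1≤t mixing room = search n ≤-refl (begin
      t                   ≤⟨ +-cancelʳ-≤ ∣ Z ∣ t _ (≤-trans
                               (+-mono-≤ (m≤m+n t (3 * t)) (m≤m+n ∣ Z ∣ (1 * ∣ Z ∣)))
                               (≤-trans room (≤-reflexive (sym (trans (+-comm _ ∣ Z ∣) (trans (cong (∣ Z ∣ +_) (∣∁p∣≡n∸∣p∣ Z)) (m+[n∸m]≡n (∣p∣≤n Z)))))))) ⟩
      ∣ ∁ Z ∣             ≤⟨ p⊆q⇒∣p∣≤∣q∣ (λ {v} v∈ → ∈⟪⟫⁺ (union? n)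
                               (x∈∁p⇒x∉p v∈ , v , toℕ<n v , x∈∁p⇒x∉p v∈ , connected-refl Z v)) ⟩
      ∣ union n ∣         ∎)
    where
    open ≤-Reasoning
    Union : ℕ → Fin n → Set
    Union i v = v ∉ Z × (∃[ u ] toℕ u < i × u ∉ Z × Connected Z u v)

    union? : ∀ i → Decidable (Union i)
    union? i v = ¬? (v ∈? Z) ×-dec any? λ u → (toℕ u <? i) ×-dec (¬? (u ∈? Z) ×-dec connected? Z u v)

    union : ℕ → Subset n
    union i = ⟪ union? i ⟫

    rest : ℕ → Subset n
    rest i = ∁ (union i ∪ Z)

    -- Otherwise mixing gives an edge from the union to the rest, whose head would belong to the
    -- union as well.
    rest-small : ∀ i → t ≤ ∣ union i ∣ → ∣ rest i ∣ < t
    rest-small i t≤ with ∣ rest i ∣ <? t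
    ... | yes <t = <t
    ... | no  ≮t =
      let p , t∈ , h∈ = mixing (union i) (rest i) t≤ (≮⇒≥ ≮t)
          t∉Z , u , u<i , u∉Z , u~t = ∈⟪⟫⁻ (union? i) t∈
          h∉ = x∈∁p⇒x∉p h∈
          h∉Z = λ h∈Z → h∉ (x∈p∪q⁺ (inj₂ h∈Z))
      in contradiction
           (x∈p∪q⁺ (inj₁ (∈⟪⟫⁺ (union? i)
             (h∉Z , u , u<i , u∉Z , connected-trans u~t (connected-edge p t∉Z h∉Z))))) h∉

    -- The index descends until removing one more vertex `w` brings the union below `t`; then the
    -- component of `w` is giant.
    search : ∀ i → i ≤ n → t ≤ ∣ union i ∣ → ∃[ w ] Giant Z w
    search zero    _   t≤ = contradiction (≤-trans 1≤t (≤-trans t≤ (≤-trans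
      (p⊆q⇒∣p∣≤∣q∣ {q = ⊥} λ {v} v∈ → case ∈⟪⟫⁻ (union? 0) v∈ of λ { (_ , _ , () , _) })
      (≤-reflexive (∣⊥∣≡0 n))))) λ ()
    search (suc i) i<n t≤ with t ≤? ∣ union i ∣ | fromℕ< i<n ∈? Z
    ... | yes t≤′ | _ = search i (<⇒≤ i<n) t≤′
    ... | no  t≰  | yes w∈Z = contradiction (≤-trans t≤ (p⊆q⇒∣p∣≤∣q∣ λ {v} v∈ →
            case ∈⟪⟫⁻ (union? (suc i)) v∈ of λ { (v∉Z , u , s≤s u≤i , u∉Z , u~v) →
              case m≤n⇒m<n∨m≡n u≤i of λ
                { (inj₁ u<i) → ∈⟪⟫⁺ (union? i) (v∉Z , u , u<i , u∉Z , u~v)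
                ; (inj₂ u≡i) → contradiction (subst (_∈ Z) (toℕ-injective (trans (toℕ-fromℕ< i<n) (sym u≡i))) w∈Z) u∉Z } })) t≰
    -- The old union, the component of `w`, `Z` and the rest cover everything. The first and the
    -- last are below `t`, so doubling and comparing with `room` leaves `n < 2 * c`.
    ... | no  t≰  | no  w∉Z = w , w∉Z , +-cancelˡ-< (4 * t + 2 * ∣ Z ∣) n _ (begin-strict
        (4 * t + 2 * ∣ Z ∣) + n              ≤⟨ +-monoˡ-≤ n room ⟩
        n + n                                ≡⟨ cong (n +_) (sym (+-identityʳ n)) ⟩
        2 * n                                ≤⟨ *-monoʳ-≤ 2 cover ⟩
        2 * ((∣ union i ∣ + c) + ∣ Z ∣ + ∣ rest (suc i) ∣)
                                             <⟨ *-monoʳ-< 2 (+-mono-< (+-monoˡ-< ∣ Z ∣ (+-monoˡ-< c (≰⇒> t≰))) (rest-small (suc i) t≤)) ⟩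
        2 * ((t + c) + ∣ Z ∣ + t)            ≡⟨ regroup t c ∣ Z ∣ ⟩
        (4 * t + 2 * ∣ Z ∣) + 2 * c          ∎)
      where
      w = fromℕ< i<n
      c = ∣ component Z w ∣
      regroup : ∀ t c z → 2 * ((t + c) + z + t) ≡ (4 * t + 2 * z) + 2 * c
      regroup = solve-∀
      step : union (suc i) ⊆ union i ∪ component Z w
      step {v} v∈ = case ∈⟪⟫⁻ (union? (suc i)) v∈ of λ { (v∉Z , u , s≤s u≤i , u∉Z , u~v) →
        case m≤n⇒m<n∨m≡n u≤i of λ
          { (inj₁ u<i) → x∈p∪q⁺ (inj₁ (∈⟪⟫⁺ (union? i) (v∉Z , u , u<i , u∉Z , u~v)))
          ; (inj₂ u≡i) → x∈p∪q⁺ (inj₂ (∈⟪⟫⁺ (component? Z w) (v∉Z ,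
              subst (λ u → Connected Z u v) (toℕ-injective (trans u≡i (sym (toℕ-fromℕ< i<n)))) u~v))) } }
      cover : n ≤ (∣ union i ∣ + c) + ∣ Z ∣ + ∣ rest (suc i) ∣
      cover = begin
        n                                                    ≡⟨ sym (m+[n∸m]≡n (∣p∣≤n (union (suc i) ∪ Z))) ⟩
        ∣ union (suc i) ∪ Z ∣ + (n ∸ ∣ union (suc i) ∪ Z ∣)  ≡⟨ cong (∣ union (suc i) ∪ Z ∣ +_) (sym (∣∁p∣≡n∸∣p∣ (union (suc i) ∪ Z))) ⟩
        ∣ union (suc i) ∪ Z ∣ + ∣ rest (suc i) ∣             ≤⟨ +-monoˡ-≤ _ (≤-trans (∣p∪q∣≤∣p∣+∣q∣ (union (suc i)) Z) (+-monoˡ-≤ ∣ Z ∣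
                                                                  (≤-trans (p⊆q⇒∣p∣≤∣q∣ step) (∣p∪q∣≤∣p∣+∣q∣ (union i) (component Z w))))) ⟩
        (∣ union i ∣ + c) + ∣ Z ∣ + ∣ rest (suc i) ∣         ∎

-- Averages over labellings

open CommutativeRing ℚ.+-*-commutativeRing using () renaming (semiring to ℚ-semiring)
module Σℚ = SemiringSum ℚ-semiring
open Σℚ using (∑⊆)

0≤1 : 0ℚ ℚ.≤ 1ℚ
0≤1 = ℚ.nonNegative⁻¹ 1ℚ

0≤*0≤ : ∀ {p q} → 0ℚ ℚ.≤ p → 0ℚ ℚ.≤ q → 0ℚ ℚ.≤ p ℚ.* q
0≤*0≤ {p} {q} 0≤p 0≤q = ℚ.nonNegative⁻¹ (p ℚ.* q)
  {{ℚ.nonNeg*nonNeg⇒nonNeg p {{ℚ.nonNegative 0≤p}} q {{ℚ.nonNegative 0≤q}}}}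

ind : Bool → ℚ
ind true  = 1ℚ
ind false = 0ℚ

0≤ind : ∀ b → 0ℚ ℚ.≤ ind b
0≤ind true  = 0≤1
0≤ind false = ℚ.≤-refl

opaque
  unfolding ∑⊆

  ∑⊆-nonneg : ∀ {n} {f : Subset n → ℚ} → (∀ S → 0ℚ ℚ.≤ f S) → 0ℚ ℚ.≤ ∑⊆ f
  ∑⊆-nonneg {zero}  0≤f = 0≤f []
  ∑⊆-nonneg {suc n} 0≤f = ℚ.+-mono-≤ (∑⊆-nonneg (0≤f ∘ (false ∷_))) (∑⊆-nonneg (0≤f ∘ (true ∷_)))

  ∑⊆-term : ∀ {n} {f : Subset n → ℚ} → (∀ S → 0ℚ ℚ.≤ f S) → ∀ S → f S ℚ.≤ ∑⊆ f
  ∑⊆-term         0≤f []          = ℚ.≤-refl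
  ∑⊆-term {f = f} 0≤f (false ∷ S) = subst (ℚ._≤ _) (ℚ.+-identityʳ (f (false ∷ S)))
    (ℚ.+-mono-≤ (∑⊆-term (0≤f ∘ (false ∷_)) S) (∑⊆-nonneg (0≤f ∘ (true ∷_))))
  ∑⊆-term {f = f} 0≤f (true ∷ S)  = subst (ℚ._≤ _) (ℚ.+-identityˡ (f (true ∷ S)))
    (ℚ.+-mono-≤ (∑⊆-nonneg (0≤f ∘ (false ∷_))) (∑⊆-term (0≤f ∘ (true ∷_)) S))

module Averaging {n d : ℕ} (σ : Permutation′ (n ℕ.* d)) (default : Fin n) where
  open Multigraph {n} {d} σ

  opaque
    centre : Subset n → Fin n
    centre Z with any? (giant? Z)
    ... | yes (w , _) = w
    ... | no  _       = default

    centre-giant : ∀ {Z} → ∃[ w ] Giant Z w → Giant Z (centre Z)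
    centre-giant {Z} g with any? (giant? Z)
    ... | yes (_ , h) = h
    ... | no  ¬g      = contradiction g ¬g

  -- The twist sits at the centre for no deleted vertices. It is thus connected to all other giant
  -- centres `w`, which makes labellings with boundary `v₀ + w` exist; for `w = v₀` these are the
  -- cycles.
  v₀ : Fin n
  v₀ = centre ⊥

  Ω : Fin n → State → Set
  Ω w x = ∀ v → ∂ x v ≡ δ v₀ v xor δ w v

  opaque
    Ω? : ∀ w x → Dec (Ω w x)
    Ω? w x = all? λ v → ∂ x v Bool.≟ (δ v₀ v xor δ w v)

  weight : Fin n → State → ℚ
  weight w x = ind (does (Ω? w x))

  total : Fin n → (State → ℚ) → ℚ
  total w f = ∑⊆ λ x → weight w x ℚ.* f x

  LocalOn : Subset n → (State → ℚ) → Set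
  LocalOn Z f = ∀ x y → (∀ v → v ∈ Z → ∀ s → val x v s ≡ val y v s) → f x ≡ f y

  -- The connecting labelling `q` has boundary `w + w′`, so adding it carries `Ω w′` onto `Ω w`; it
  -- vanishes at the slots of `Z`, so `f` does not notice.
  total-moves : ∀ {Z w w′ f} → Connected Z w w′ → LocalOn Z f → total w f ≡ total w′ f
  total-moves {Z} {w} {w′} {f} (connection q q₀ ∂q) local = begin
    ∑⊆ (λ x → weight w x ℚ.* f x)                        ≡⟨ sym (Σℚ.∑⊆-translate q _) ⟩
    ∑⊆ (λ x → weight w (q ⊕ₛ x) ℚ.* f (q ⊕ₛ x))          ≡⟨ Σℚ.∑⊆-cong (λ x → cong₂ ℚ._*_ (weights x) (values x)) ⟩
    ∑⊆ (λ x → weight w′ x ℚ.* f x)                       ∎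
    where
    open ≡-Reasoning
    open BoolSolver.xor-∧-Solver using (solve; _:+_; _:=_)
    values : ∀ x → f (q ⊕ₛ x) ≡ f x
    values x = local (q ⊕ₛ x) x λ v v∈Z s → trans (val-⊕ q x v s) (cong (_xor val x v s) (q₀ v v∈Z s))
    cancel : ∀ b c o → (b xor c) xor (o xor b) ≡ o xor c
    cancel = solve 3 (λ b c o → (b :+ c) :+ (o :+ b) := o :+ c) refl
    undo : ∀ b c a → (b xor c) xor ((b xor c) xor a) ≡ a
    undo = solve 3 (λ b c a → (b :+ c) :+ ((b :+ c) :+ a) := a) refl
    redo : ∀ b c o → (b xor c) xor (o xor c) ≡ o xor b
    redo = solve 3 (λ b c o → (b :+ c) :+ (o :+ c) := o :+ b) refl
    ∂-shift : ∀ x v → ∂ (q ⊕ₛ x) v ≡ (δ w v xor δ w′ v) xor ∂ x v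
    ∂-shift x v = trans (∂-⊕ q x v) (cong (_xor ∂ x v) (∂q v))
    weights : ∀ x → weight w (q ⊕ₛ x) ≡ weight w′ x
    weights x = cong ind (does-⇔ (mk⇔
      (λ ω v → trans (sym (undo (δ w v) (δ w′ v) (∂ x v)))
                 (trans (cong ((δ w v xor δ w′ v) xor_) (trans (sym (∂-shift x v)) (ω v)))
                        (cancel (δ w v) (δ w′ v) (δ v₀ v))))
      (λ ω v → trans (∂-shift x v) (trans (cong ((δ w v xor δ w′ v) xor_) (ω v))
                 (redo (δ w v) (δ w′ v) (δ v₀ v))))) (Ω? w (q ⊕ₛ x)) (Ω? w′ x))

  total₀ : ℚ
  total₀ = total v₀ (λ _ → 1ℚ)

  total₀-positive : ℚ.Positive total₀
  total₀-positive = ℚ.positive (ℚ.<-≤-trans (ℚ.positive⁻¹ 1ℚ) (subst (ℚ._≤ total₀) one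
    (∑⊆-term (λ x → 0≤*0≤ (0≤ind (does (Ω? v₀ x))) 0≤1) ⊥)))
    where
    one : weight v₀ ⊥ ℚ.* 1ℚ ≡ 1ℚ
    one = trans (ℚ.*-identityʳ _) (cong ind (dec-true (Ω? v₀ ⊥) λ v →
      trans (trans (⊕.∑-cong (λ s → lookup-⊥ (edge v s))) (⨁-false _)) (sym (Bool.xor-same (δ v₀ v)))))

  private instance
    total₀-nonZero : ℚ.NonZero total₀
    total₀-nonZero = ℚ.pos⇒nonZero total₀ {{total₀-positive}}

  opaque
    scale : ℚ
    scale = ℚ.1/ total₀

    0≤scale : 0ℚ ℚ.≤ scale
    0≤scale = ℚ.<⇒≤ (ℚ.positive⁻¹ scale {{ℚ.1/pos⇒pos total₀ {{total₀-positive}}}})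

    scale-total₀ : scale ℚ.* total₀ ≡ 1ℚ
    scale-total₀ = ℚ.*-inverseˡ total₀

  -- total₀ normalises all centres alike: for small Z, total (centre Z) (λ _ → 1ℚ) does not depend on Z.
  avg : Subset n → (State → ℚ) → ℚ
  avg Z f = scale ℚ.* total (centre Z) f

  total-cong : ∀ {w f g} → (∀ x → Ω w x → f x ≡ g x) → total w f ≡ total w g
  total-cong {w} {f} {g} e = Σℚ.∑⊆-cong λ x → lemma x
    where
    lemma : ∀ x → weight w x ℚ.* f x ≡ weight w x ℚ.* g x
    lemma x with Ω? w x
    ... | yes ω = cong (1ℚ ℚ.*_) (e x ω)
    ... | no  _ = trans (ℚ.*-zeroˡ (f x)) (sym (ℚ.*-zeroˡ (g x)))

  avg-cong : ∀ {Z f g} → (∀ x → Ω (centre Z) x → f x ≡ g x) → avg Z f ≡ avg Z g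
  avg-cong e = cong (scale ℚ.*_) (total-cong e)

  avg-+ : ∀ Z f g → avg Z (λ x → f x ℚ.+ g x) ≡ avg Z f ℚ.+ avg Z g
  avg-+ Z f g = trans (cong (scale ℚ.*_) (trans
      (Σℚ.∑⊆-cong λ x → ℚ.*-distribˡ-+ (weight (centre Z) x) (f x) (g x)) (Σℚ.∑⊆-+ _ _)))
    (ℚ.*-distribˡ-+ scale _ _)

  avg-*ˡ : ∀ Z a f → avg Z (λ x → a ℚ.* f x) ≡ a ℚ.* avg Z f
  avg-*ˡ Z a f = begin
    scale ℚ.* ∑⊆ (λ x → W x ℚ.* (a ℚ.* f x))  ≡⟨ cong (scale ℚ.*_) (Σℚ.∑⊆-cong λ x → swap (W x) a (f x)) ⟩
    scale ℚ.* ∑⊆ (λ x → a ℚ.* (W x ℚ.* f x))  ≡⟨ cong (scale ℚ.*_) (Σℚ.∑⊆-*ˡ a _) ⟩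
    scale ℚ.* (a ℚ.* ∑⊆ (λ x → W x ℚ.* f x))  ≡⟨ swap scale a _ ⟩
    a ℚ.* avg Z f                             ∎
    where
    open ≡-Reasoning
    W = weight (centre Z)
    swap : ∀ p q r → p ℚ.* (q ℚ.* r) ≡ q ℚ.* (p ℚ.* r)
    swap p q r = trans (sym (ℚ.*-assoc p q r)) (trans (cong (ℚ._* r) (ℚ.*-comm p q)) (ℚ.*-assoc q p r))

  avg-0 : ∀ Z → avg Z (λ _ → 0ℚ) ≡ 0ℚ
  avg-0 Z = trans (cong (λ y → scale ℚ.* y) (trans (Σℚ.∑⊆-cong λ x → ℚ.*-zeroʳ (weight (centre Z) x)) (Σℚ.∑⊆-0# _))) (ℚ.*-zeroʳ scale)

  avg-nonneg : ∀ {Z f} → (∀ x → 0ℚ ℚ.≤ f x) → 0ℚ ℚ.≤ avg Z f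
  avg-nonneg {Z} 0≤f = 0≤*0≤ 0≤scale (∑⊆-nonneg λ x → 0≤*0≤ (0≤ind (does (Ω? (centre Z) x))) (0≤f x))

  module Robust {r : ℕ} (giants : ∀ Z → ∣ Z ∣ ℕ.≤ r → ∃[ w ] Giant Z w) where

    centres-connected : ∀ {Z Z′} → Z ⊆ Z′ → ∣ Z′ ∣ ℕ.≤ r → Connected Z (centre Z) (centre Z′)
    centres-connected Z⊆Z′ small = giants-connected Z⊆Z′
      (centre-giant (giants _ (ℕ.≤-trans (p⊆q⇒∣p∣≤∣q∣ Z⊆Z′) small))) (centre-giant (giants _ small))

    centre∉ : ∀ {Z} → ∣ Z ∣ ℕ.≤ r → centre Z ∉ Z
    centre∉ small = proj₁ (centre-giant (giants _ small))

    -- A constant is local on the empty set, whose centre is `v₀`, so its total can be moved to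
    -- `v₀`, where `scale` normalises it.
    avg-1 : ∀ {Z} → ∣ Z ∣ ℕ.≤ r → avg Z (λ _ → 1ℚ) ≡ 1ℚ
    avg-1 {Z} small = trans
      (cong (scale ℚ.*_) (sym (total-moves {f = λ _ → 1ℚ} (centres-connected (λ x∈⊥ → contradiction x∈⊥ ∉⊥) small) (λ _ _ _ → refl))))
      scale-total₀

    -- Both are compared with the centre of `Z ∪ Z′`: one centre moves there avoiding `Z`, the other
    -- avoiding `Z′`, and `f` is blind to either move. This needs a giant component for the union.
    avg-local : ∀ {Z Z′ f} → ∣ Z ∣ ℕ.+ ∣ Z′ ∣ ℕ.≤ r → LocalOn Z f → LocalOn Z′ f → avg Z f ≡ avg Z′ f
    avg-local {Z} {Z′} small local local′ = cong (scale ℚ.*_) (trans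
      (total-moves (centres-connected (p⊆p∪q Z′) small′) local)
      (sym (total-moves (centres-connected (q⊆p∪q Z Z′) small′) local′)))
      where
      small′ : ∣ Z ∪ Z′ ∣ ℕ.≤ r
      small′ = ℕ.≤-trans (∣p∪q∣≤∣p∣+∣q∣ Z Z′) small

-- Evaluating polynomials at 0/1 points

-- The identities between reals below hold exactly at every index of the Cauchy sequences, so the
-- work is done in ℚ and no limit is taken.
≈-pointwise : ∀ x y → (∀ m → seq x m ≡ seq y m) → x ≈ y
≈-pointwise x y e = (λ ε 0<ε → 0 , λ m _ → bound 0<ε (e m)) , (λ ε 0<ε → 0 , λ m _ → bound 0<ε (sym (e m)))
  where
  bound : ∀ {p q ε} → 0ℚ ℚ.< ε → p ≡ q → p ℚ.≤ q ℚ.+ ε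
  bound {p} {ε = ε} 0<ε refl = subst (ℚ._≤ p ℚ.+ ε) (ℚ.+-identityʳ p) (ℚ.+-monoʳ-≤ p (ℚ.<⇒≤ 0<ε))

0≤-pointwise : ∀ x → (∀ m → 0ℚ ℚ.≤ seq x m) → 0ℝ ≤ℝ x
0≤-pointwise x 0≤x ε 0<ε = 0 , λ m _ → ℚ.+-mono-≤ (0≤x m) (ℚ.<⇒≤ 0<ε)

∑-select : ∀ {n} (a : Fin n) (g : Fin n → ℚ) → Σℚ.∑ (λ v → ind (δ a v) ℚ.* g v) ≡ g a
∑-select {suc n} a g = begin
  Σℚ.∑ (λ v → ind (δ a v) ℚ.* g v)
    ≡⟨ Σℚ.∑-removeAt a _ ⟩
  ind (δ a a) ℚ.* g a ℚ.+ Σℚ.∑ (λ k → ind (δ a (punchIn a k)) ℚ.* g (punchIn a k))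
    ≡⟨ cong₂ ℚ._+_
         (trans (cong (λ b → ind b ℚ.* g a) (dec-true (a ≟ a) refl)) (ℚ.*-identityˡ (g a)))
         (trans (Σℚ.∑-cong λ k → trans (cong (λ b → ind b ℚ.* g (punchIn a k)) (dec-false (a ≟ punchIn a k) (punchInᵢ≢i a k ∘ sym)))
                                       (ℚ.*-zeroˡ (g (punchIn a k))))
                (Σℚ.∑-ε n)) ⟩
  g a ℚ.+ 0ℚ
    ≡⟨ ℚ.+-identityʳ (g a) ⟩
  g a ∎
  where open ≡-Reasoning

ind-∧ : ∀ a b → ind (a ∧ b) ≡ ind a ℚ.* ind b
ind-∧ true  b = sym (ℚ.*-identityˡ (ind b))
ind-∧ false b = sym (ℚ.*-zeroˡ (ind b))

supp : ∀ {M} → Vec ℕ M → Subset M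
supp = Vec.map (0 ℕ.<ᵇ_)

supp-+ : ∀ {M} (d e : Vec ℕ M) → supp (zipWith ℕ._+_ d e) ≡ supp d ∪ supp e
supp-+ []          []      = refl
supp-+ (zero ∷ d)  (b ∷ e) = cong (_ ∷_) (supp-+ d e)
supp-+ (suc a ∷ d) (b ∷ e) = cong (true ∷_) (supp-+ d e)

supp-0 : ∀ M → supp (Vec.replicate M 0) ≡ ⊥
supp-0 zero    = refl
supp-0 (suc M) = cong (false ∷_) (supp-0 M)

supp-1 : ∀ {M} (i : Fin M) → supp (Vec.replicate M 0 Vec.[ i ]≔ 1) ≡ ⁅ i ⁆
supp-1 {suc M} zero = cong (true ∷_) (supp-0 M)
supp-1 (suc i)      = cong (false ∷_) (supp-1 i)

-- The value at `s` of the monomial with variable set `J`. At 0/1 points only the support of a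
-- monomial matters, so linearising preserves values there.
holds : ∀ {M} → (Fin M → Bool) → Subset M → Bool
holds s []      = true
holds s (b ∷ J) = (not b ∨ s zero) ∧ holds (s ∘ suc) J

holds-∪ : ∀ {M} (s : Fin M → Bool) I J → holds s (I ∪ J) ≡ holds s I ∧ holds s J
holds-∪ s []      []      = refl
holds-∪ s (a ∷ I) (b ∷ J) rewrite holds-∪ (s ∘ suc) I J = lemma a b (s zero) (holds (s ∘ suc) I) (holds (s ∘ suc) J)
  where
  lemma : ∀ a b s h k → (not (a ∨ b) ∨ s) ∧ (h ∧ k) ≡ ((not a ∨ s) ∧ h) ∧ ((not b ∨ s) ∧ k)
  lemma false b     s     false k = Bool.∧-zeroʳ _
  lemma false b     s     true  k = refl
  lemma true  b     false h     k = refl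
  lemma true  false true  h     k = refl
  lemma true  true  true  h     k = refl

holds-cong : ∀ {M} {s s′ : Fin M → Bool} J → (∀ i → i ∈ J → s i ≡ s′ i) → holds s J ≡ holds s′ J
holds-cong []          e = refl
holds-cong (true  ∷ J) e = cong₂ _∧_ (e zero here) (holds-cong J λ i i∈ → e (suc i) (there i∈))
holds-cong (false ∷ J) e = holds-cong J λ i i∈ → e (suc i) (there i∈)

holds-empty : ∀ {M} (s : Fin M → Bool) J → Subset.Empty J → holds s J ≡ true
holds-empty s []          _     = refl
holds-empty s (true  ∷ J) empty = contradiction (zero , here) empty
holds-empty s (false ∷ J) empty = holds-empty (s ∘ suc) J λ (i , i∈) → empty (suc i , there i∈)

holds-⁅⁆ : ∀ {M} (s : Fin M → Bool) i → holds s ⁅ i ⁆ ≡ s i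
holds-⁅⁆ {suc M} s zero    = trans (cong (s zero ∧_) (holds-empty (s ∘ suc) ⊥ λ (i , i∈) → ∉⊥ i∈)) (Bool.∧-identityʳ _)
holds-⁅⁆ {suc M} s (suc i) = holds-⁅⁆ (s ∘ suc) i

monomial-elim : ∀ {M} (y : Subset M → ℝ) (P : ℝ → Set) I →
                (Subset.Nonempty I → P (y I)) → (Subset.Empty I → P 1ℝ) → P (monomial y I)
monomial-elim y P I yes-case no-case with nonempty? I
... | yes i∈I   = yes-case i∈I
... | no  empty = no-case empty

-- The value at the 0/1 point s when every real coefficient is replaced by its m-th approximation.
eval : ∀ {M} → ℕ → (Fin M → Bool) → Polynomial M → ℚ
eval m s []            = 0ℚ
eval m s ((c , d) ∷ p) = seq c m ℚ.* ind (holds s (supp d)) ℚ.+ eval m s p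

module _ {M : ℕ} (m : ℕ) (s : Fin M → Bool) where

  eval-++ : ∀ p q → eval m s (p ++ q) ≡ eval m s p ℚ.+ eval m s q
  eval-++ []      q = sym (ℚ.+-identityˡ _)
  eval-++ ((c , d) ∷ p) q = trans (cong (t ℚ.+_) (eval-++ p q)) (sym (ℚ.+-assoc t (eval m s p) (eval m s q)))
    where t = seq c m ℚ.* ind (holds s (supp d))

  eval-mulTerm : ∀ c d q → eval m s (List.map (mulTerm (c , d)) q) ≡ (seq c m ℚ.* ind (holds s (supp d))) ℚ.* eval m s q
  eval-mulTerm c d []            = sym (ℚ.*-zeroʳ (seq c m ℚ.* ind (holds s (supp d))))
  eval-mulTerm c d ((b , e) ∷ q) = trans (cong₂ ℚ._+_
      (trans (cong (seq c m ℚ.* seq b m ℚ.*_) (trans (cong ind (trans (cong (holds s) (supp-+ d e)) (holds-∪ s (supp d) (supp e))))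
                                                     (ind-∧ (holds s (supp d)) (holds s (supp e)))))
             (interchange (seq c m) (seq b m) (ind (holds s (supp d))) (ind (holds s (supp e)))))
      (eval-mulTerm c d q))
    (sym (ℚ.*-distribˡ-+ (seq c m ℚ.* ind (holds s (supp d))) (seq b m ℚ.* ind (holds s (supp e))) (eval m s q)))
    where
    open ℚSolver.+-*-Solver
    interchange : ∀ x y z w → (x ℚ.* y) ℚ.* (z ℚ.* w) ≡ (x ℚ.* z) ℚ.* (y ℚ.* w)
    interchange = solve 4 (λ x y z w → (x :* y) :* (z :* w) := (x :* z) :* (y :* w)) refl

  eval-*ₚ : ∀ p q → eval m s (p *ₚ q) ≡ eval m s p ℚ.* eval m s q
  eval-*ₚ []            q = sym (ℚ.*-zeroˡ (eval m s q))
  eval-*ₚ ((c , d) ∷ p) q = trans (eval-++ (List.map (mulTerm (c , d)) q) (p *ₚ q))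
    (trans (cong₂ ℚ._+_ (eval-mulTerm c d q) (eval-*ₚ p q)) (sym (ℚ.*-distribʳ-+ (eval m s q) (seq c m ℚ.* ind (holds s (supp d))) (eval m s p))))

  eval-constₚ : ∀ c → eval m s (constₚ c) ≡ seq c m
  eval-constₚ c = trans (ℚ.+-identityʳ _) (trans
    (cong (λ b → seq c m ℚ.* ind b) (trans (cong (holds s) (supp-0 M)) (holds-empty s ⊥ λ (i , i∈) → ∉⊥ i∈)))
    (ℚ.*-identityʳ (seq c m)))

  eval-var : ∀ i → eval m s (var i) ≡ ind (s i)
  eval-var i = trans (ℚ.+-identityʳ _) (trans
    (cong (λ b → 1ℚ ℚ.* ind b) (trans (cong (holds s) (supp-1 i)) (holds-⁅⁆ s i)))
    (ℚ.*-identityˡ (ind (s i))))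

  eval--ₚ : ∀ p q → eval m s (p -ₚ q) ≡ eval m s p ℚ.- eval m s q
  eval--ₚ p q = trans (eval-++ p (constₚ -1ℝ *ₚ q)) (cong (eval m s p ℚ.+_)
    (trans (eval-*ₚ (constₚ -1ℝ) q) (trans (cong (ℚ._* eval m s q) (eval-constₚ -1ℝ)) (minus (eval m s q)))))
    where
    minus : ∀ x → (ℚ.- 1ℚ) ℚ.* x ≡ ℚ.- x
    minus x = trans (sym (ℚ.neg-distribˡ-* 1ℚ x)) (cong ℚ.-_ (ℚ.*-identityˡ x))

  eval-∑ₚ : ∀ {n} (F : Vector (Polynomial M) n) → eval m s (∑ₚ F) ≡ Σℚ.∑ (λ i → eval m s (F i))
  eval-∑ₚ {zero}  F = sym (Σℚ.∑-empty _)
  eval-∑ₚ {suc n} F = trans (eval-++ (F zero) (∑ₚ (F ∘ suc)))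
    (trans (cong (eval m s (F zero) ℚ.+_) (eval-∑ₚ (F ∘ suc))) (sym (Σℚ.∑-suc _)))

  eval-product-nonneg : ∀ {n} (F : Vector (Polynomial M) n) → (∀ i → 0ℚ ℚ.≤ eval m s (F i)) →
                        0ℚ ℚ.≤ eval m s (foldr _*ₚ_ (constₚ 1ℝ) F)
  eval-product-nonneg {zero}  F 0≤F = subst (0ℚ ℚ.≤_) (sym (eval-constₚ 1ℝ)) 0≤1
  eval-product-nonneg {suc n} F 0≤F = subst (0ℚ ℚ.≤_) (sym (eval-*ₚ (F zero) _))
    (0≤*0≤ (0≤F zero) (eval-product-nonneg (F ∘ suc) (0≤F ∘ suc)))

  eval-∏ₚ-nonneg : ∀ S {p} → (∀ i → 0ℚ ℚ.≤ eval m s (p i)) → 0ℚ ℚ.≤ eval m s (∏ₚ S p)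
  eval-∏ₚ-nonneg S {p} 0≤p = eval-product-nonneg _ λ i → factor i (lookup S i)
    where
    factor : ∀ i b → 0ℚ ℚ.≤ eval m s (if b then p i else constₚ 1ℝ)
    factor i true  = 0≤p i
    factor i false = subst (0ℚ ℚ.≤_) (sym (eval-constₚ 1ℝ)) 0≤1

-- Conditions on the variable sets of all monomials of a polynomial

Supports : ∀ {M} → (Subset M → Set) → Polynomial M → Set
Supports P = All (P ∘ supp ∘ proj₂)

module _ {M : ℕ} where

  supports-*ₚ : ∀ (P Q R : Subset M → Set) → (∀ {I J} → P I → Q J → R (I ∪ J)) →
                ∀ p q → Supports P p → Supports Q q → Supports R (p *ₚ q)
  supports-*ₚ P Q R c []      q []        Qq = []
  supports-*ₚ P Q R c (t ∷ p) q (Pt ∷ Pp) Qq =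
    All.++⁺ (All.map⁺ (All.map (λ {u} Qu → subst R (sym (supp-+ (proj₂ t) (proj₂ u))) (c Pt Qu)) Qq))
            (supports-*ₚ P Q R c p q Pp Qq)

  supports-constₚ : ∀ (P : Subset M → Set) c → P ⊥ → Supports P (constₚ c)
  supports-constₚ P c P⊥ = subst P (sym (supp-0 M)) P⊥ ∷ []

  supports-var : ∀ (P : Subset M → Set) i → P ⁅ i ⁆ → Supports P (var i)
  supports-var P i Pi = subst P (sym (supp-1 i)) Pi ∷ []

  supports-scale : ∀ (P : Subset M → Set) c p → Supports P p → Supports P (constₚ c *ₚ p)
  supports-scale P c p Pp = supports-*ₚ (_≡ ⊥) P P (λ { {_} {J} refl PJ → subst P (sym (∪-identityˡ J)) PJ })
    (constₚ c) p (supports-constₚ (_≡ ⊥) c refl) Pp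

  supports--ₚ : ∀ (P : Subset M → Set) p q → Supports P p → Supports P q → Supports P (p -ₚ q)
  supports--ₚ P p q Pp Pq = All.++⁺ Pp (supports-scale P -1ℝ q Pq)

  supports-∑ₚ : ∀ (P : Subset M → Set) {n} (F : Vector (Polynomial M) n) → (∀ i → Supports P (F i)) → Supports P (∑ₚ F)
  supports-∑ₚ P {zero}  F PF = []
  supports-∑ₚ P {suc n} F PF = All.++⁺ (PF zero) (supports-∑ₚ P (F ∘ suc) (PF ∘ suc))

  ∪-lub : ∀ {I J K : Subset M} → I ⊆ K → J ⊆ K → I ∪ J ⊆ K
  ∪-lub {I} {J} I⊆K J⊆K x∈ = [ I⊆K , J⊆K ]′ (x∈p∪q⁻ I J x∈)

  supports-∏ₚ : ∀ S (p : Fin M → Polynomial M) → (∀ i → Supports (_⊆ ⁅ i ⁆) (p i)) → Supports (_⊆ S) (∏ₚ S p)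
  supports-∏ₚ S p supports = go _ factor
    where
    go : ∀ {n} (F : Vector (Polynomial M) n) → (∀ i → Supports (_⊆ S) (F i)) → Supports (_⊆ S) (foldr _*ₚ_ (constₚ 1ℝ) F)
    go {zero}  F PF = supports-constₚ (_⊆ S) 1ℝ ⊥⊆
    go {suc n} F PF = supports-*ₚ (_⊆ S) (_⊆ S) (_⊆ S) (λ {I} {J} → ∪-lub {I} {J}) (F zero) _ (PF zero) (go (F ∘ suc) (PF ∘ suc))
    factor : ∀ i → Supports (_⊆ S) (if lookup S i then p i else constₚ 1ℝ)
    factor i with lookup S i in eq
    ... | true  = All.map (λ J⊆ {_} x∈J → subst (_∈ S) (sym (x∈⁅y⁆⇒x≡y i (J⊆ x∈J))) (lookup⇒[]= i S eq)) (supports i)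
    ... | false = supports-constₚ (_⊆ S) 1ℝ ⊥⊆

image : ∀ {M n} → (Fin M → Fin n) → Subset M → Subset n
image f []          = ⊥
image f (true  ∷ J) = ⁅ f zero ⁆ ∪ image (f ∘ suc) J
image f (false ∷ J) = image (f ∘ suc) J

∈-image : ∀ {M n} (f : Fin M → Fin n) {J i} → i ∈ J → f i ∈ image f J
∈-image f {true  ∷ J} here       = p⊆p∪q (image (f ∘ suc) J) (x∈⁅x⁆ (f zero))
∈-image f {true  ∷ J} (there i∈) = q⊆p∪q ⁅ f zero ⁆ (image (f ∘ suc) J) (∈-image (f ∘ suc) i∈)
∈-image f {false ∷ J} (there i∈) = ∈-image (f ∘ suc) i∈

∣image∣ : ∀ {M n} (f : Fin M → Fin n) J → ∣ image f J ∣ ℕ.≤ ∣ J ∣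
∣image∣ {n = n} f []          = ℕ.≤-reflexive (∣⊥∣≡0 n)
∣image∣ f (true  ∷ J) = ℕ.≤-trans (∣p∪q∣≤∣p∣+∣q∣ ⁅ f zero ⁆ (image (f ∘ suc) J))
  (ℕ.+-mono-≤ (ℕ.≤-reflexive (∣⁅x⁆∣≡1 (f zero))) (∣image∣ (f ∘ suc) J))
∣image∣ f (false ∷ J) = ∣image∣ (f ∘ suc) J

-- Feasibility of the relaxations

module Relaxation {n d : ℕ} (σ : Permutation′ (n ℕ.* d)) (default : Fin n) where
  open Multigraph {n} {d} σ
  open Averaging {n} {d} σ default

  -- Each state x moves the vertices of G to those of H by an involution that is an isomorphism away from
  -- the vertices owned by w, where the boundary of x is v₀ + w.
  module Moves {r N : ℕ} (giants : ∀ Z → ∣ Z ∣ ℕ.≤ r → ∃[ w ] Giant Z w)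
    (G H : Graph N) (Φ : State → Fin N → Fin N) (owner : Fin N → Fin n)
    (Φ-involutive : ∀ x u → Φ x (Φ x u) ≡ u)
    (Φ-owner : ∀ x u → owner (Φ x u) ≡ owner u)
    (Φ-local : ∀ x y u → (∀ s → val x (owner u) s ≡ val y (owner u) s) → Φ x u ≡ Φ y u)
    (Φ-preserves : ∀ w x → Ω w x → ∀ u₁ u₂ → owner u₁ ≢ w → owner u₂ ≢ w →
                   adj G u₁ u₂ ≡ adj H (Φ x u₁) (Φ x u₂))
    where
    open Robust {r} giants

    M : ℕ
    M = N ℕ.* N

    -- Specialised to N, which cannot be inferred from N * N.
    X′ : Fin N → Fin N → Polynomial M
    X′ = X {N}
    rowSum′ columnSum′ : Fin N → Polynomial M
    rowSum′    = rowSum {N}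
    columnSum′ = columnSum {N}
    𝒯-f′ : 𝒯-Eq {N} → Polynomial M
    𝒯-f′ = 𝒯-f G H
    𝒬-f′ : 𝒬-Eq G H → Polynomial M
    𝒬-f′ = 𝒬-f G H
    ∏x′ : Subset M → Polynomial M
    ∏x′ = ∏x {M}
    ∏x∏[1-x]′ : Subset M → Subset M → Polynomial M
    ∏x∏[1-x]′ = ∏x∏[1-x] {M}

    point : State → Fin M → Bool
    point x i = δ (Φ x (proj₁ (remQuot {N} N i))) (proj₂ (remQuot {N} N i))

    point-combine : ∀ x u v → point x (combine u v) ≡ δ (Φ x u) v
    point-combine x u v = cong (λ (a , b) → δ (Φ x a) b) (remQuot-combine u v)

    -- Row owners suffice: the labels at the owner of `u` fix `Φ x u`, and with it the whole row `u`
    -- of the point.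
    owners : Subset M → Subset n
    owners = image (owner ∘ proj₁ ∘ remQuot {N} N)

    valueℚ : Subset M → State → ℚ
    valueℚ J x = ind (holds (point x) J)

    solution : Subset M → ℝ
    solution J = fromℚ (avg (owners J) (valueℚ J))

    Determines : Subset n → Fin M → Set
    Determines Z i = ∀ x y → (∀ v → v ∈ Z → ∀ s → val x v s ≡ val y v s) → point x i ≡ point y i

    determines-value : ∀ {Z} J → (∀ i → i ∈ J → Determines Z i) → LocalOn Z (valueℚ J)
    determines-value J det x y agree = cong ind (holds-cong J λ i i∈J → det i i∈J x y agree)

    determines-owner : ∀ {Z} i → owner (proj₁ (remQuot {N} N i)) ∈ Z → Determines Z i
    determines-owner i o∈Z x y agree =
      cong (λ a → δ a (proj₂ (remQuot {N} N i))) (Φ-local x y _ (agree _ o∈Z))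

    determines-row : ∀ {Z} u v → owner u ∈ Z → Determines Z (combine u v)
    determines-row {Z} u v u∈Z = determines-owner (combine u v)
      (subst (λ a → owner (proj₁ a) ∈ Z) (sym (remQuot-combine u v)) u∈Z)

    -- The matrix of an involution is symmetric. This makes a column as local as a row.
    δ-Φ : ∀ x u v → δ (Φ x u) v ≡ δ (Φ x v) u
    δ-Φ x u v = does-⇔ (mk⇔
      (λ { refl → Φ-involutive x u }) (λ { refl → Φ-involutive x v })) (Φ x u ≟ v) (Φ x v ≟ u)

    determines-column : ∀ {Z} u v → owner v ∈ Z → Determines Z (combine u v)
    determines-column u v v∈Z x y agree = begin
      point x (combine u v)   ≡⟨ trans (point-combine x u v) (δ-Φ x u v) ⟩
      δ (Φ x v) u             ≡⟨ cong (λ a → δ a u) (Φ-local x y v (agree (owner v) v∈Z)) ⟩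
      δ (Φ y v) u             ≡⟨ sym (trans (point-combine y u v) (δ-Φ y u v)) ⟩
      point y (combine u v)   ∎
      where open ≡-Reasoning

    -- What `avg-local` asks for in order to replace `owners J` by `Z`: the bound on `J` keeps
    -- `owners J` small, and `Z` must determine all variables of `J` too.
    Tame : ℕ → Subset n → Subset M → Set
    Tame b Z J = ∣ J ∣ ℕ.≤ b × (∀ i → i ∈ J → Determines Z i)

    -- The heart of the feasibility proof. Each monomial has its own centre, but `avg-local` moves
    -- them all to the centre of `Z`; by linearity the linearised polynomial becomes an average of
    -- its values at 0/1 points.
    linearize-avg : ∀ {b Z} m p → b ℕ.+ ∣ Z ∣ ℕ.≤ r → Supports (Tame b Z) p →
                    seq (linearize solution p) m ≡ avg Z (λ x → eval m (point x) p)
    linearize-avg {b} {Z} m []            small []                  = sym (avg-0 Z)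
    linearize-avg {b} {Z} m ((c , e) ∷ p) small ((J≤b , det) ∷ tame) = begin
      seq c m ℚ.* seq (monomial solution J) m ℚ.+ seq (linearize solution p) m
        ≡⟨ cong₂ (λ s t → seq c m ℚ.* s ℚ.+ t) monomial-avg (linearize-avg {b} {Z} m p small tame) ⟩
      seq c m ℚ.* avg Z (valueℚ J) ℚ.+ avg Z (λ x → eval m (point x) p)
        ≡⟨ cong (ℚ._+ avg Z (λ x → eval m (point x) p)) (sym (avg-*ˡ Z (seq c m) (valueℚ J))) ⟩
      avg Z (λ x → seq c m ℚ.* valueℚ J x) ℚ.+ avg Z (λ x → eval m (point x) p)
        ≡⟨ sym (avg-+ Z _ _) ⟩
      avg Z (λ x → eval m (point x) ((c , e) ∷ p))
        ∎
      where
      open ≡-Reasoning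
      J : Subset M
      J = supp e
      monomial-avg : seq (monomial solution J) m ≡ avg Z (valueℚ J)
      monomial-avg = monomial-elim solution (λ y → seq y m ≡ avg Z (valueℚ J)) J
        (λ _ → avg-local
          (ℕ.≤-trans (ℕ.+-monoˡ-≤ ∣ Z ∣ (ℕ.≤-trans (∣image∣ (owner ∘ proj₁ ∘ remQuot {N} N) J) J≤b)) small)
          (determines-value J λ i i∈J → determines-owner i (∈-image (owner ∘ proj₁ ∘ remQuot {N} N) i∈J))
          (determines-value J det))
        -- The empty monomial is 1 by convention, which agrees with the average because that is
        -- normalised.
        (λ empty → sym (trans
          (avg-cong λ x _ → cong ind (holds-empty (point x) J empty))
          (avg-1 {Z} (ℕ.m+n≤o⇒n≤o b small))))

    supports-∏x : ∀ I → Supports (_⊆ I) (∏x′ I)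
    supports-∏x I = supports-∏ₚ I var λ i → supports-var (_⊆ ⁅ i ⁆) i λ x∈ → x∈

    0≤var : ∀ m x i → 0ℚ ℚ.≤ eval m (point x) (var i)
    0≤var m x i = subst (0ℚ ℚ.≤_) (sym (eval-var m (point x) i)) (0≤ind (point x i))

    0≤1-var : ∀ m x i → 0ℚ ℚ.≤ eval m (point x) (constₚ 1ℝ -ₚ var i)
    0≤1-var m x i = subst (0ℚ ℚ.≤_) (sym (trans (eval--ₚ m (point x) (constₚ 1ℝ) (var i))
      (cong₂ ℚ._-_ (eval-constₚ m (point x) 1ℝ) (eval-var m (point x) i)))) (lemma (point x i))
      where
      lemma : ∀ b → 0ℚ ℚ.≤ 1ℚ ℚ.- ind b
      lemma true  = ℚ.≤-refl
      lemma false = 0≤1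

    -- At 0/1 points every factor is 0 or 1. One `k` bounds the variables of a monomial, the other
    -- the common set `owners J`.
    bounds-hold : ∀ {k} → k ℕ.+ k ℕ.≤ r → ∀ I J → I ⊆ J → ∣ J ∣ ℕ.≤ k →
                  0ℝ ≤ℝ linearize solution (∏x∏[1-x]′ I J)
    bounds-hold {k} small I J I⊆J J≤k = 0≤-pointwise (linearize solution (∏x∏[1-x]′ I J)) λ m → subst (0ℚ ℚ.≤_)
      (sym (linearize-avg {k} {owners J} m (∏x∏[1-x]′ I J)
        (ℕ.≤-trans (ℕ.+-monoʳ-≤ k (ℕ.≤-trans (∣image∣ (owner ∘ proj₁ ∘ remQuot {N} N) J) J≤k)) small) (All.map tame supports)))
      (avg-nonneg λ x → subst (0ℚ ℚ.≤_) (sym (eval-*ₚ m (point x) (∏x′ I) (∏ₚ (J ─ I) 1-x)))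
        (0≤*0≤ (eval-∏ₚ-nonneg m (point x) I {var} (0≤var m x))
               (eval-∏ₚ-nonneg m (point x) (J ─ I) {1-x} (0≤1-var m x))))
      where
      1-x : Fin M → Polynomial M
      1-x i = constₚ 1ℝ -ₚ var i
      tame : ∀ {K} → K ⊆ J → Tame k (owners J) K
      tame K⊆J = ℕ.≤-trans (p⊆q⇒∣p∣≤∣q∣ K⊆J) J≤k , λ i i∈K → determines-owner i (∈-image (owner ∘ proj₁ ∘ remQuot {N} N) (K⊆J i∈K))
      supports : Supports (_⊆ J) (∏x∏[1-x]′ I J)
      supports = supports-*ₚ (_⊆ I) (_⊆ J ─ I) (_⊆ J)
        (λ {A} {B} A⊆I B⊆ → ∪-lub {I = A} {J = B} (λ x∈ → I⊆J (A⊆I x∈)) (λ x∈ → p─q⊆p J I (B⊆ x∈)))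
        (∏x′ I) (∏ₚ (J ─ I) 1-x) (supports-∏x I)
        (supports-∏ₚ (J ─ I) 1-x λ i → supports--ₚ (_⊆ ⁅ i ⁆) (constₚ 1ℝ) (var i)
          (supports-constₚ (_⊆ ⁅ i ⁆) 1ℝ ⊥⊆) (supports-var (_⊆ ⁅ i ⁆) i λ x∈ → x∈))

    -- A monomial of the product has at most `(k - 1) + 2` variables, and `owners I ∪ Z` at most
    -- `(k - 1) + 2` vertices. `f` has to vanish only at labellings whose defect `w` lies outside
    -- this set, where the maps respect adjacency.
    equality-holds : ∀ {k} I f Z → k ℕ.+ k ℕ.+ 2 ℕ.≤ r → 1 ℕ.≤ k → ∣ I ∣ ℕ.≤ k ℕ.∸ 1 → ∣ Z ∣ ℕ.≤ 2 →
      Supports (Tame 2 Z) f →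
      (∀ Z′ → Z ⊆ Z′ → centre Z′ ∉ Z′ → ∀ m x → Ω (centre Z′) x → eval m (point x) f ≡ 0ℚ) →
      linearize solution (∏x′ I *ₚ f) ≈ 0ℝ
    equality-holds {suc k} I f Z small _ I≤k Z≤2 tame vanish =
      ≈-pointwise (linearize solution (∏x′ I *ₚ f)) 0ℝ λ m → trans
      (linearize-avg {k ℕ.+ 2} {Z′} m (∏x′ I *ₚ f) small′ supports)
      (trans (avg-cong λ x ω → trans (eval-*ₚ m (point x) (∏x′ I) f)
               (trans (cong (eval m (point x) (∏x′ I) ℚ.*_)
                        (vanish Z′ (q⊆p∪q (owners I) Z) (centre∉ (ℕ.m+n≤o⇒n≤o (k ℕ.+ 2) small′)) m x ω))
                      (ℚ.*-zeroʳ (eval m (point x) (∏x′ I)))))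
             (avg-0 Z′))
      where
      Z′ : Subset n
      Z′ = owners I ∪ Z
      Z′≤ : ∣ Z′ ∣ ℕ.≤ k ℕ.+ 2
      Z′≤ = ℕ.≤-trans (∣p∪q∣≤∣p∣+∣q∣ (owners I) Z) (ℕ.+-mono-≤ (ℕ.≤-trans (∣image∣ (owner ∘ proj₁ ∘ remQuot {N} N) I) I≤k) Z≤2)
      small′ : k ℕ.+ 2 ℕ.+ ∣ Z′ ∣ ℕ.≤ r
      small′ = ℕ.≤-trans (ℕ.+-monoʳ-≤ (k ℕ.+ 2) Z′≤) (ℕ.≤-trans (ℕ.≤-reflexive (regroup k)) small)
        where
        regroup : ∀ k → k ℕ.+ 2 ℕ.+ (k ℕ.+ 2) ≡ suc k ℕ.+ suc k ℕ.+ 2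
        regroup = solve-∀
      supports : Supports (Tame (k ℕ.+ 2) Z′) (∏x′ I *ₚ f)
      supports = supports-*ₚ (_⊆ I) (Tame 2 Z) (Tame (k ℕ.+ 2) Z′) combined (∏x′ I) f (supports-∏x I) tame
        where
        combined : ∀ {A B} → A ⊆ I → Tame 2 Z B → Tame (k ℕ.+ 2) Z′ (A ∪ B)
        combined {A} {B} A⊆I (B≤2 , det) =
          ℕ.≤-trans (∣p∪q∣≤∣p∣+∣q∣ A B) (ℕ.+-mono-≤ (ℕ.≤-trans (p⊆q⇒∣p∣≤∣q∣ A⊆I) I≤k) B≤2) ,
          λ i i∈ → [ (λ i∈A → determines-owner i (p⊆p∪q Z (∈-image (owner ∘ proj₁ ∘ remQuot {N} N) (A⊆I i∈A))))
                   , (λ i∈B x y agree → det i i∈B x y λ v v∈Z → agree v (q⊆p∪q (owners I) Z v∈Z))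
                   ]′ (x∈p∪q⁻ A B i∈)

    -- Locality and validity of the individual equations

    tame-⊥ : ∀ {b Z} → Tame b Z ⊥
    tame-⊥ = subst (ℕ._≤ _) (sym (∣⊥∣≡0 M)) z≤n , λ i i∈⊥ → contradiction i∈⊥ ∉⊥

    tame-⁅⁆ : ∀ {b Z i} → 1 ℕ.≤ b → Determines Z i → Tame b Z ⁅ i ⁆
    tame-⁅⁆ {b} {Z} {i} 1≤b det = subst (ℕ._≤ b) (sym (∣⁅x⁆∣≡1 i)) 1≤b ,
      λ j j∈ → subst (Determines Z) (sym (x∈⁅y⁆⇒x≡y i j∈)) det

    tame-X : ∀ {Z u v} → Determines Z (combine u v) → Supports (Tame 2 Z) (X′ u v)
    tame-X {Z} {u} {v} det = supports-var (Tame 2 Z) (combine u v) (tame-⁅⁆ (s≤s z≤n) det)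

    eval-X : ∀ m x u v → eval m (point x) (X′ u v) ≡ ind (δ (Φ x u) v)
    eval-X m x u v = trans (eval-var m (point x) (combine u v)) (cong ind (point-combine x u v))

    ∑-δ : ∀ a → Σℚ.∑ (λ v → ind (δ {N} a v)) ≡ 1ℚ
    ∑-δ a = trans (Σℚ.∑-cong λ v → sym (ℚ.*-identityʳ (ind (δ a v)))) (∑-select a (λ _ → 1ℚ))

    minus-one : ∀ m x {p : Polynomial M} → eval m (point x) p ≡ 1ℚ → eval m (point x) (p -ₚ constₚ 1ℝ) ≡ 0ℚ
    minus-one m x {p} e = trans (eval--ₚ m (point x) p (constₚ 1ℝ)) (cong₂ ℚ._-_ e (eval-constₚ m (point x) 1ℝ))

    row-holds : ∀ m x u → eval m (point x) (rowSum′ u) ≡ 0ℚ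
    row-holds m x u = minus-one m x {∑ₚ (λ v → X′ u v)} (trans (eval-∑ₚ m (point x) (λ v → X′ u v))
      (trans (Σℚ.∑-cong (eval-X m x u)) (∑-δ (Φ x u))))

    column-holds : ∀ m x v → eval m (point x) (columnSum′ v) ≡ 0ℚ
    column-holds m x v = minus-one m x {∑ₚ (λ u → X′ u v)} (trans (eval-∑ₚ m (point x) (λ u → X′ u v))
      (trans (Σℚ.∑-cong λ u → trans (eval-X m x u v) (cong ind (δ-Φ x u v))) (∑-δ (Φ x v))))

    tame-row : ∀ u → Supports (Tame 2 ⁅ owner u ⁆) (rowSum′ u)
    tame-row u = supports--ₚ (Tame 2 Z) (∑ₚ (λ v → X′ u v)) (constₚ 1ℝ)
      (supports-∑ₚ (Tame 2 Z) (λ v → X′ u v) λ v → tame-X {u = u} {v} (determines-row u v (x∈⁅x⁆ (owner u))))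
      (supports-constₚ (Tame 2 Z) 1ℝ tame-⊥)
      where Z = ⁅ owner u ⁆

    tame-column : ∀ v → Supports (Tame 2 ⁅ owner v ⁆) (columnSum′ v)
    tame-column v = supports--ₚ (Tame 2 Z) (∑ₚ (λ u → X′ u v)) (constₚ 1ℝ)
      (supports-∑ₚ (Tame 2 Z) (λ u → X′ u v) λ u → tame-X {u = u} {v} (determines-column u v (x∈⁅x⁆ (owner v))))
      (supports-constₚ (Tame 2 Z) 1ℝ tame-⊥)
      where Z = ⁅ owner v ⁆

    pair : Fin N → Fin N → Subset n
    pair u v = ⁅ owner u ⁆ ∪ ⁅ owner v ⁆

    first∈pair : ∀ u v → owner u ∈ pair u v
    first∈pair u v = p⊆p∪q ⁅ owner v ⁆ (x∈⁅x⁆ (owner u))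

    second∈pair : ∀ u v → owner v ∈ pair u v
    second∈pair u v = q⊆p∪q ⁅ owner u ⁆ ⁅ owner v ⁆ (x∈⁅x⁆ (owner v))

    ∣pair∣ : ∀ u v → ∣ pair u v ∣ ℕ.≤ 2
    ∣pair∣ u v = ℕ.≤-trans (∣p∪q∣≤∣p∣+∣q∣ ⁅ owner u ⁆ ⁅ owner v ⁆)
      (ℕ.≤-reflexive (cong₂ ℕ._+_ (∣⁅x⁆∣≡1 (owner u)) (∣⁅x⁆∣≡1 (owner v))))

    ∣singleton∣ : ∀ (v : Fin n) → ∣ ⁅ v ⁆ ∣ ℕ.≤ 2
    ∣singleton∣ v = ℕ.≤-trans (ℕ.≤-reflexive (∣⁅x⁆∣≡1 v)) (s≤s z≤n)

    entry-poly₁ entry-poly₂ : Fin N → Fin N → Vector (Polynomial M) N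
    entry-poly₁ u v w = constₚ (A G u w) *ₚ X′ w v
    entry-poly₂ u v w = X′ u w *ₚ constₚ (A H w v)

    -- The first sum runs down column `v` and the second along row `u`, so two owners determine all
    -- the variables.
    tame-entry : ∀ u v → Supports (Tame 2 (pair u v)) (𝒯-f′ (entry u v))
    tame-entry u v = supports--ₚ (Tame 2 Z) (∑ₚ (entry-poly₁ u v)) (∑ₚ (entry-poly₂ u v))
      (supports-∑ₚ (Tame 2 Z) (entry-poly₁ u v) λ w → supports-scale (Tame 2 Z) (A G u w) (X′ w v)
        (tame-X {u = w} {v} (determines-column w v (second∈pair u v))))
      (supports-∑ₚ (Tame 2 Z) (entry-poly₂ u v) λ w →
        supports-*ₚ (Tame 2 Z) (_≡ ⊥) (Tame 2 Z) (λ { {I} PI refl → subst (Tame 2 Z) (sym (∪-identityʳ I)) PI })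
          (X′ u w) (constₚ (A H w v)) (tame-X {u = u} {w} (determines-row u w (first∈pair u v)))
          (supports-constₚ (_≡ ⊥) (A H w v) refl))
      where
      Z = pair u v

    seq-A : ∀ K m (u v : Fin N) → seq (A K u v) m ≡ ind (adj K u v)
    seq-A K m u v with adj K u v
    ... | true  = refl
    ... | false = refl

    preserved : ∀ {Z x} → centre Z ∉ Z → Ω (centre Z) x → ∀ u₁ u₂ → owner u₁ ∈ Z → owner u₂ ∈ Z →
                adj G u₁ u₂ ≡ adj H (Φ x u₁) (Φ x u₂)
    preserved {Z} c∉Z ω u₁ u₂ u₁∈Z u₂∈Z = Φ-preserves _ _ ω u₁ u₂
      (λ e → c∉Z (subst (_∈ Z) e u₁∈Z)) (λ e → c∉Z (subst (_∈ Z) e u₂∈Z))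

    -- Each sum collapses to one term, `adj G u (Φ x v)` and `adj H (Φ x u) v`. Applying `Φ x` to
    -- both arguments of the first gives the second.
    entry-holds : ∀ u v Z → pair u v ⊆ Z → centre Z ∉ Z → ∀ m x → Ω (centre Z) x →
                  eval m (point x) (𝒯-f′ (entry u v)) ≡ 0ℚ
    entry-holds u v Z pair⊆Z c∉Z m x ω = begin
      eval m s (∑ₚ (entry-poly₁ u v) -ₚ ∑ₚ (entry-poly₂ u v))
        ≡⟨ eval--ₚ m s (∑ₚ (entry-poly₁ u v)) (∑ₚ (entry-poly₂ u v)) ⟩
      eval m s (∑ₚ (entry-poly₁ u v)) ℚ.- eval m s (∑ₚ (entry-poly₂ u v))
        ≡⟨ cong₂ ℚ._-_ left right ⟩
      ind (adj G u (Φ x v)) ℚ.- ind (adj H (Φ x u) v)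
        ≡⟨ cong (λ b → ind b ℚ.- ind (adj H (Φ x u) v)) (trans
             (preserved c∉Z ω u (Φ x v) (pair⊆Z (first∈pair u v))
               (subst (_∈ Z) (sym (Φ-owner x v)) (pair⊆Z (second∈pair u v))))
             (cong (adj H (Φ x u)) (Φ-involutive x v))) ⟩
      ind (adj H (Φ x u) v) ℚ.- ind (adj H (Φ x u) v)
        ≡⟨ ℚ.+-inverseʳ (ind (adj H (Φ x u) v)) ⟩
      0ℚ ∎
      where
      open ≡-Reasoning
      s = point x
      left : eval m s (∑ₚ (entry-poly₁ u v)) ≡ ind (adj G u (Φ x v))
      left = trans (eval-∑ₚ m s (entry-poly₁ u v)) (trans (Σℚ.∑-cong λ w → trans
        (eval-*ₚ m s (constₚ (A G u w)) (X′ w v))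
        (trans (cong₂ ℚ._*_ (trans (eval-constₚ m s (A G u w)) (seq-A G m u w))
                            (trans (eval-X m x w v) (cong ind (δ-Φ x w v))))
               (ℚ.*-comm (ind (adj G u w)) (ind (δ (Φ x v) w)))))
        (∑-select (Φ x v) (λ w → ind (adj G u w))))
      right : eval m s (∑ₚ (entry-poly₂ u v)) ≡ ind (adj H (Φ x u) v)
      right = trans (eval-∑ₚ m s (entry-poly₂ u v)) (trans (Σℚ.∑-cong λ w → trans
        (eval-*ₚ m s (X′ u w) (constₚ (A H w v)))
        (cong₂ ℚ._*_ (eval-X m x u w) (trans (eval-constₚ m s (A H w v)) (seq-A H m w v))))
        (∑-select (Φ x u) (λ w → ind (adj H w v))))

    tame-quadratic : ∀ u₁ u₂ v₁ v₂ → Supports (Tame 2 (pair u₁ u₂)) (X′ u₁ v₁ *ₚ X′ u₂ v₂)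
    tame-quadratic u₁ u₂ v₁ v₂ = supports-*ₚ (Tame 1 Z) (Tame 1 Z) (Tame 2 Z) combined (X′ u₁ v₁) (X′ u₂ v₂)
      (supports-var (Tame 1 Z) (combine u₁ v₁) (tame-⁅⁆ ℕ.≤-refl (determines-row u₁ v₁ (first∈pair u₁ u₂))))
      (supports-var (Tame 1 Z) (combine u₂ v₂) (tame-⁅⁆ ℕ.≤-refl (determines-row u₂ v₂ (second∈pair u₁ u₂))))
      where
      Z = pair u₁ u₂
      combined : ∀ {I J} → Tame 1 Z I → Tame 1 Z J → Tame 2 Z (I ∪ J)
      combined {I} {J} (I≤1 , detI) (J≤1 , detJ) =
        ℕ.≤-trans (∣p∪q∣≤∣p∣+∣q∣ I J) (ℕ.+-mono-≤ I≤1 J≤1) ,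
        λ i i∈ → [ detI i , detJ i ]′ (x∈p∪q⁻ I J i∈)

    -- If both factors were 1, `Φ x` would send `u₁`, `u₂` to `v₁`, `v₂` and so preserve adjacency
    -- between them.
    quadratic-holds : ∀ u₁ u₂ v₁ v₂ {b c} → b ≢ c → adj G u₁ u₂ ≡ b → adj H v₁ v₂ ≡ c →
      ∀ Z → pair u₁ u₂ ⊆ Z → centre Z ∉ Z → ∀ m x → Ω (centre Z) x →
      eval m (point x) (X′ u₁ v₁ *ₚ X′ u₂ v₂) ≡ 0ℚ
    quadratic-holds u₁ u₂ v₁ v₂ b≢c eG eH Z pair⊆Z c∉Z m x ω = trans (eval-*ₚ m (point x) (X′ u₁ v₁) (X′ u₂ v₂))
      (trans (cong₂ ℚ._*_ (eval-X m x u₁ v₁) (eval-X m x u₂ v₂)) product)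
      where
      product : ind (δ (Φ x u₁) v₁) ℚ.* ind (δ (Φ x u₂) v₂) ≡ 0ℚ
      product with Φ x u₁ ≟ v₁ | Φ x u₂ ≟ v₂
      ... | no  _    | b       = ℚ.*-zeroˡ (ind (does b))
      ... | yes _    | no  _   = refl
      ... | yes e₁   | yes e₂  = contradiction (trans (sym eG) (trans
        (preserved c∉Z ω u₁ u₂ (pair⊆Z (first∈pair u₁ u₂)) (pair⊆Z (second∈pair u₁ u₂)))
        (trans (cong₂ (adj H) e₁ e₂) eH))) b≢c

    module _ {k : ℕ} (1≤k : 1 ℕ.≤ k) (small : k ℕ.+ k ℕ.+ 2 ℕ.≤ r) where

      lifted-𝒯 : Lifted (𝒯 G H) k solution
      lifted-𝒯 = record
        { equalities   = λ I j I≤ → equation I I≤ j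
        ; inequalities = λ _ _ ()
        ; bounds       = bounds-hold (ℕ.m+n≤o⇒m≤o (k ℕ.+ k) small)
        }
        where
        equation : ∀ I → ∣ I ∣ ℕ.≤ k ℕ.∸ 1 → ∀ j → linearize solution (∏x′ I *ₚ 𝒯-f′ j) ≈ 0ℝ
        equation I I≤ (row u)     = equality-holds I (rowSum′ u) ⁅ owner u ⁆ small 1≤k I≤ (∣singleton∣ (owner u))
                                      (tame-row u) λ _ _ _ m x _ → row-holds m x u
        equation I I≤ (column v)  = equality-holds I (columnSum′ v) ⁅ owner v ⁆ small 1≤k I≤ (∣singleton∣ (owner v))
                                      (tame-column v) λ _ _ _ m x _ → column-holds m x v
        equation I I≤ (entry u v) = equality-holds I (𝒯-f′ (entry u v)) (pair u v) small 1≤k I≤ (∣pair∣ u v)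
                                      (tame-entry u v) (entry-holds u v)

      lifted-𝒬 : Lifted (𝒬 G H) k solution
      lifted-𝒬 = record
        { equalities   = λ I j I≤ → equation I I≤ j
        ; inequalities = λ _ _ ()
        ; bounds       = bounds-hold (ℕ.m+n≤o⇒m≤o (k ℕ.+ k) small)
        }
        where
        equation : ∀ I → ∣ I ∣ ℕ.≤ k ℕ.∸ 1 → ∀ j → linearize solution (∏x′ I *ₚ 𝒬-f′ j) ≈ 0ℝ
        equation I I≤ (row u)     = equality-holds I (rowSum′ u) ⁅ owner u ⁆ small 1≤k I≤ (∣singleton∣ (owner u))
                                      (tame-row u) λ _ _ _ m x _ → row-holds m x u
        equation I I≤ (column v)  = equality-holds I (columnSum′ v) ⁅ owner v ⁆ small 1≤k I≤ (∣singleton∣ (owner v))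
                                      (tame-column v) λ _ _ _ m x _ → column-holds m x v
        equation I I≤ (edge-nonedge u₁ u₂ v₁ v₂ eG eH) =
          equality-holds I (X′ u₁ v₁ *ₚ X′ u₂ v₂) (pair u₁ u₂) small 1≤k I≤ (∣pair∣ u₁ u₂)
            (tame-quadratic u₁ u₂ v₁ v₂) (quadratic-holds u₁ u₂ v₁ v₂ (λ ()) eG eH)
        equation I I≤ (nonedge-edge u₁ u₂ v₁ v₂ eG eH) =
          equality-holds I (X′ u₁ v₁ *ₚ X′ u₂ v₂) (pair u₁ u₂) small 1≤k I≤ (∣pair∣ u₁ u₂)
            (tame-quadratic u₁ u₂ v₁ v₂) (quadratic-holds u₁ u₂ v₁ v₂ (λ ()) eG eH)

      𝒯-feasible : ∃[ x ] SheraliAdams (𝒯 G H) k x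
      𝒯-feasible = (λ i → solution ⁅ i ⁆) , solution , lifted-𝒯 , λ i → ≈-pointwise (solution ⁅ i ⁆) (solution ⁅ i ⁆) λ _ → refl

      𝒬-feasible : ∃[ x ] SheraliAdams (𝒬 G H) k x
      𝒬-feasible = (λ i → solution ⁅ i ⁆) , solution , lifted-𝒬 , λ i → ≈-pointwise (solution ⁅ i ⁆) (solution ⁅ i ⁆) λ _ → refl

-- A rigid encoding of vertex colours

does-true : ∀ {P : Set} (P? : Dec P) → does P? ≡ true → P
does-true (yes p) _ = p

-- The leaves make the path recognisable, and its start is recognisable because zero is not the
-- colour of any vertex of Main: hence isomorphisms fix the path, and so preserve colours.
module Coloured {Main : Set} {K : ℕ} (link : Main → Main → Bool) where

  data Vertex : Set where
    main : Main → Vertex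
    path : Fin (suc K) → Vertex
    leaf : Fin (suc K) → Vertex

  path-injective : ∀ {i j} → path i ≡ path j → i ≡ j
  path-injective refl = refl

  successive : Fin (suc K) → Fin (suc K) → Bool
  successive i j = does (toℕ j ℕ.≟ suc (toℕ i)) ∨ does (toℕ i ℕ.≟ suc (toℕ j))

  adjacent : (Main → Fin K) → Vertex → Vertex → Bool
  adjacent κ (main a) (main c) = link a c
  adjacent κ (main a) (path i) = does (i ≟ suc (κ a))
  adjacent κ (main a) (leaf i) = false
  adjacent κ (path i) (main a) = does (i ≟ suc (κ a))
  adjacent κ (path i) (path j) = successive i j
  adjacent κ (path i) (leaf j) = does (i ≟ j)
  adjacent κ (leaf i) (main a) = false
  adjacent κ (leaf i) (path j) = does (j ≟ i)
  adjacent κ (leaf i) (leaf j) = false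

  adjacent-symm : (∀ a c → link a c ≡ link c a) → ∀ κ u v → adjacent κ u v ≡ adjacent κ v u
  adjacent-symm link-symm κ (main a) (main c) = link-symm a c
  adjacent-symm link-symm κ (main a) (path i) = refl
  adjacent-symm link-symm κ (main a) (leaf i) = refl
  adjacent-symm link-symm κ (path i) (main a) = refl
  adjacent-symm link-symm κ (path i) (path j) = Bool.∨-comm (does (toℕ j ℕ.≟ suc (toℕ i))) _
  adjacent-symm link-symm κ (path i) (leaf j) = refl
  adjacent-symm link-symm κ (leaf i) (main a) = refl
  adjacent-symm link-symm κ (leaf i) (path j) = refl
  adjacent-symm link-symm κ (leaf i) (leaf j) = refl

  adjacent-irrefl : (∀ a → link a a ≡ false) → ∀ κ u → adjacent κ u u ≡ false
  adjacent-irrefl link-irrefl κ (main a) = link-irrefl a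
  adjacent-irrefl link-irrefl κ (path i)
    rewrite dec-false (toℕ i ℕ.≟ suc (toℕ i)) (λ e → ℕ.1+n≢n (sym e)) = refl
  adjacent-irrefl link-irrefl κ (leaf i) = refl

  record Isomorphism (κ κ′ : Main → Fin K) : Set where
    field
      f g       : Vertex → Vertex
      g∘f       : ∀ u → g (f u) ≡ u
      f∘g       : ∀ u → f (g u) ≡ u
      preserves : ∀ u v → adjacent κ u v ≡ adjacent κ′ (f u) (f v)

  inverse : ∀ {κ κ′} → Isomorphism κ κ′ → Isomorphism κ′ κ
  inverse {κ} {κ′} φ = record
    { f = g ; g = f ; g∘f = f∘g ; f∘g = g∘f
    ; preserves = λ u v → sym (trans (preserves (g u) (g v)) (cong₂ (adjacent κ′) (f∘g u) (f∘g v)))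
    }
    where open Isomorphism φ

  module _ (c₀ : Fin K) (linked : ∀ a → ∃[ c ] link a c ≡ true) where

    AtMostOne : (Main → Fin K) → Vertex → Set
    AtMostOne κ u = ∀ v w → adjacent κ u v ≡ true → adjacent κ u w ≡ true → v ≡ w

    leaf-one : ∀ κ i → AtMostOne κ (leaf i)
    leaf-one κ i (path j) (path k) ej ek = cong path (trans (does-true (j ≟ i) ej) (sym (does-true (k ≟ i) ek)))

    Onto : (Main → Fin K) → Set
    Onto κ = ∀ c → ∃[ a ] κ a ≡ c

    second : ∀ {K} → Fin K → Σ[ j ∈ Fin (suc K) ] toℕ j ≡ 1
    second {suc K} _ = suc zero , refl

    -- All other vertices have two neighbours: a main vertex has a linked one and its path vertex,
    -- `path zero` its leaf and the next path vertex, and a later path vertex its leaf and, as every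
    -- colour occurs, a main vertex.
    one-leaf : ∀ {κ} → Onto κ → ∀ u → AtMostOne κ u → ∃[ i ] u ≡ leaf i
    one-leaf {κ} onto (leaf i) one = i , refl
    one-leaf {κ} onto (main a) one with linked a
    ... | c , a~c with () ← one (main c) (path (suc (κ a))) a~c (dec-true (suc (κ a) ≟ suc (κ a)) refl)
    one-leaf {κ} onto (path zero) one with second c₀
    ... | j , e with () ← one (leaf zero) (path j) refl
                            (cong (_∨ does (0 ℕ.≟ suc (toℕ j))) (dec-true (toℕ j ℕ.≟ 1) e))
    one-leaf {κ} onto (path (suc i)) one with onto i
    ... | a , refl with () ← one (leaf (suc (κ a))) (main a) (dec-true (suc (κ a) ≟ suc (κ a)) refl)
                               (dec-true (suc (κ a) ≟ suc (κ a)) refl)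

    leaf-neighbour : ∀ κ u i → adjacent κ u (leaf i) ≡ true → u ≡ path i
    leaf-neighbour κ (path j) i e = cong path (does-true (j ≟ i) e)

    -- Kept separate in order to be applied to the inverse isomorphism as well.
    module Half {κ κ′} (onto′ : Onto κ′) (φ : Isomorphism κ κ′) where
      open Isomorphism φ

      f-injective : ∀ {u v} → f u ≡ f v → u ≡ v
      f-injective {u} {v} e = trans (sym (g∘f u)) (trans (cong g e) (g∘f v))

      preserves-true : ∀ {u v} → adjacent κ u v ≡ true → adjacent κ′ (f u) (f v) ≡ true
      preserves-true {u} {v} e = trans (sym (preserves u v)) e

      f-leaf : ∀ i → ∃[ j ] f (leaf i) ≡ leaf j
      f-leaf i = one-leaf onto′ (f (leaf i)) λ v w ev ew →
        g-injective (leaf-one κ i (g v) (g w) (pull v ev) (pull w ew))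
        where
        pull : ∀ v → adjacent κ′ (f (leaf i)) v ≡ true → adjacent κ (leaf i) (g v) ≡ true
        pull v e = trans (preserves (leaf i) (g v)) (trans (cong (adjacent κ′ (f (leaf i))) (f∘g v)) e)
        g-injective : ∀ {u v} → g u ≡ g v → u ≡ v
        g-injective {u} {v} e = trans (sym (f∘g u)) (trans (cong f e) (f∘g v))

      f-path : ∀ i → ∃[ j ] f (path i) ≡ path j
      f-path i with f-leaf i
      ... | j , e = j , leaf-neighbour κ′ (f (path i)) j
        (subst (λ u → adjacent κ′ (f (path i)) u ≡ true) e (preserves-true (dec-true (i ≟ i) refl)))

    module _ {κ κ′} (onto : Onto κ) (onto′ : Onto κ′) (φ : Isomorphism κ κ′) where
      open Isomorphism φ
      open Half onto′ φ
      private module Half⁻¹ = Half onto (inverse φ)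

      -- Any other path vertex has a main neighbour, whose preimage would be a main neighbour of
      -- `path zero`.
      f-start : f (path zero) ≡ path zero
      f-start with f-path zero
      ... | zero  , e = e
      ... | suc j , e with onto′ j
      ...   | a , refl with g (main a) in ga
                 | Half⁻¹.preserves-true {path (suc j)} {main a} (dec-true (suc (κ′ a) ≟ suc (κ′ a)) refl)
      ...     | path i | _ with () ← trans (sym (proj₂ (f-path i))) (trans (cong f (sym ga)) (f∘g (main a)))
      ...     | leaf i | _ with () ← trans (sym (proj₂ (f-leaf i))) (trans (cong f (sym ga)) (f∘g (main a)))
      ...     | main c | edge rewrite sym e | g∘f (path zero) with () ← edge

      -- The image of the next vertex is a path neighbour of a fixed vertex, and the neighbour on
      -- the near side is already taken. The bound `k` lets the induction reach two vertices back.
      f-fixes-path : ∀ i → f (path i) ≡ path i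
      f-fixes-path i = go (toℕ i) i ℕ.≤-refl
        where
        go : ∀ k i → toℕ i ℕ.≤ k → f (path i) ≡ path i
        go k       zero    _         = f-start
        go (suc k) (suc i) (s≤s i≤k) with f-path (suc i)
        ... | j , e = trans e (cong path (cases (toℕ j ℕ.≟ suc (toℕ (inject₁ i))) (toℕ (inject₁ i) ℕ.≟ suc (toℕ j)) next))
          where
          next : successive (inject₁ i) j ≡ true
          next = trans (sym (cong₂ (adjacent κ′) (go k (inject₁ i) (subst (ℕ._≤ k) (sym (toℕ-inject₁ i)) i≤k)) e))
            (preserves-true {path (inject₁ i)} {path (suc i)}
              (cong (_∨ does (toℕ (inject₁ i) ℕ.≟ suc (suc (toℕ i))))
                (dec-true (suc (toℕ i) ℕ.≟ suc (toℕ (inject₁ i))) (cong suc (sym (toℕ-inject₁ i))))))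
          cases : (p : Dec (toℕ j ≡ suc (toℕ (inject₁ i)))) (q : Dec (toℕ (inject₁ i) ≡ suc (toℕ j))) →
                  does p ∨ does q ≡ true → j ≡ suc i
          cases (yes p) _       _ = toℕ-injective (trans p (cong suc (toℕ-inject₁ i)))
          cases (no _)  (yes q) _ = path-injective (f-injective (trans (go k j j≤k) (sym e)))
            where
            j≤k : toℕ j ℕ.≤ k
            j≤k = ℕ.≤-trans (ℕ.n≤1+n (toℕ j)) (subst (ℕ._≤ k) (trans (sym (toℕ-inject₁ i)) q) i≤k)

      f-main : ∀ a → ∃[ c ] f (main a) ≡ main c × κ′ c ≡ κ a
      f-main a with f (main a) in fa
      ... | path i with () ← f-injective (trans fa (sym (f-fixes-path i)))
      ... | leaf i with () ← trans (sym (g∘f (main a))) (trans (cong g fa) (proj₂ (Half⁻¹.f-leaf i)))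
      ... | main c = c , refl , sym (suc-injective (does-true (suc (κ a) ≟ suc (κ′ c))
        (trans (sym (cong₂ (adjacent κ′) fa (f-fixes-path (suc (κ a)))))
               (preserves-true {main a} {path (suc (κ a))} (dec-true (suc (κ a) ≟ suc (κ a)) refl)))))

-- The gadgets

xor-cancelˡ : ∀ a b → a xor (a xor b) ≡ b
xor-cancelˡ a b = trans (sym (Bool.xor-assoc a a b)) (cong (_xor b) (Bool.xor-same a))

zipWith-xor-cancelˡ : ∀ {n} (u v : Vec Bool n) → zipWith _xor_ u (zipWith _xor_ u v) ≡ v
zipWith-xor-cancelˡ []      []      = refl
zipWith-xor-cancelˡ (a ∷ u) (b ∷ v) = cong₂ _∷_ (xor-cancelˡ a b) (zipWith-xor-cancelˡ u v)

xor-cancel-≡ : ∀ a {b c} → a xor b ≡ a xor c → b ≡ c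
xor-cancel-≡ a {b} {c} e = trans (sym (xor-cancelˡ a b)) (trans (cong (a xor_) e) (xor-cancelˡ a c))

xor-≡-false : ∀ {a b} → a xor b ≡ false → a ≡ b
xor-≡-false {true}  {true}  e = refl
xor-≡-false {false} {false} e = refl

does-false : ∀ {P : Set} (P? : Dec P) → does P? ≡ false → ¬ P
does-false (no ¬p) _ = ¬p

Vec-Bool↔Fin : ∀ n → Vec Bool n ↔ Fin (2 ℕ.^ n)
Vec-Bool↔Fin zero    = mk↔ₛ′ (λ _ → zero) (λ _ → []) (λ { zero → refl }) (λ { [] → refl })
Vec-Bool↔Fin (suc n) = ↔-sym *↔× ↔-∘ ((↔-sym 2↔Bool ×-↔ Vec-Bool↔Fin n) ↔-∘ uncons)
  where
  uncons : Vec Bool (suc n) ↔ (Bool × Vec Bool n)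
  uncons = mk↔ₛ′ (λ { (b ∷ v) → b , v }) (λ { (b , v) → b ∷ v }) (λ _ → refl) (λ { (b ∷ v) → refl })

bit₂ : Bool → Fin 2
bit₂ = Inverse.from 2↔Bool

bit₂-injective : ∀ {a b} → bit₂ a ≡ bit₂ b → a ≡ b
bit₂-injective {a} {b} e = trans (sym (Inverse.inverseˡ 2↔Bool refl)) (trans (cong (Inverse.to 2↔Bool) e) (Inverse.inverseˡ 2↔Bool refl))

-- One colour per edge, shared by its two literals, and two per base vertex, for the parities of its
-- cells. The size adds up literals, cells, path and leaves.
gadget-colours gadget-size : ℕ → ℕ → ℕ
gadget-colours n d = n ℕ.* d ℕ.+ n ℕ.* 2
gadget-size n d = ((n ℕ.* d) ℕ.* 2 ℕ.+ n ℕ.* 2 ℕ.^ (d ℕ.+ d)) ℕ.+ (suc (gadget-colours n d) ℕ.+ suc (gadget-colours n d))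

-- The Cai-Fürer-Immerman gadgets: lit p ε is the literal "edge p has value ε", and cell v α is
-- an assignment of values to the edge slots at v, joined to the literals it makes true.
module CFI {n d : ℕ} (σ : Permutation′ (n ℕ.* d)) where
  open Multigraph {n} {d} σ

  data Main : Set where
    lit  : Fin (n ℕ.* d) → Bool → Main
    cell : Fin n → Subset (d ℕ.+ d) → Main

  colours : ℕ
  colours = gadget-colours n d

  Satisfies : Fin n → Subset (d ℕ.+ d) → Fin (n ℕ.* d) → Bool → Fin (d ℕ.+ d) → Set
  Satisfies v α p ε s = edge v s ≡ p × lookup α s ≡ ε

  satisfies? : ∀ v α p ε s → Dec (Satisfies v α p ε s)
  satisfies? v α p ε s = (edge v s ≟ p) ×-dec (lookup α s Bool.≟ ε)

  meets : Fin n → Subset (d ℕ.+ d) → Fin (n ℕ.* d) → Bool → Bool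
  meets v α p ε = does (any? (satisfies? v α p ε))

  link : Main → Main → Bool
  link (lit p ε)  (lit q η)  = false
  link (lit p ε)  (cell v α) = meets v α p ε
  link (cell v α) (lit p ε)  = meets v α p ε
  link (cell v α) (cell w β) = false

  link-symm : ∀ a c → link a c ≡ link c a
  link-symm (lit p ε)  (lit q η)  = refl
  link-symm (lit p ε)  (cell v α) = refl
  link-symm (cell v α) (lit p ε)  = refl
  link-symm (cell v α) (cell w β) = refl

  link-irrefl : ∀ a → link a a ≡ false
  link-irrefl (lit p ε)  = refl
  link-irrefl (cell v α) = refl

  parity : Subset (d ℕ.+ d) → Bool
  parity α = ⨁ (lookup α)

  -- This is the only place where the twist b enters.
  colour : (Fin n → Bool) → Main → Fin colours
  colour b (lit p ε)  = p ↑ˡ (n ℕ.* 2)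
  colour b (cell v α) = (n ℕ.* d) ↑ʳ combine v (bit₂ (parity α xor b v))

  open Coloured {Main} {colours} link

  vals : State → Fin n → Subset (d ℕ.+ d)
  vals x v = tabulate (val x v)

  move-main : State → Main → Main
  move-main x (lit p ε)  = lit p (lookup x p xor ε)
  move-main x (cell v α) = cell v (zipWith _xor_ (vals x v) α)

  move : State → Vertex → Vertex
  move x (main a) = main (move-main x a)
  move x (path i) = path i
  move x (leaf i) = leaf i

  move-involutive : ∀ x u → move x (move x u) ≡ u
  move-involutive x (main (lit p ε))  = cong (main ∘ lit p) (xor-cancelˡ (lookup x p) ε)
  move-involutive x (main (cell v α)) = cong (main ∘ cell v) (zipWith-xor-cancelˡ (vals x v) α)
  move-involutive x (path i)          = refl
  move-involutive x (leaf i)          = refl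

  lookup-moved : ∀ x v α s → lookup (zipWith _xor_ (vals x v) α) s ≡ val x v s xor lookup α s
  lookup-moved x v α s = trans (lookup-zipWith _xor_ s (vals x v) α) (cong (_xor lookup α s) (lookup∘tabulate (val x v) s))

  parity-moved : ∀ x v α → parity (zipWith _xor_ (vals x v) α) ≡ ∂ x v xor parity α
  parity-moved x v α = trans (⊕.∑-cong (lookup-moved x v α)) (⊕.∑-∙ (val x v) (lookup α))

  -- The cell entry and the literal are shifted by the same bit, the value of `x` on the edge.
  meets-moved : ∀ x v α p ε → meets v α p ε ≡ meets v (zipWith _xor_ (vals x v) α) p (lookup x p xor ε)
  meets-moved x v α p ε = does-⇔ (mk⇔
    (λ { (s , refl , e) → s , refl , trans (lookup-moved x v α s) (cong (val x v s xor_) e) })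
    (λ { (s , refl , e) → s , refl , xor-cancel-≡ (val x v s) (trans (sym (lookup-moved x v α s)) e) }))
    (any? (satisfies? v α p ε)) (any? (satisfies? v (zipWith _xor_ (vals x v) α) p (lookup x p xor ε)))

  link-moved : ∀ x a c → link a c ≡ link (move-main x a) (move-main x c)
  link-moved x (lit p ε)  (lit q η)  = refl
  link-moved x (lit p ε)  (cell v α) = meets-moved x v α p ε
  link-moved x (cell v α) (lit p ε)  = meets-moved x v α p ε
  link-moved x (cell v α) (cell w β) = refl

  owner-main : Main → Fin n
  owner-main (lit p ε)  = tail p
  owner-main (cell v α) = v

  -- The path and its leaves never move, so their owner is irrelevant.
  owner : Fin n → Vertex → Fin n
  owner default (main a) = owner-main a
  owner default (path i) = default
  owner default (leaf i) = default

  move-owner : ∀ {default} x u → owner default (move x u) ≡ owner default u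
  move-owner x (main (lit p ε))  = refl
  move-owner x (main (cell v α)) = refl
  move-owner x (path i)          = refl
  move-owner x (leaf i)          = refl

  move-local : ∀ {default} x y u → (∀ s → val x (owner default u) s ≡ val y (owner default u) s) → move x u ≡ move y u
  move-local x y (main (lit p ε))  agree =
    let s , e = tail-edge p
    in cong (λ b → main (lit p (b xor ε))) (subst (λ q → lookup x q ≡ lookup y q) e (agree s))
  move-local x y (main (cell v α)) agree = cong (λ z → main (cell v (zipWith _xor_ z α))) (tabulate-cong agree)
  move-local x y (path i)          agree = refl
  move-local x y (leaf i)          agree = refl

  untwisted : Fin n → Bool
  untwisted _ = false

  module _ {default : Fin n} {x : State} {b : Fin n → Bool} {w : Fin n} (∂x : ∀ v → v ≢ w → ∂ x v ≡ b v) where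

    -- Moving changes the parity of a cell at `v` by `∂ x v`, which away from `w` is exactly the
    -- twist `b v`.
    colour-moved : ∀ a → owner-main a ≢ w → colour untwisted a ≡ colour b (move-main x a)
    colour-moved (lit p ε)  _   = refl
    colour-moved (cell v α) v≢w = cong (λ z → (n ℕ.* d) ↑ʳ combine v (bit₂ z)) (begin
      parity α xor false                                 ≡⟨ Bool.xor-identityʳ (parity α) ⟩
      parity α                                           ≡⟨ sym (xor-cancelˡ (b v) (parity α)) ⟩
      b v xor (b v xor parity α)                         ≡⟨ Bool.xor-comm (b v) _ ⟩
      (b v xor parity α) xor b v                         ≡⟨ cong (λ z → (z xor parity α) xor b v) (sym (∂x v v≢w)) ⟩
      (∂ x v xor parity α) xor b v                       ≡⟨ cong (_xor b v) (sym (parity-moved x v α)) ⟩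
      parity (zipWith _xor_ (vals x v) α) xor b v        ∎)
      where open ≡-Reasoning

    move-preserves : ∀ u₁ u₂ → owner default u₁ ≢ w → owner default u₂ ≢ w →
                     adjacent (colour untwisted) u₁ u₂ ≡ adjacent (colour b) (move x u₁) (move x u₂)
    move-preserves (main a) (main c) _ _ = link-moved x a c
    move-preserves (main a) (path i) o _ = cong (λ c → does (i ≟ suc c)) (colour-moved a o)
    move-preserves (main a) (leaf i) _ _ = refl
    move-preserves (path i) (main a) _ o = cong (λ c → does (i ≟ suc c)) (colour-moved a o)
    move-preserves (path i) (path j) _ _ = refl
    move-preserves (path i) (leaf j) _ _ = refl
    move-preserves (leaf i) (main a) _ _ = refl
    move-preserves (leaf i) (path j) _ _ = refl
    move-preserves (leaf i) (leaf j) _ _ = refl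

  module _ (s₀ : Fin (d ℕ.+ d)) where

    linked : ∀ a → ∃[ c ] link a c ≡ true
    linked (lit p ε)  = let s , e = tail-edge p in
      cell (tail p) (replicate _ ε) , dec-true (any? (satisfies? (tail p) (replicate _ ε) p ε)) (s , e , lookup-replicate s ε)
    linked (cell v α) = lit (edge v s₀) (lookup α s₀) ,
      dec-true (any? (satisfies? v α (edge v s₀) (lookup α s₀))) (s₀ , refl , refl)

    with-parity : ∀ b → ∃[ α ] parity α ≡ b
    with-parity true  = ⁅ s₀ ⁆ , trans (⊕.∑-cong (lookup-⁅⁆ s₀)) (⨁-δ s₀)
    with-parity false = ⊥ , trans (⊕.∑-cong (lookup-⊥ {d ℕ.+ d})) (⨁-false _)

    onto : ∀ b c → ∃[ a ] colour b a ≡ c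
    onto b c with splitAt (n ℕ.* d) c in eq
    ... | inj₁ p = lit p false , trans (cong [ _↑ˡ (n ℕ.* 2) , (n ℕ.* d) ↑ʳ_ ]′ (sym eq)) (join-splitAt (n ℕ.* d) (n ℕ.* 2) c)
    ... | inj₂ k with Inverse.to *↔× k in eq′
    ...   | v , i with with-parity (Inverse.to 2↔Bool i xor b v)
    ...     | α , e = cell v α , trans (cong (λ z → (n ℕ.* d) ↑ʳ combine v (bit₂ (z xor b v))) e)
      (trans (cong (λ z → (n ℕ.* d) ↑ʳ combine v z) (trans (cong bit₂ (cancelʳ (Inverse.to 2↔Bool i) (b v))) (Inverse.inverseʳ 2↔Bool refl)))
        (trans (cong ((n ℕ.* d) ↑ʳ_) (Inverse.inverseʳ *↔× (sym eq′)))
          (trans (cong [ _↑ˡ (n ℕ.* 2) , (n ℕ.* d) ↑ʳ_ ]′ (sym eq)) (join-splitAt (n ℕ.* d) (n ℕ.* 2) c))))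
      where
      cancelʳ : ∀ a b → (a xor b) xor b ≡ a
      cancelʳ a b = trans (Bool.xor-comm (a xor b) b) (trans (cong (b xor_) (Bool.xor-comm a b)) (xor-cancelˡ b a))

    -- Colours keep each literal over its edge and each cell at its vertex, so an isomorphism yields
    -- a labelling `x` of the edges; the image of the zero cell at `v` carries the values of `x`
    -- and, by its colour, has parity `b v`.
    not-isomorphic : ∀ {b v₀} → (∀ v → b v ≡ δ v₀ v) → ¬ Isomorphism (colour untwisted) (colour b)
    not-isomorphic {b} {v₀} b≡δ φ = contradiction (trans (sym total) (∂-total x)) λ ()
      where
      open Isomorphism φ
      c₀ : Fin colours
      c₀ = (n ℕ.* d) ↑ʳ combine v₀ zero

      main-image : ∀ a → ∃[ c ] f (main a) ≡ main c × colour b c ≡ colour untwisted a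
      main-image = f-main c₀ linked (onto untwisted) (onto b) φ

      lit-image : ∀ p → ∃[ ε ] f (main (lit p true)) ≡ main (lit p ε)
      lit-image p with main-image (lit p true)
      ... | lit q ε  , e , same = ε , trans e (cong (λ q → main (lit q ε)) (↑ˡ-injective (n ℕ.* 2) q p same))
      ... | cell v α , e , same with () ← trans (sym (splitAt-↑ʳ (n ℕ.* d) (n ℕ.* 2) _))
                                           (trans (cong (splitAt (n ℕ.* d)) same) (splitAt-↑ˡ (n ℕ.* d) p (n ℕ.* 2)))

      -- `x` marks the edges whose two literals are exchanged.
      x : State
      x = tabulate λ p → not (proj₁ (lit-image p))

      parity-⊥ : parity ⊥ ≡ false
      parity-⊥ = trans (⊕.∑-cong (lookup-⊥ {d ℕ.+ d})) (⨁-false _)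

      cell-image : ∀ v → ∃[ α ] f (main (cell v ⊥)) ≡ main (cell v α) × parity α ≡ b v
      cell-image v with main-image (cell v ⊥)
      ... | lit q ε  , e , same with () ← trans (sym (splitAt-↑ˡ (n ℕ.* d) q (n ℕ.* 2)))
                                           (trans (cong (splitAt (n ℕ.* d)) same) (splitAt-↑ʳ (n ℕ.* d) (n ℕ.* 2) _))
      ... | cell u α , e , same with combine-injective u _ v _ (↑ʳ-injective (n ℕ.* d) _ _ same)
      ...   | refl , same₂ = α , e , xor-≡-false (trans (bit₂-injective same₂) (trans (Bool.xor-identityʳ (parity ⊥)) parity-⊥))

      not-≢ : ∀ a c → a ≢ c → a ≡ not c
      not-≢ true  true  a≢c = contradiction refl a≢c
      not-≢ true  false a≢c = refl
      not-≢ false true  a≢c = refl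
      not-≢ false false a≢c = contradiction refl a≢c

      cell-values : ∀ v s → lookup (proj₁ (cell-image v)) s ≡ val x v s
      cell-values v s with cell-image v
      ... | α , e , _ = trans (not-≢ (lookup α s) (proj₁ (lit-image p)) avoid) (sym (lookup∘tabulate (not ∘ proj₁ ∘ lit-image) p))
        where
        p : Fin (n ℕ.* d)
        p = edge v s
        -- Non-adjacency constrains every slot that carries `p`, whereas adjacency would speak of
        -- only one of the two slots of a loop.
        unmet : meets v ⊥ p true ≡ false
        unmet = dec-false (any? (satisfies? v ⊥ p true)) λ (t , _ , ⊥t) → contradiction (trans (sym (lookup-⊥ {d ℕ.+ d} t)) ⊥t) λ ()
        unmet′ : meets v α p (proj₁ (lit-image p)) ≡ false
        unmet′ = trans (sym (trans (preserves (main (cell v ⊥)) (main (lit p true)))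
                               (cong₂ (adjacent (colour b)) e (proj₂ (lit-image p))))) unmet
        avoid : lookup α s ≢ proj₁ (lit-image p)
        avoid eq = does-false (any? (satisfies? v α p (proj₁ (lit-image p)))) unmet′ (s , refl , eq)

      boundary : ∀ v → ∂ x v ≡ b v
      boundary v = trans (sym (⊕.∑-cong (cell-values v))) (proj₂ (proj₂ (cell-image v)))

      total : ⨁ (∂ x) ≡ true
      total = trans (⊕.∑-cong λ v → trans (boundary v) (b≡δ v)) (⨁-δ v₀)

  opaque
    enumeration : Vertex ↔ Fin (gadget-size n d)
    enumeration = ↔-sym +↔⊎ ↔-∘ ((Main↔ ⊎-↔ ↔-sym +↔⊎) ↔-∘ sum)
      where
      sum : Vertex ↔ (Main ⊎ (Fin (suc colours) ⊎ Fin (suc colours)))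
      sum = mk↔ₛ′ (λ { (main a) → inj₁ a ; (path i) → inj₂ (inj₁ i) ; (leaf i) → inj₂ (inj₂ i) })
                  (λ { (inj₁ a) → main a ; (inj₂ (inj₁ i)) → path i ; (inj₂ (inj₂ i)) → leaf i })
                  (λ { (inj₁ a) → refl ; (inj₂ (inj₁ i)) → refl ; (inj₂ (inj₂ i)) → refl })
                  (λ { (main a) → refl ; (path i) → refl ; (leaf i) → refl })
      pairs : Main ↔ ((Fin (n ℕ.* d) × Bool) ⊎ (Fin n × Vec Bool (d ℕ.+ d)))
      pairs = mk↔ₛ′ (λ { (lit p ε) → inj₁ (p , ε) ; (cell v α) → inj₂ (v , α) })
                    (λ { (inj₁ (p , ε)) → lit p ε ; (inj₂ (v , α)) → cell v α })
                    (λ { (inj₁ _) → refl ; (inj₂ _) → refl }) (λ { (lit p ε) → refl ; (cell v α) → refl })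
      Main↔ : Main ↔ Fin ((n ℕ.* d) ℕ.* 2 ℕ.+ n ℕ.* 2 ℕ.^ (d ℕ.+ d))
      Main↔ = ↔-sym +↔⊎ ↔-∘ (((↔-sym *↔× ↔-∘ (↔-id _ ×-↔ ↔-sym 2↔Bool)) ⊎-↔ (↔-sym *↔× ↔-∘ (↔-id _ ×-↔ Vec-Bool↔Fin (d ℕ.+ d)))) ↔-∘ pairs)

  index : Vertex → Fin (gadget-size n d)
  index = Inverse.to enumeration

  vertex : Fin (gadget-size n d) → Vertex
  vertex = Inverse.from enumeration

  index-vertex : ∀ i → index (vertex i) ≡ i
  index-vertex i = Inverse.inverseˡ enumeration refl

  vertex-index : ∀ u → vertex (index u) ≡ u
  vertex-index u = Inverse.inverseʳ enumeration refl

  graph : (Fin n → Bool) → Graph (gadget-size n d)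
  graph b = record
    { adj    = λ i j → adjacent (colour b) (vertex i) (vertex j)
    ; symm   = λ i j → adjacent-symm link-symm (colour b) (vertex i) (vertex j)
    ; irrefl = λ i → adjacent-irrefl link-irrefl (colour b) (vertex i)
    }

  ≅⇒isomorphism : ∀ {b b′} → graph b ≅ graph b′ → Isomorphism (colour b) (colour b′)
  ≅⇒isomorphism {b} {b′} (ψ , iso) = record
    { f = λ u → vertex (ψ ⟨$⟩ʳ index u)
    ; g = λ u → vertex (ψ ⟨$⟩ˡ index u)
    ; g∘f = λ u → trans (cong vertex (trans (cong (ψ ⟨$⟩ˡ_) (index-vertex _)) (Perm.inverseˡ ψ))) (vertex-index u)
    ; f∘g = λ u → trans (cong vertex (trans (cong (ψ ⟨$⟩ʳ_) (index-vertex _)) (Perm.inverseʳ ψ))) (vertex-index u)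
    ; preserves = λ u v → trans (sym (cong₂ (adjacent (colour b)) (vertex-index u) (vertex-index v))) (iso (index u) (index v))
    }

-- The lower bound

-- A combination of no points has total weight 0; tolerance 1/2 separates this from 1.
Conv-empty : ∀ {M} {S : Pred (Vector ℝ M) 0ℓ} → Empty S → Empty (Conv S)
Conv-empty empty x (zero  , w , p , _ , (_ , 1≤0) , _) =
  let K , 1≤½ = 1≤0 ½ (ℚ.positive⁻¹ ½) in contradiction (1≤½ K ℕ.≤-refl) λ { (ℚ.*≤* (ℤ.+≤+ (s≤s ()))) }
Conv-empty empty x (suc m , w , p , _ , _ , p∈S , _) = empty (p zero) (p∈S zero)

/1≃ : ∀ a → toℚᵘ (ℤ.+ a ℚ./ 1) ℚᵘ.≃ mkℚᵘ (ℤ.+ a) 0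
/1≃ a = ℚ.toℚᵘ-fromℚᵘ (mkℚᵘ (ℤ.+ a) 0)

/1-mono-* : ∀ a b c → a ≤ b ℕ.* c → ℤ.+ a ℚ./ 1 ℚ.≤ (ℤ.+ b ℚ./ 1) ℚ.* (ℤ.+ c ℚ./ 1)
/1-mono-* a b c a≤bc = ℚ.toℚᵘ-cancel-≤ (begin
  toℚᵘ (ℤ.+ a ℚ./ 1)                           ≃⟨ /1≃ a ⟩
  mkℚᵘ (ℤ.+ a) 0                               ≤⟨ *≤* (subst₂ ℤ._≤_ (sym (ℤ.*-identityʳ (ℤ.+ a)))
                                                    (sym (trans (ℤ.*-identityʳ _) (sym (ℤ.pos-* b c)))) (ℤ.+≤+ a≤bc)) ⟩
  mkℚᵘ (ℤ.+ b) 0 ℚᵘ.* mkℚᵘ (ℤ.+ c) 0           ≃⟨ ℚᵘ.≃-sym (ℚᵘ.*-cong (/1≃ b) (/1≃ c)) ⟩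
  toℚᵘ (ℤ.+ b ℚ./ 1) ℚᵘ.* toℚᵘ (ℤ.+ c ℚ./ 1)   ≃⟨ ℚᵘ.≃-sym (ℚ.toℚᵘ-homo-* (ℤ.+ b ℚ./ 1) (ℤ.+ c ℚ./ 1)) ⟩
  toℚᵘ ((ℤ.+ b ℚ./ 1) ℚ.* (ℤ.+ c ℚ./ 1))       ∎)
  where open ℚᵘ.≤-Reasoning

¼ : ℚ
¼ = ½ ℚ.* ½

/1-mono-¼ : ∀ n k → n ≤ 4 ℕ.* k → ¼ ℚ.* (ℤ.+ n ℚ./ 1) ℚ.≤ ℤ.+ k ℚ./ 1
/1-mono-¼ n k n≤4k = begin
  ¼ ℚ.* (ℤ.+ n ℚ./ 1)                     ≤⟨ ℚ.*-monoˡ-≤-nonNeg ¼ (/1-mono-* n 4 k n≤4k) ⟩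
  ¼ ℚ.* ((ℤ.+ 4 ℚ./ 1) ℚ.* (ℤ.+ k ℚ./ 1))  ≡⟨ sym (ℚ.*-assoc ¼ (ℤ.+ 4 ℚ./ 1) (ℤ.+ k ℚ./ 1)) ⟩
  1ℚ ℚ.* (ℤ.+ k ℚ./ 1)                    ≡⟨ ℚ.*-identityˡ _ ⟩
  ℤ.+ k ℚ./ 1                             ∎
  where open ℚ.≤-Reasoning

≤ℝ-pointwise : ∀ x y → (∀ m → seq x m ℚ.≤ seq y m) → x ≤ℝ y
≤ℝ-pointwise x y x≤y ε 0<ε = 0 , λ m _ → ℚ.≤-trans (x≤y m)
  (subst (ℚ._≤ seq y m ℚ.+ ε) (ℚ.+-identityʳ (seq y m)) (ℚ.+-monoʳ-≤ (seq y m) (ℚ.<⇒≤ 0<ε)))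

0<fromℚ : ∀ {q} → 0ℚ ℚ.< q → 0ℝ <ℝ fromℚ q
0<fromℚ {q} 0<q = q , 0<q , 0 , λ _ _ → ℚ.≤-reflexive (ℚ.+-identityˡ q)

-- Each of the `10m` base vertices accounts for `4d + 4 + 2^(2d)` vertices; the last 2 pays for
-- `path zero` and its leaf.
size-constant : ℕ → ℕ
size-constant d = 10 ℕ.* (4 ℕ.* d ℕ.+ 4 ℕ.+ 2 ℕ.^ (d ℕ.+ d)) ℕ.+ 2

size-bound : ∀ d m → 1 ≤ m → gadget-size (5 ℕ.* (2 ℕ.* m)) d ≤ size-constant d ℕ.* m
size-bound d m 1≤m = begin
  gadget-size (5 ℕ.* (2 ℕ.* m)) d                     ≡⟨ regroup m d (2 ℕ.^ (d ℕ.+ d)) ⟩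
  10 ℕ.* (4 ℕ.* d ℕ.+ 4 ℕ.+ 2 ℕ.^ (d ℕ.+ d)) ℕ.* m ℕ.+ 2  ≤⟨ ℕ.+-monoʳ-≤ (10 ℕ.* (4 ℕ.* d ℕ.+ 4 ℕ.+ 2 ℕ.^ (d ℕ.+ d)) ℕ.* m) (ℕ.*-monoʳ-≤ 2 1≤m) ⟩
  10 ℕ.* (4 ℕ.* d ℕ.+ 4 ℕ.+ 2 ℕ.^ (d ℕ.+ d)) ℕ.* m ℕ.+ 2 ℕ.* m  ≡⟨ sym (ℕ.*-distribʳ-+ m (10 ℕ.* (4 ℕ.* d ℕ.+ 4 ℕ.+ 2 ℕ.^ (d ℕ.+ d))) 2) ⟩
  size-constant d ℕ.* m                               ∎
  where
  open ℕ.≤-Reasoning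
  regroup : ∀ m d P →
    ((5 ℕ.* (2 ℕ.* m) ℕ.* d) ℕ.* 2 ℕ.+ 5 ℕ.* (2 ℕ.* m) ℕ.* P) ℕ.+
      (suc (5 ℕ.* (2 ℕ.* m) ℕ.* d ℕ.+ 5 ℕ.* (2 ℕ.* m) ℕ.* 2) ℕ.+ suc (5 ℕ.* (2 ℕ.* m) ℕ.* d ℕ.+ 5 ℕ.* (2 ℕ.* m) ℕ.* 2))
    ≡ 10 ℕ.* (4 ℕ.* d ℕ.+ 4 ℕ.+ P) ℕ.* m ℕ.+ 2
  regroup = solve-∀

record Hard {N : ℕ} (m : ℕ) (G H : Graph N) : Set where
  field
    non-isomorphic : ¬ (G ≅ H)
    feasible       : ∀ {k} → 1 ≤ k → k ℕ.+ k ℕ.+ 2 ≤ m →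
                     (∃[ x ] SheraliAdams (𝒯 G H) k x) × (∃[ x ] SheraliAdams (𝒬 G H) k x)

module _ (d : ℕ) (4<5 : 4 ℕ.^ (5 ℕ.+ d) ℕ.< 5 ℕ.^ d) (s₀ : Fin (d ℕ.+ d)) where

  hard-pair : ∀ m → 1 ≤ m → Σ[ G ∈ Graph (gadget-size (5 ℕ.* (2 ℕ.* m)) d) ] ∃[ H ] Hard m G H
  hard-pair m 1≤m = graph untwisted , graph (δ v₀) , record
    { non-isomorphic = λ iso → not-isomorphic s₀ {v₀ = v₀} (λ _ → refl) (≅⇒isomorphism iso)
    ; feasible       = λ 1≤k small → 𝒯-feasible 1≤k small , 𝒬-feasible 1≤k small
    }
    where
    t n : ℕ
    -- Chosen so that deleting `m` vertices leaves just the room that `giant-exists` asks for: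
    -- `4t + 2m = 5t = n`.
    t = 2 ℕ.* m
    n = 5 ℕ.* t
    1≤t : 1 ≤ t
    1≤t = ℕ.≤-trans 1≤m (ℕ.m≤m+n m (m ℕ.+ 0))
    good = Counting.mixing-permutation t d 1≤t 4<5
    σ : Permutation′ (n ℕ.* d)
    σ = proj₁ good
    default : Fin n
    default = fromℕ< (ℕ.≤-trans 1≤t (ℕ.m≤m+n t (4 ℕ.* t)))
    open Multigraph {n} {d} σ
    open Averaging {n} {d} σ default
    open CFI {n} {d} σ
    mixing : Mixing t
    mixing A B t≤A t≤B =
      let p , pA , pB = proj₂ good A B t≤A t≤B
      in p , lookup⇒[]= (tail p) A pA , lookup⇒[]= (head p) B pB
    giants : ∀ Z → ∣ Z ∣ ≤ m → ∃[ w ] Giant Z w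
    giants Z Z≤m = giant-exists Z 1≤t mixing (begin
      4 ℕ.* t ℕ.+ 2 ℕ.* ∣ Z ∣    ≤⟨ ℕ.+-monoʳ-≤ (4 ℕ.* t) (ℕ.*-monoʳ-≤ 2 Z≤m) ⟩
      4 ℕ.* t ℕ.+ t              ≡⟨ ℕ.+-comm (4 ℕ.* t) t ⟩
      n                          ∎)
      where open ℕ.≤-Reasoning
    open Coloured {Main} {colours} link using (adjacent)
    Φ : State → Fin (gadget-size n d) → Fin (gadget-size n d)
    Φ x i = index (move x (vertex i))
    owner′ : Fin (gadget-size n d) → Fin n
    owner′ i = owner default (vertex i)
    Φ-involutive : ∀ x i → Φ x (Φ x i) ≡ i
    Φ-involutive x i = trans (cong (index ∘ move x) (vertex-index _))
      (trans (cong index (move-involutive x (vertex i))) (index-vertex i))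
    Φ-owner : ∀ x i → owner′ (Φ x i) ≡ owner′ i
    Φ-owner x i = trans (cong (owner default) (vertex-index _)) (move-owner x (vertex i))
    Φ-local : ∀ x y i → (∀ s → val x (owner′ i) s ≡ val y (owner′ i) s) → Φ x i ≡ Φ y i
    Φ-local x y i agree = cong index (move-local x y (vertex i) agree)
    Φ-preserves : ∀ w x → Ω w x → ∀ i j → owner′ i ≢ w → owner′ j ≢ w →
                  adj (graph untwisted) i j ≡ adj (graph (δ v₀)) (Φ x i) (Φ x j)
    Φ-preserves w x ω i j i≢w j≢w = trans
      (move-preserves {default} {x} {δ v₀} {w}
        (λ v v≢w → trans (ω v) (trans (cong (δ v₀ v xor_) (dec-false (w ≟ v) (v≢w ∘ sym))) (Bool.xor-identityʳ (δ v₀ v))))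
        (vertex i) (vertex j) i≢w j≢w)
      (sym (cong₂ (adjacent (colour (δ v₀))) (vertex-index (move x (vertex i))) (vertex-index (move x (vertex j)))))
    open Relaxation {n} {d} σ default
    open Moves {m} giants (graph untwisted) (graph (δ v₀)) Φ owner′ Φ-involutive Φ-owner Φ-local Φ-preserves

  pair : ∀ n → Σ[ G ∈ Graph (gadget-size (5 ℕ.* (2 ℕ.* n)) d) ] Σ[ H ∈ Graph (gadget-size (5 ℕ.* (2 ℕ.* n)) d) ]
         (1 ≤ n → Hard n G H)
  -- A filler: index 0 lies below `n₀ = 1`.
  pair zero      = let open CFI {5 ℕ.* (2 ℕ.* 0)} {d} Perm.id in graph untwisted , graph untwisted , λ ()
  pair n@(suc _) = let G , H , hard = hard-pair n (s≤s z≤n) in G , H , λ _ → hard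

  -- Feasibility is known while `2k + 2 ≤ n`, and `2k + 2 ≤ 4k` for `k ≥ 1`.
  linear-lower-bound : ∀ {n k} {G H : Graph (gadget-size (5 ℕ.* (2 ℕ.* n)) d)} → Hard n G H → 1 ≤ k →
    (¬ ((∃[ x ] SheraliAdams (𝒯 G H) k x) × (∃[ x ] SheraliAdams (𝒬 G H) k x))) → n ≤ 4 ℕ.* k
  linear-lower-bound {n} {k} hard 1≤k infeasible with n ℕ.≤? 4 ℕ.* k
  ... | yes n≤4k = n≤4k
  ... | no  n≰4k = contradiction (Hard.feasible hard 1≤k (begin
    k ℕ.+ k ℕ.+ 2         ≤⟨ ℕ.+-monoʳ-≤ (k ℕ.+ k) (ℕ.+-mono-≤ 1≤k 1≤k) ⟩
    k ℕ.+ k ℕ.+ (k ℕ.+ k) ≡⟨ regroup k ⟩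
    4 ℕ.* k               ≤⟨ ℕ.<⇒≤ (ℕ.≰⇒> n≰4k) ⟩
    n                     ∎)) infeasible
    where
    open ℕ.≤-Reasoning
    regroup : ∀ k → k ℕ.+ k ℕ.+ (k ℕ.+ k) ≡ 4 ℕ.* k
    regroup = solve-∀

  size-of : ℕ → ℕ
  size-of n = gadget-size (5 ℕ.* (2 ℕ.* n)) d

  left right : ∀ n → Graph (size-of n)
  left  n = proj₁ (pair n)
  right n = proj₁ (proj₂ (pair n))

  hard-family : ∀ n → 1 ≤ n →
    (¬ (left n ≅ right n)) ×
    (fromℕ (size-of n) ≤ℝ fromℕ (size-constant d) *ℝ fromℕ n) ×
    Empty (Conv (Ψ (left n) (right n))) ×
    (∀ k → 1 ≤ k → Empty (SheraliAdams (𝒯 (left n) (right n)) k) → fromℚ ¼ *ℝ fromℕ n ≤ℝ fromℕ k) ×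
    (∀ k → 1 ≤ k → Empty (SheraliAdams (𝒬 (left n) (right n)) k) → fromℚ ¼ *ℝ fromℕ n ≤ℝ fromℕ k)
  hard-family n 1≤n =
    Hard.non-isomorphic hard ,
    ≤ℝ-pointwise (fromℕ (size-of n)) (fromℕ (size-constant d) *ℝ fromℕ n)
      (λ _ → /1-mono-* (size-of n) (size-constant d) n (size-bound d n 1≤n)) ,
    Conv-empty {S = Ψ (left n) (right n)} (λ _ (ψ , iso , _) → Hard.non-isomorphic hard (ψ , iso)) ,
    (λ k 1≤k empty → quarter k (linear-lower-bound hard 1≤k λ (feasible , _) → empty (proj₁ feasible) (proj₂ feasible))) ,
    (λ k 1≤k empty → quarter k (linear-lower-bound hard 1≤k λ (_ , feasible) → empty (proj₁ feasible) (proj₂ feasible)))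
    where
    hard : Hard n (left n) (right n)
    hard = proj₂ (proj₂ (pair n)) 1≤n
    quarter : ∀ k → n ≤ 4 ℕ.* k → fromℚ ¼ *ℝ fromℕ n ≤ℝ fromℕ k
    quarter k n≤4k = ≤ℝ-pointwise (fromℚ ¼ *ℝ fromℕ n) (fromℕ k) λ _ → /1-mono-¼ n k n≤4k

  0<size-constant : 0ℝ <ℝ fromℕ (size-constant d)
  0<size-constant = 0<fromℚ (ℚ.<-≤-trans (ℚ.positive⁻¹ 1ℚ) (ℚ.≤-trans
    (/1-mono-* 1 (size-constant d) 1 (ℕ.≤-trans (s≤s z≤n) (ℕ.≤-trans (ℕ.m≤n+m 2 _) (ℕ.≤-reflexive (sym (ℕ.*-identityʳ (size-constant d)))))))
    (ℚ.≤-reflexive (ℚ.*-identityʳ (ℤ.+ size-constant d ℚ./ 1)))))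

corollary1p4 : Σ[ c ∈ ℝ ] Σ[ C ∈ ℝ ] (0ℝ <ℝ c) × (0ℝ <ℝ C) × (Σ[ n₀ ∈ ℕ ] Σ[ N ∈ (ℕ → ℕ) ]
    Σ[ G ∈ ((n : ℕ) → Graph (N n)) ] Σ[ H ∈ ((n : ℕ) → Graph (N n)) ]
    ((n : ℕ) → n₀ ≤ n →
    (¬ (G n ≅ H n)) ×
    (fromℕ (N n) ≤ℝ C *ℝ fromℕ n) ×
    Empty (Conv (Ψ (G n) (H n))) ×
    ((k : ℕ) → 1 ≤ k → Empty (SheraliAdams (𝒯 (G n) (H n)) k) → c *ℝ fromℕ n ≤ℝ fromℕ k) ×
    ((k : ℕ) → 1 ≤ k → Empty (SheraliAdams (𝒬 (G n) (H n)) k) → c *ℝ fromℕ n ≤ℝ fromℕ k)))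
corollary1p4 =
  fromℚ ¼ , fromℕ (size-constant 32) , 0<fromℚ (ℚ.positive⁻¹ ¼) , 0<size-constant 32 32-mixes zero ,
  1 , size-of 32 32-mixes zero , left 32 32-mixes zero , right 32 32-mixes zero , hard-family 32 32-mixes zero
  where
  -- The union bound needs `(5/4)^d > 4^5`, and 32 is the least such `d`.
  32-mixes : 4 ℕ.^ 37 ℕ.< 5 ℕ.^ 32
  32-mixes = ℕ.<ᵇ⇒< (4 ℕ.^ 37) (5 ℕ.^ 32) _
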